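{- Let $K=\mathbb{Q}(\sqrt{p},\sqrt{q})$ be a real biquadratic field, where $p,q>1$ are distinct squarefree integers, and let $\mathcal{O}_K$ be its ring of integers. Then there does not exist a $\mathbb{Z}$-form that is universal over $\mathcal{O}_K$.
   Context: A $\mathbb{Z}$-form is a positive definite quadratic form $Q(x_1,\dots,x_r)=\sum_{1\le i\le j\le r}a_{ij}x_ix_j$ with all $a_{ij}\in\mathbb{Z}$. An element of $\mathcal{O}_K$ is totally positive if its image under each of the four real embeddings of $K$ is positive. A $\mathbb{Z}$-form $Q$ is universal over $\mathcal{O}_K$ if every totally positive $\alpha\in\mathcal{O}_K$ equals $Q(v)$ for some $v\in\mathcal{O}_K^r$. -}

module Defs where

open import Algebra.Bundles.Raw using (RawRing)
import Algebra.Definitions.RawSemiring as RawSemiringDefinitions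
open import Algebra.Morphism.Structures using (module RingMorphisms)
open import Data.Bool.Base using (if_then_else_)
open import Data.Fin.Base using (Fin; toℕ)
open import Data.Fin.Properties using (_≤?_)
open import Data.Integer.Base as ℤ using (ℤ; +_; -[1+_])
open import Data.Nat.Base as ℕ using (ℕ; suc)
open import Data.Nat.Divisibility using (_∣_)
import Data.Nat.Properties as ℕₚ
open import Data.Product.Base using (Σ-syntax; ∃-syntax; _×_; _,_)
open import Data.Rational.Base as ℚ using (ℚ; 0ℚ; 1ℚ; ½; ∣_∣)
import Data.Rational.Properties as ℚₚ
open import Data.Rational.Solver using (module +-*-Solver)
open import Data.Vec.Functional using (Vector)
open import Level using (0ℓ)
open import Relation.Binary.PropositionalEquality
  using (_≡_; refl; sym; trans; cong; cong₂; subst)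
open import Relation.Nullary.Decidable using (does)
open import Relation.Nullary.Negation using (¬_)

SquareFree : ℕ → Set
SquareFree n = ∀ d → d ℕ.* d ∣ n → d ≡ 1

------------------------------------------------------------------------
-- Quadratic forms and integrality over a ring

module OverRing {c ℓ} (R : RawRing c ℓ) where
  open RawRing R
  open RawSemiringDefinitions rawSemiring public
    using (sum; _^_) renaming (_×_ to _·_)

  fromℤ : ℤ → Carrier
  fromℤ (+ n)    = n · 1#
  fromℤ -[1+ n ] = - (suc n · 1#)

  -- The form Σ_{i ≤ j} aᵢⱼ xᵢ xⱼ; the entries aᵢⱼ with j < i are not used.
  evalForm : ∀ {r} → (Fin r → Fin r → ℤ) → Vector Carrier r → Carrier
  evalForm a x = sum λ i → sum λ j →
    if does (i ≤? j) then fromℤ (a i j) * (x i * x j) else 0#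

  IsIntegral : Carrier → Set ℓ
  IsIntegral x = ∃[ n ] Σ[ c ∈ Vector ℤ n ]
    x ^ n + sum (λ i → fromℤ (c i) * x ^ toℕ i) ≈ 0#

-- Definiteness is over ℤ; for integral coefficients it is equivalent to
-- definiteness over the reals.
record ℤForm : Set where
  field
    rank             : ℕ
    coeff            : Fin rank → Fin rank → ℤ
    positiveDefinite : ∀ (x : Vector ℤ rank) → ¬ (∀ i → x i ≡ + 0) →
                       + 0 ℤ.< OverRing.evalForm ℤ.+-*-rawRing coeff x

------------------------------------------------------------------------
-- The real numbers, as Cauchy sequences of rationals

IsCauchy : (ℕ → ℚ) → Set
IsCauchy x = ∀ ε → 0ℚ ℚ.< ε → ∃[ N ] (∀ m n → N ℕ.≤ m → N ℕ.≤ n →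
               ∣ x m ℚ.- x n ∣ ℚ.< ε)

record ℝ : Set where
  constructor mkℝ
  field
    seq    : ℕ → ℚ
    cauchy : IsCauchy seq
open ℝ

infix 4 _≈ℝ_
_≈ℝ_ : ℝ → ℝ → Set
x ≈ℝ y = ∀ ε → 0ℚ ℚ.< ε → ∃[ N ] (∀ n → N ℕ.≤ n → ∣ seq x n ℚ.- seq y n ∣ ℚ.< ε)

Positiveℝ : ℝ → Set
Positiveℝ x = ∃[ ε ] (0ℚ ℚ.< ε × ∃[ N ] (∀ n → N ℕ.≤ n → ε ℚ.< seq x n))

constℝ : ℚ → ℝ
constℝ q = mkℝ (λ _ → q) λ ε 0<ε → 0 , λ _ _ _ _ →
  subst (λ d → ∣ d ∣ ℚ.< ε) (sym (ℚₚ.+-inverseʳ q)) 0<ε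

private
  open +-*-Solver

  half-pos : ∀ {ε} → 0ℚ ℚ.< ε → 0ℚ ℚ.< ½ ℚ.* ε
  half-pos {ε} 0<ε =
    subst (ℚ._< ½ ℚ.* ε) (ℚₚ.*-zeroʳ ½) (ℚₚ.*-monoʳ-<-pos ½ 0<ε)

  half+half : ∀ ε → ½ ℚ.* ε ℚ.+ ½ ℚ.* ε ≡ ε
  half+half ε = trans (sym (ℚₚ.*-distribʳ-+ ε ½ ½)) (ℚₚ.*-identityˡ ε)

  +-cauchy : ∀ {x y} → IsCauchy x → IsCauchy y → IsCauchy (λ n → x n ℚ.+ y n)
  +-cauchy {x} {y} cx cy ε 0<ε
    with M , hx ← cx (½ ℚ.* ε) (half-pos 0<ε)
    with N , hy ← cy (½ ℚ.* ε) (half-pos 0<ε) = M ℕ.⊔ N , bound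
    where
    bound : ∀ m n → M ℕ.⊔ N ℕ.≤ m → M ℕ.⊔ N ℕ.≤ n →
            ∣ (x m ℚ.+ y m) ℚ.- (x n ℚ.+ y n) ∣ ℚ.< ε
    bound m n m≥ n≥ = begin-strict
      ∣ (x m ℚ.+ y m) ℚ.- (x n ℚ.+ y n) ∣
        ≡⟨ cong ∣_∣ (solve 4 (λ a b c d →
             (a :+ b) :- (c :+ d) := (a :- c) :+ (b :- d)) refl
             (x m) (y m) (x n) (y n)) ⟩
      ∣ (x m ℚ.- x n) ℚ.+ (y m ℚ.- y n) ∣
        ≤⟨ ℚₚ.∣p+q∣≤∣p∣+∣q∣ (x m ℚ.- x n) (y m ℚ.- y n) ⟩
      ∣ x m ℚ.- x n ∣ ℚ.+ ∣ y m ℚ.- y n ∣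
        <⟨ ℚₚ.+-mono-< (hx m n (ℕₚ.m⊔n≤o⇒m≤o M N m≥) (ℕₚ.m⊔n≤o⇒m≤o M N n≥))
                       (hy m n (ℕₚ.m⊔n≤o⇒n≤o M N m≥) (ℕₚ.m⊔n≤o⇒n≤o M N n≥)) ⟩
      ½ ℚ.* ε ℚ.+ ½ ℚ.* ε
        ≡⟨ half+half ε ⟩
      ε ∎
      where open ℚₚ.≤-Reasoning

  neg-cauchy : ∀ {x} → IsCauchy x → IsCauchy (λ n → ℚ.- x n)
  neg-cauchy {x} cx ε 0<ε with N , hx ← cx ε 0<ε = N , λ m n m≥ n≥ →
    subst (ℚ._< ε)
      (sym (trans
        (cong ∣_∣ (solve 2 (λ a b → (:- a) :- (:- b) := :- (a :- b)) refl (x m) (x n)))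
        (ℚₚ.∣-p∣≡∣p∣ (x m ℚ.- x n))))
      (hx m n m≥ n≥)

  eventually-bounded : ∀ {x} → IsCauchy x →
    ∃[ N ] ∃[ B ] (0ℚ ℚ.< B × (∀ n → N ℕ.≤ n → ∣ x n ∣ ℚ.< B))
  eventually-bounded {x} cx
    with N , hx ← cx 1ℚ (ℚₚ.positive⁻¹ 1ℚ) =
    N , ∣ x N ∣ ℚ.+ 1ℚ ,
    ℚₚ.+-mono-≤-< (ℚₚ.0≤∣p∣ (x N)) (ℚₚ.positive⁻¹ 1ℚ) , bound
    where
    bound : ∀ n → N ℕ.≤ n → ∣ x n ∣ ℚ.< ∣ x N ∣ ℚ.+ 1ℚ
    bound n n≥ = begin-strict
      ∣ x n ∣
        ≡⟨ cong ∣_∣ (solve 2 (λ a b → a := b :+ (a :- b)) refl (x n) (x N)) ⟩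
      ∣ x N ℚ.+ (x n ℚ.- x N) ∣
        ≤⟨ ℚₚ.∣p+q∣≤∣p∣+∣q∣ (x N) (x n ℚ.- x N) ⟩
      ∣ x N ∣ ℚ.+ ∣ x n ℚ.- x N ∣
        <⟨ ℚₚ.+-monoʳ-< ∣ x N ∣ (hx n N n≥ ℕₚ.≤-refl) ⟩
      ∣ x N ∣ ℚ.+ 1ℚ ∎
      where open ℚₚ.≤-Reasoning

  divide : ∀ C ε → 0ℚ ℚ.< C → 0ℚ ℚ.< ε → ∃[ δ ] (0ℚ ℚ.< δ × C ℚ.* δ ≡ ε)
  divide C ε 0<C 0<ε = ℚ.1/ C ℚ.* ε , ℚₚ.positive⁻¹ (ℚ.1/ C ℚ.* ε) , C/Cε≡ε
    where
    instance
      C-pos : ℚ.Positive C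
      C-pos = ℚ.positive 0<C
      C-nonZero : ℚ.NonZero C
      C-nonZero = ℚₚ.pos⇒nonZero C
      ε-pos : ℚ.Positive ε
      ε-pos = ℚ.positive 0<ε
      1/C-pos : ℚ.Positive (ℚ.1/ C)
      1/C-pos = ℚₚ.1/pos⇒pos C
      δ-pos : ℚ.Positive (ℚ.1/ C ℚ.* ε)
      δ-pos = ℚₚ.pos*pos⇒pos (ℚ.1/ C) ε
    C/Cε≡ε : C ℚ.* (ℚ.1/ C ℚ.* ε) ≡ ε
    C/Cε≡ε = trans (sym (ℚₚ.*-assoc C (ℚ.1/ C) ε))
               (trans (cong (ℚ._* ε) (ℚₚ.*-inverseʳ C)) (ℚₚ.*-identityˡ ε))

  product-close : ∀ {A B δ} → 0ℚ ℚ.< δ → ∀ a b c d →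
    ∣ a ∣ ℚ.< A → ∣ d ∣ ℚ.< B → ∣ b ℚ.- d ∣ ℚ.< δ → ∣ a ℚ.- c ∣ ℚ.< δ →
    ∣ a ℚ.* b ℚ.- c ℚ.* d ∣ ℚ.< (A ℚ.+ B) ℚ.* δ
  product-close {A} {B} {δ} 0<δ a b c d a<A d<B b-d<δ a-c<δ = begin-strict
    ∣ a ℚ.* b ℚ.- c ℚ.* d ∣
      ≡⟨ cong ∣_∣ (solve 4 (λ a b c d →
           a :* b :- c :* d := a :* (b :- d) :+ d :* (a :- c)) refl a b c d) ⟩
    ∣ a ℚ.* (b ℚ.- d) ℚ.+ d ℚ.* (a ℚ.- c) ∣
      ≤⟨ ℚₚ.∣p+q∣≤∣p∣+∣q∣ (a ℚ.* (b ℚ.- d)) (d ℚ.* (a ℚ.- c)) ⟩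
    ∣ a ℚ.* (b ℚ.- d) ∣ ℚ.+ ∣ d ℚ.* (a ℚ.- c) ∣
      ≡⟨ cong₂ ℚ._+_ (ℚₚ.∣p*q∣≡∣p∣*∣q∣ a (b ℚ.- d)) (ℚₚ.∣p*q∣≡∣p∣*∣q∣ d (a ℚ.- c)) ⟩
    ∣ a ∣ ℚ.* ∣ b ℚ.- d ∣ ℚ.+ ∣ d ∣ ℚ.* ∣ a ℚ.- c ∣
      ≤⟨ ℚₚ.+-mono-≤
           (ℚₚ.*-monoˡ-≤-nonNeg ∣ a ∣ {{ℚₚ.∣-∣-nonNeg a}} (ℚₚ.<⇒≤ b-d<δ))
           (ℚₚ.*-monoˡ-≤-nonNeg ∣ d ∣ {{ℚₚ.∣-∣-nonNeg d}} (ℚₚ.<⇒≤ a-c<δ)) ⟩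
    ∣ a ∣ ℚ.* δ ℚ.+ ∣ d ∣ ℚ.* δ
      ≡⟨ sym (ℚₚ.*-distribʳ-+ δ ∣ a ∣ ∣ d ∣) ⟩
    (∣ a ∣ ℚ.+ ∣ d ∣) ℚ.* δ
      <⟨ ℚₚ.*-monoˡ-<-pos δ {{ℚ.positive 0<δ}} (ℚₚ.+-mono-< a<A d<B) ⟩
    (A ℚ.+ B) ℚ.* δ ∎
    where open ℚₚ.≤-Reasoning

  *-cauchy : ∀ {x y} → IsCauchy x → IsCauchy y → IsCauchy (λ n → x n ℚ.* y n)
  *-cauchy {x} {y} cx cy ε 0<ε =
    let M₁ , A , 0<A , bx  = eventually-bounded cx
        N₁ , B , 0<B , by  = eventually-bounded cy
        δ  , 0<δ , Cδ≡ε    = divide (A ℚ.+ B) ε (ℚₚ.+-mono-< 0<A 0<B) 0<ε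
        M₂ , hx            = cx δ 0<δ
        N₂ , hy            = cy δ 0<δ
        M = M₁ ℕ.⊔ M₂
        N = N₁ ℕ.⊔ N₂
    in M ℕ.⊔ N , λ m n m≥ n≥ →
      let M≤m = ℕₚ.m⊔n≤o⇒m≤o M N m≥
          M≤n = ℕₚ.m⊔n≤o⇒m≤o M N n≥
          N≤m = ℕₚ.m⊔n≤o⇒n≤o M N m≥
          N≤n = ℕₚ.m⊔n≤o⇒n≤o M N n≥
      in subst (∣ x m ℚ.* y m ℚ.- x n ℚ.* y n ∣ ℚ.<_) Cδ≡ε
           (product-close 0<δ (x m) (y m) (x n) (y n)
             (bx m (ℕₚ.m⊔n≤o⇒m≤o M₁ M₂ M≤m))
             (by n (ℕₚ.m⊔n≤o⇒m≤o N₁ N₂ N≤n))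
             (hy m n (ℕₚ.m⊔n≤o⇒n≤o N₁ N₂ N≤m) (ℕₚ.m⊔n≤o⇒n≤o N₁ N₂ N≤n))
             (hx m n (ℕₚ.m⊔n≤o⇒n≤o M₁ M₂ M≤m) (ℕₚ.m⊔n≤o⇒n≤o M₁ M₂ M≤n)))

infixl 6 _+ℝ_
infixl 7 _*ℝ_

_+ℝ_ : ℝ → ℝ → ℝ
mkℝ x cx +ℝ mkℝ y cy = mkℝ (λ n → x n ℚ.+ y n) (+-cauchy {x} {y} cx cy)

_*ℝ_ : ℝ → ℝ → ℝ
mkℝ x cx *ℝ mkℝ y cy = mkℝ (λ n → x n ℚ.* y n) (*-cauchy {x} {y} cx cy)

-ℝ_ : ℝ → ℝ
-ℝ mkℝ x cx = mkℝ (λ n → ℚ.- x n) (neg-cauchy {x} cx)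

ℝ-rawRing : RawRing 0ℓ 0ℓ
ℝ-rawRing = record
  { Carrier = ℝ
  ; _≈_     = _≈ℝ_
  ; _+_     = _+ℝ_
  ; _*_     = _*ℝ_
  ; -_      = -ℝ_
  ; 0#      = constℝ 0ℚ
  ; 1#      = constℝ 1ℚ
  }

------------------------------------------------------------------------
-- The field ℚ(√p, √q)

-- Coordinates with respect to 1, √p, √q, √p√q.  These four elements form a
-- ℚ-basis of ℚ(√p, √q) when none of p, q, pq is a square, which holds for
-- distinct squarefree p, q > 1.
record K (p q : ℕ) : Set where
  constructor ⟨_,_,_,_⟩
  field
    c₁ c√p c√q c√p√q : ℚ

module _ {p q : ℕ} where
  private
    P Q : ℚ
    P = + p ℚ./ 1
    Q = + q ℚ./ 1

  infixl 6 _+K_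
  infixl 7 _*K_

  _+K_ : K p q → K p q → K p q
  ⟨ a , b , c , d ⟩ +K ⟨ a′ , b′ , c′ , d′ ⟩ =
    ⟨ a ℚ.+ a′ , b ℚ.+ b′ , c ℚ.+ c′ , d ℚ.+ d′ ⟩

  -K_ : K p q → K p q
  -K ⟨ a , b , c , d ⟩ = ⟨ ℚ.- a , ℚ.- b , ℚ.- c , ℚ.- d ⟩

  _*K_ : K p q → K p q → K p q
  ⟨ a , b , c , d ⟩ *K ⟨ a′ , b′ , c′ , d′ ⟩ =
    ⟨ a * a′ + P * (b * b′) + Q * (c * c′) + P * Q * (d * d′)
    , a * b′ + b * a′ + Q * (c * d′ + d * c′)
    , a * c′ + c * a′ + P * (b * d′ + d * b′)
    , a * d′ + d * a′ + b * c′ + c * b′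
    ⟩
    where open import Data.Rational.Base using (_+_; _*_)

K-rawRing : (p q : ℕ) → RawRing 0ℓ 0ℓ
K-rawRing p q = record
  { Carrier = K p q
  ; _≈_     = _≡_
  ; _+_     = _+K_
  ; _*_     = _*K_
  ; -_      = -K_
  ; 0#      = ⟨ 0ℚ , 0ℚ , 0ℚ , 0ℚ ⟩
  ; 1#      = ⟨ 1ℚ , 0ℚ , 0ℚ , 0ℚ ⟩
  }

module _ (p q : ℕ) where
  open OverRing (K-rawRing p q)
  open RingMorphisms (K-rawRing p q) ℝ-rawRing using (IsRingMonomorphism)

  IsRealEmbedding : (K p q → ℝ) → Set
  IsRealEmbedding = IsRingMonomorphism

  -- Under the hypotheses above there are exactly four real embeddings,
  -- √p ↦ ±√p and √q ↦ ±√q.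
  TotallyPositive : K p q → Set
  TotallyPositive α = ∀ σ → IsRealEmbedding σ → Positiveℝ (σ α)

  InRingOfIntegers : K p q → Set
  InRingOfIntegers = IsIntegral

  IsUniversal : ℤForm → Set
  IsUniversal Q = ∀ α → InRingOfIntegers α → TotallyPositive α →
    Σ[ v ∈ Vector (K p q) (ℤForm.rank Q) ]
      ((∀ i → InRingOfIntegers (v i)) × evalForm (ℤForm.coeff Q) v ≡ α)

{-# OPTIONS --safe #-}
module Submission where

-- Let D₁, D₂, D₃ be the three squarefree integers whose roots lie in K.  They
-- can be written bc, ac, ab, and after a permutation E = ac is not the largest
-- of them.  If some Dᵢ ≢ 1 (mod 4), choose E ≢ 1 and α = r + √E with r = ⌈√E⌉;
-- otherwise choose E ≠ 5 and α = (r + √E)/2 with r the least odd integer above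
-- √E.  Suppose α = Q(v), and write v = x + y√bc + s√ac + t√ab with rational
-- vectors x, y, s, t, whose denominators divide 4 by integrality.  Comparing
-- the coefficients of 1 and of √ac gives
--   Q(x) + bc Q(y) + ac Q(s) + ab Q(t) = c₁(α),   B(x,s) + b B(y,t) ≠ 0,
-- where B is the polar form.  Hence x, s ≠ 0 or y, t ≠ 0.  Since Q ≥ 1 on
-- nonzero integral vectors, congruences modulo 4 between the coordinates make
-- the left-hand side larger than c₁(α) in either case.

open import Defs
open import Algebra.Bundles using (CommutativeRing; CommutativeSemiring)
open import Algebra.Bundles.Raw using (RawRing)
open import Algebra.Morphism.Structures using (module RingMorphisms)
import Algebra.Properties.Group as GroupProperties
import Algebra.Properties.Ring as RingProperties
import Algebra.Properties.Semiring.Exp as Exponentiation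
import Algebra.Properties.Semiring.Mult as Multiplication
import Algebra.Properties.Semiring.Sum as Summation
open import Algebra.Structures using (IsCommutativeRing)
open import Data.Bool.Base using (true; false; if_then_else_)
open import Data.Empty using (⊥; ⊥-elim)
open import Data.Fin.Base using (Fin; zero; suc; toℕ; fromℕ<)
import Data.Fin.Properties as Finₚ
open import Data.Integer.Base as ℤ using (ℤ; +_; -[1+_])
import Data.Integer.DivMod as ℤ/
import Data.Integer.Properties as ℤₚ
import Data.Integer.Tactic.RingSolver as ℤSolver
open import Data.Nat.Base as ℕ using (ℕ; zero; suc; s≤s; z≤n; _<_)
open import Data.Nat.Coprimality as Coprimality using (Coprime; coprime-divisor)
open import Data.Nat.Divisibility
  using (_∣_; divides; ∣-trans; ∣⇒≤; ∣1⇒≡1; m∣m*n; n∣m*n;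
         *-monoˡ-∣; *-cancelʳ-∣; *-pres-∣; m%n≡0⇒n∣m)
import Data.Nat.DivMod as ℕ/
open import Data.Nat.GCD using (gcd; gcd[m,n]∣m; gcd[m,n]∣n; gcd-greatest)
open import Data.Nat.Induction using (<-rec)
import Data.Nat.Properties as ℕₚ
import Data.Nat.Tactic.RingSolver as ℕSolver
open import Data.Product.Base using (Σ-syntax; ∃-syntax; _×_; _,_; proj₁; proj₂)
open import Data.Rational.Base as ℚ using (ℚ; mkℚ; 0ℚ; 1ℚ; ½; ↥_; ↧_; ↧ₙ_; ∣_∣)
import Data.Rational.Properties as ℚₚ
open import Data.Rational.Solver using (module +-*-Solver)
import Data.Rational.Unnormalised.Base as ℚᵘ
import Data.Rational.Unnormalised.Properties as ℚᵘₚ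
import Data.Sign.Base as Sign
open import Data.Sum.Base using (_⊎_; inj₁; inj₂)
open import Data.Vec.Functional using (Vector; foldr)
open import Function.Base using (_∘_)
open import Level using (0ℓ)
open import Relation.Binary.Definitions using (tri<; tri≈; tri>)
open import Relation.Binary.PropositionalEquality hiding (setoid)
import Relation.Binary.Reasoning.Setoid as ≈-Reasoning
open import Relation.Nullary.Decidable
  using (Dec; yes; no; does; ¬?; _×-dec_; _⊎-dec_; _→-dec_; from-yes)
open import Relation.Nullary.Negation using (¬_)

-- Rational numbers that are integers

-- The bounds work because α is nearly as small as total positivity allows: r exceeds √E by less
-- than 1, or by less than 2 when r must be odd. After coordinates are multiplied by their
-- denominator ℓ = 2 or 4, the target ℓ² c₁(α) is linear in √E. If x, s ≠ 0, the term E Q(s) is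
-- quadratic in √E. If y, t ≠ 0, the terms bc and ab add up to b(a + c), which is at least 2b√(ac),
-- and the task is to make b large enough. Arranging c < b puts ac below ab and, with the residues
-- at hand, gives b ≥ 3 or b ≥ 5. The scaling costs a factor ℓ² on the side of α, while a nonzero
-- integral vector is only known to contribute at least 1. Parity relations repair this: they show
-- either that some vectors are even, so that each contributes at least 4, or that further vectors
-- are nonzero. The exception E = 5 is genuine: it would give α = (3 + √5)/2, the square of the unit
-- (1 + √5)/2 and hence a value of the form x².

ι : ℤ → ℚ
ι z = z ℚ./ 1

toℚᵘ-ι : ∀ z → ℚ.toℚᵘ (ι z) ℚᵘ.≃ ℚᵘ.mkℚᵘ z 0
toℚᵘ-ι z = ℚₚ.toℚᵘ-fromℚᵘ (ℚᵘ.mkℚᵘ z 0)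

ι-+ : ∀ x y → ι (x ℤ.+ y) ≡ ι x ℚ.+ ι y
ι-+ x y = ℚₚ.toℚᵘ-injective (begin
  ℚ.toℚᵘ (ι (x ℤ.+ y))                  ≈⟨ toℚᵘ-ι (x ℤ.+ y) ⟩
  ℚᵘ.mkℚᵘ (x ℤ.+ y) 0                   ≈⟨ ℚᵘ.*≡*
    (cong (ℤ._* + 1) (sym (cong₂ ℤ._+_ (ℤₚ.*-identityʳ x) (ℤₚ.*-identityʳ y)))) ⟩
  ℚᵘ.mkℚᵘ x 0 ℚᵘ.+ ℚᵘ.mkℚᵘ y 0          ≈⟨ ℚᵘₚ.+-cong (toℚᵘ-ι x) (toℚᵘ-ι y) ⟨
  ℚ.toℚᵘ (ι x) ℚᵘ.+ ℚ.toℚᵘ (ι y)        ≈⟨ ℚₚ.toℚᵘ-homo-+ (ι x) (ι y) ⟨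
  ℚ.toℚᵘ (ι x ℚ.+ ι y)                  ∎)
  where open ℚᵘₚ.≃-Reasoning

ι-* : ∀ x y → ι (x ℤ.* y) ≡ ι x ℚ.* ι y
ι-* x y = ℚₚ.toℚᵘ-injective (begin
  ℚ.toℚᵘ (ι (x ℤ.* y))                  ≈⟨ toℚᵘ-ι (x ℤ.* y) ⟩
  ℚᵘ.mkℚᵘ x 0 ℚᵘ.* ℚᵘ.mkℚᵘ y 0          ≈⟨ ℚᵘₚ.*-cong (toℚᵘ-ι x) (toℚᵘ-ι y) ⟨
  ℚ.toℚᵘ (ι x) ℚᵘ.* ℚ.toℚᵘ (ι y)        ≈⟨ ℚₚ.toℚᵘ-homo-* (ι x) (ι y) ⟨
  ℚ.toℚᵘ (ι x ℚ.* ι y)                  ∎)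
  where open ℚᵘₚ.≃-Reasoning

ι-neg : ∀ x → ι (ℤ.- x) ≡ ℚ.- ι x
ι-neg x = ℚₚ.toℚᵘ-injective (begin
  ℚ.toℚᵘ (ι (ℤ.- x))                    ≈⟨ toℚᵘ-ι (ℤ.- x) ⟩
  ℚᵘ.- ℚᵘ.mkℚᵘ x 0                      ≈⟨ ℚᵘₚ.-‿cong (toℚᵘ-ι x) ⟨
  ℚᵘ.- ℚ.toℚᵘ (ι x)                     ≈⟨ ℚₚ.toℚᵘ-homo‿- (ι x) ⟨
  ℚ.toℚᵘ (ℚ.- ι x)                      ∎)
  where open ℚᵘₚ.≃-Reasoning

ι-injective : ∀ x y → ι x ≡ ι y → x ≡ y
ι-injective x y eq with ℚₚ.fromℚᵘ-injective {ℚᵘ.mkℚᵘ x 0} {ℚᵘ.mkℚᵘ y 0} eq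
... | ℚᵘ.*≡* e = trans (sym (ℤₚ.*-identityʳ x)) (trans e (ℤₚ.*-identityʳ y))

denominator-clear : ∀ x → ι (↧ x) ℚ.* x ≡ ι (↥ x)
denominator-clear x@record{} = ℚₚ.toℚᵘ-injective (begin
  ℚ.toℚᵘ (ι (↧ x) ℚ.* x)                ≈⟨ ℚₚ.toℚᵘ-homo-* (ι (↧ x)) x ⟩
  ℚ.toℚᵘ (ι (↧ x)) ℚᵘ.* ℚ.toℚᵘ x        ≈⟨ ℚᵘₚ.*-congʳ (toℚᵘ-ι (↧ x)) ⟩
  ℚᵘ.mkℚᵘ (↧ x) 0 ℚᵘ.* ℚ.toℚᵘ x         ≈⟨ ℚᵘ.*≡*
    (trans (ℤₚ.*-identityʳ _) (trans (ℤₚ.*-comm (↧ x) (↥ x))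
    (cong (↥ x ℤ.*_) (sym (ℤₚ.*-identityˡ (↧ x)))))) ⟩
  ℚᵘ.mkℚᵘ (↥ x) 0                       ≈⟨ toℚᵘ-ι (↥ x) ⟨
  ℚ.toℚᵘ (ι (↥ x))                      ∎)
  where open ℚᵘₚ.≃-Reasoning

IsInteger : ℚ → Set
IsInteger x = ∃[ z ] x ≡ ι z

infixl 7 _⊗_
infixl 6 _⊕_ _⊖_

_⊕_ : ∀ {x y} → IsInteger x → IsInteger y → IsInteger (x ℚ.+ y)
(i , p) ⊕ (j , q) = i ℤ.+ j , trans (cong₂ ℚ._+_ p q) (sym (ι-+ i j))

_⊗_ : ∀ {x y} → IsInteger x → IsInteger y → IsInteger (x ℚ.* y)
(i , p) ⊗ (j , q) = i ℤ.* j , trans (cong₂ ℚ._*_ p q) (sym (ι-* i j))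

neg-isInteger : ∀ {x} → IsInteger x → IsInteger (ℚ.- x)
neg-isInteger (i , p) = ℤ.- i , trans (cong ℚ.-_ p) (sym (ι-neg i))

_⊖_ : ∀ {x y} → IsInteger x → IsInteger y → IsInteger (x ℚ.- y)
i ⊖ j = i ⊕ neg-isInteger j

integer : ∀ z → IsInteger (ι z)
integer z = z , refl

isInteger-unique : ∀ {x y} → x ≡ y → ((i , _) : IsInteger x) ((j , _) : IsInteger y) → i ≡ j
isInteger-unique refl (i , p) (j , q) = ι-injective i j (trans (sym p) q)

-- Denominators of rational numbers and squarefree integers

coprime-*ˡ : ∀ {i j k} → Coprime i k → Coprime j k → Coprime (i ℕ.* j) k
coprime-*ˡ {i} {j} {k} ci cj {d} (d∣ij , d∣k) =
  cj (coprime-divisor (λ (t∣d , t∣i) → ci (t∣i , ∣-trans t∣d d∣k)) d∣ij , d∣k)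

coprime-^ˡ : ∀ {i k} n → Coprime i k → Coprime (i ℕ.^ n) k
coprime-^ˡ zero    c (d∣1 , _) = ∣1⇒≡1 d∣1
coprime-^ˡ (suc n) c = coprime-*ˡ c (coprime-^ˡ n c)

coprime-^ : ∀ {i k} m n → Coprime i k → Coprime (i ℕ.^ m) (k ℕ.^ n)
coprime-^ m n c = coprime-^ˡ m (Coprimality.sym (coprime-^ˡ n (Coprimality.sym c)))

module ℚ-form = OverRing ℚ.+-*-rawRing
open ℚ-form using () renaming (_^_ to _^ℚ_)

*-^-distrib : ∀ x y n → (x ℚ.* y) ^ℚ n ≡ x ^ℚ n ℚ.* y ^ℚ n
*-^-distrib x y zero = refl
*-^-distrib x y (suc n) = trans (cong (x ℚ.* y ℚ.*_) (*-^-distrib x y n))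
  (solve 4 (λ a b c d → a :* b :* (c :* d) := a :* c :* (b :* d)) refl x y (x ^ℚ n) (y ^ℚ n))
  where
  open +-*-Solver

ι-^ : ∀ z n → ι z ^ℚ n ≡ ι (z ℤ.^ n)
ι-^ z zero = refl
ι-^ z (suc n) = trans (cong (ι z ℚ.*_) (ι-^ z n)) (sym (ι-* z (z ℤ.^ n)))

∣^∣ : ∀ z n → ℤ.∣ z ℤ.^ n ∣ ≡ ℤ.∣ z ∣ ℕ.^ n
∣^∣ z zero = refl
∣^∣ z (suc n) = trans (ℤₚ.abs-* z (z ℤ.^ n)) (cong (ℤ.∣ z ∣ ℕ.*_) (∣^∣ z n))

-- Clearing denominators in d xⁿ = z gives d (↥ x)ⁿ = z (↧ x)ⁿ, and the powers of numerator and
-- denominator are coprime.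
denominator-^-∣ : ∀ x n d → IsInteger (ι (+ d) ℚ.* x ^ℚ n) → (↧ₙ x) ℕ.^ n ∣ d
denominator-^-∣ x@(mkℚ _ _ cop) n d (z , eq) =
  coprime-divisor {n = ℤ.∣ ↥ x ∣ ℕ.^ n}
    (coprime-^ n n (Coprimality.sym (Coprimality.recompute cop)))
    (divides ℤ.∣ z ∣ (begin
      ℤ.∣ ↥ x ∣ ℕ.^ n ℕ.* d               ≡⟨ ℕₚ.*-comm _ d ⟩
      d ℕ.* ℤ.∣ ↥ x ∣ ℕ.^ n               ≡⟨ cong (d ℕ.*_) (∣^∣ (↥ x) n) ⟨
      d ℕ.* ℤ.∣ (↥ x) ℤ.^ n ∣             ≡⟨ ℤₚ.abs-* (+ d) ((↥ x) ℤ.^ n) ⟨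
      ℤ.∣ + d ℤ.* (↥ x) ℤ.^ n ∣           ≡⟨ cong ℤ.∣_∣
        (ι-injective (+ d ℤ.* (↥ x) ℤ.^ n) (z ℤ.* (↧ x) ℤ.^ n) cleared) ⟩
      ℤ.∣ z ℤ.* (↧ x) ℤ.^ n ∣             ≡⟨ ℤₚ.abs-* z ((↧ x) ℤ.^ n) ⟩
      ℤ.∣ z ∣ ℕ.* ℤ.∣ (↧ x) ℤ.^ n ∣       ≡⟨ cong (ℤ.∣ z ∣ ℕ.*_) (∣^∣ (↧ x) n) ⟩
      ℤ.∣ z ∣ ℕ.* (↧ₙ x) ℕ.^ n            ∎))
  where
  open ≡-Reasoning
  open +-*-Solver
  cleared : ι (+ d ℤ.* (↥ x) ℤ.^ n) ≡ ι (z ℤ.* (↧ x) ℤ.^ n)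
  cleared = begin
    ι (+ d ℤ.* (↥ x) ℤ.^ n)               ≡⟨ ι-* (+ d) _ ⟩
    ι (+ d) ℚ.* ι ((↥ x) ℤ.^ n)           ≡⟨ cong (ι (+ d) ℚ.*_) (ι-^ (↥ x) n) ⟨
    ι (+ d) ℚ.* ι (↥ x) ^ℚ n               ≡⟨
      cong (λ y → ι (+ d) ℚ.* y ^ℚ n) (denominator-clear x) ⟨
    ι (+ d) ℚ.* (ι (↧ x) ℚ.* x) ^ℚ n       ≡⟨ cong (ι (+ d) ℚ.*_) (*-^-distrib (ι (↧ x)) x n) ⟩
    ι (+ d) ℚ.* (ι (↧ x) ^ℚ n ℚ.* x ^ℚ n)   ≡⟨
      solve 3 (λ a b c → a :* (b :* c) := a :* c :* b) refl (ι (+ d)) (ι (↧ x) ^ℚ n) (x ^ℚ n) ⟩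
    ι (+ d) ℚ.* x ^ℚ n ℚ.* ι (↧ x) ^ℚ n     ≡⟨ cong₂ ℚ._*_ eq (ι-^ (↧ x) n) ⟩
    ι z ℚ.* ι ((↧ x) ℤ.^ n)               ≡⟨ ι-* z _ ⟨
    ι (z ℤ.* (↧ x) ℤ.^ n)                 ∎

denominator≡1⇒isInteger : ∀ x → ↧ₙ x ≡ 1 → IsInteger x
denominator≡1⇒isInteger x ↧≡1 = ↥ x , (begin
  x                  ≡⟨ ℚₚ.*-identityˡ x ⟨
  ι (+ 1) ℚ.* x      ≡⟨ cong (λ d → ι (+ d) ℚ.* x) ↧≡1 ⟨
  ι (↧ x) ℚ.* x      ≡⟨ denominator-clear x ⟩
  ι (↥ x)            ∎)
  where open ≡-Reasoning

n<2+m^n : ∀ m n → n ℕ.< (2 ℕ.+ m) ℕ.^ n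
n<2+m^n m zero = s≤s z≤n
n<2+m^n m (suc n) = begin-strict
  suc n                            ≤⟨ n<2+m^n m n ⟩
  (2 ℕ.+ m) ℕ.^ n                  <⟨ ℕₚ.m<m*n ((2 ℕ.+ m) ℕ.^ n) (2 ℕ.+ m) {{ℕₚ.m^n≢0 (2 ℕ.+ m) n}}
    (s≤s (s≤s z≤n)) ⟩
  (2 ℕ.+ m) ℕ.^ n ℕ.* (2 ℕ.+ m)    ≡⟨ ℕₚ.*-comm ((2 ℕ.+ m) ℕ.^ n) (2 ℕ.+ m) ⟩
  (2 ℕ.+ m) ℕ.^ suc n              ∎
  where open ℕₚ.≤-Reasoning

-- A denominator of at least 2 would have powers exceeding every fixed d; the exponent d is already
-- large enough, since d < 2^d.
powers-bounded⇒isInteger : ∀ x d .{{_ : ℕ.NonZero d}} →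
  (∀ n → IsInteger (ι (+ d) ℚ.* x ^ℚ n)) → IsInteger x
powers-bounded⇒isInteger x@(mkℚ _ zero _) d h = denominator≡1⇒isInteger x refl
powers-bounded⇒isInteger x@(mkℚ _ (suc e) _) d h =
  ⊥-elim (ℕₚ.<⇒≱ (n<2+m^n e d) (∣⇒≤ (denominator-^-∣ x d d (h d))))

squareFree⇒isInteger : ∀ {d} x → SquareFree d → IsInteger (ι (+ d) ℚ.* (x ℚ.* x)) → IsInteger x
squareFree⇒isInteger {d} x sf h = denominator≡1⇒isInteger x
  (sf (↧ₙ x) (subst (_∣ d) (cong (↧ₙ x ℕ.*_) (ℕₚ.*-identityʳ (↧ₙ x)))
    (denominator-^-∣ x 2 d (subst (λ y → IsInteger (ι (+ d) ℚ.* (x ℚ.* y)))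
      (sym (ℚₚ.*-identityʳ x)) h))))

-- Write m = k e. Cancelling one e leaves e ∣ k n, and e inherits coprimality to n from m.
square-∣-coprime-* : ∀ {m n} e → Coprime m n → e ∣ m → e ℕ.* e ∣ m ℕ.* n → e ℕ.* e ∣ m
square-∣-coprime-* zero m⊥n (divides k refl) _ = divides 0 (ℕₚ.*-zeroʳ k)
square-∣-coprime-* {n = n} e@(suc _) m⊥n (divides k refl) e²∣mn = *-monoˡ-∣ e e∣k
  where
  e⊥n : Coprime e n
  e⊥n (t∣e , t∣n) = m⊥n (∣-trans t∣e (n∣m*n k) , t∣n)
  e∣k : e ∣ k
  e∣k = coprime-divisor {n = n} e⊥n
    (*-cancelʳ-∣ e (subst (e ℕ.* e ∣_) (rearrange k e n) e²∣mn))
    where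
    rearrange : ∀ k e n → k ℕ.* e ℕ.* n ≡ n ℕ.* k ℕ.* e
    rearrange = ℕSolver.solve-∀

-- A common divisor e of d and m has e² ∣ m n, hence e² ∣ m and e = 1. So d is coprime to m and d²
-- must divide n. This supplies the squarefreeness of the third radicand, which is not among the
-- hypotheses on p and q.
coprime-squareFree-* : ∀ {m n} → Coprime m n → SquareFree m → SquareFree n → SquareFree (m ℕ.* n)
coprime-squareFree-* {m} {n} m⊥n sm sn d d²∣mn =
  sn d (coprime-divisor (coprime-*ˡ d⊥m d⊥m) d²∣mn)
  where
  d⊥m : Coprime d m
  d⊥m {e} (e∣d , e∣m) = sm e (square-∣-coprime-* e m⊥n e∣m
    (∣-trans (*-pres-∣ e∣d e∣d) d²∣mn))

-- The field ℚ(√bc, √ac) in the basis 1, √bc, √ac, √ab, whose elements of index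
-- m, n, k satisfy eₘ eₙ = c eₖ, eₘ eₖ = b eₙ and eₙ eₖ = a eₘ.  Permuting the
-- parameters permutes the basis, so each of the three roots can be put at n.
record Biquadratic (a b c : ℕ) : Set where
  constructor ⟪_,_,_,_⟫
  field
    c₁ cₘ cₙ cₖ : ℚ

open Biquadratic public

cong₄ : ∀ {a b c x x′ y y′ s s′ t t′} → x ≡ x′ → y ≡ y′ → s ≡ s′ → t ≡ t′ →
  _≡_ {A = Biquadratic a b c} ⟪ x , y , s , t ⟫ ⟪ x′ , y′ , s′ , t′ ⟫
cong₄ refl refl refl refl = refl

module BiquadraticRing (a b c : ℕ) where
  private
    B = Biquadratic a b c
    A′ B′ C′ : ℚ
    A′ = ι (+ a)
    B′ = ι (+ b)
    C′ = ι (+ c)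

  infixl 6 _+_
  infixl 7 _*_
  infix 8 -_

  _+_ _*_ : B → B → B
  ⟪ x , y , s , t ⟫ + ⟪ x′ , y′ , s′ , t′ ⟫ =
    ⟪ x ℚ.+ x′ , y ℚ.+ y′ , s ℚ.+ s′ , t ℚ.+ t′ ⟫
  ⟪ x , y , s , t ⟫ * ⟪ x′ , y′ , s′ , t′ ⟫ =
    ⟪ x ℚ.* x′ ℚ.+ B′ ℚ.* C′ ℚ.* (y ℚ.* y′) ℚ.+ A′ ℚ.* C′ ℚ.* (s ℚ.* s′)
      ℚ.+ A′ ℚ.* B′ ℚ.* (t ℚ.* t′)
    , x ℚ.* y′ ℚ.+ y ℚ.* x′ ℚ.+ A′ ℚ.* (s ℚ.* t′ ℚ.+ t ℚ.* s′)
    , x ℚ.* s′ ℚ.+ s ℚ.* x′ ℚ.+ B′ ℚ.* (y ℚ.* t′ ℚ.+ t ℚ.* y′)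
    , x ℚ.* t′ ℚ.+ t ℚ.* x′ ℚ.+ C′ ℚ.* (y ℚ.* s′ ℚ.+ s ℚ.* y′)
    ⟫

  -_ : B → B
  - ⟪ x , y , s , t ⟫ = ⟪ ℚ.- x , ℚ.- y , ℚ.- s , ℚ.- t ⟫

  embed : ℚ → B
  embed x = ⟪ x , 0ℚ , 0ℚ , 0ℚ ⟫

  private
    open +-*-Solver

    p₁ : ∀ {n} (a b c x y s t x′ y′ s′ t′ : Polynomial n) → Polynomial n
    p₁ a b c x y s t x′ y′ s′ t′ = x :* x′ :+ b :* c :* (y :* y′) :+ a :* c :* (s :* s′)
      :+ a :* b :* (t :* t′)
    -- The coordinates of a product at √bc, √ac and √ab are this one polynomial, up to a permutation
    -- of the arguments and the choice of a, b or c.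
    p₂ : ∀ {n} (a x y s t x′ y′ s′ t′ : Polynomial n) → Polynomial n
    p₂ a x y s t x′ y′ s′ t′ = x :* y′ :+ y :* x′ :+ a :* (s :* t′ :+ t :* s′)

    *-comm : ∀ u v → u * v ≡ v * u
    *-comm ⟪ x , y , s , t ⟫ ⟪ x′ , y′ , s′ , t′ ⟫ = cong₄
      (solve 11 (λ a b c x y s t x′ y′ s′ t′ → p₁ a b c x y s t x′ y′ s′ t′ :=
        p₁ a b c x′ y′ s′ t′ x y s t) refl A′ B′ C′ x y s t x′ y′ s′ t′)
      (comm₂ A′ x y s t x′ y′ s′ t′)
      (comm₂ B′ x s y t x′ s′ y′ t′)
      (comm₂ C′ x t y s x′ t′ y′ s′)
      where
      comm₂ = solve 9 (λ a x y s t x′ y′ s′ t′ → p₂ a x y s t x′ y′ s′ t′ :=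
        p₂ a x′ y′ s′ t′ x y s t) refl

    *-assoc : ∀ u v w → (u * v) * w ≡ u * (v * w)
    *-assoc ⟪ x , y , s , t ⟫ ⟪ x′ , y′ , s′ , t′ ⟫ ⟪ x″ , y″ , s″ , t″ ⟫ = cong₄
      (solve 15 (λ a b c x y s t x′ y′ s′ t′ x″ y″ s″ t″ →
        p₁ a b c (p₁ a b c x y s t x′ y′ s′ t′) (p₂ a x y s t x′ y′ s′ t′)
          (p₂ b x s y t x′ s′ y′ t′) (p₂ c x t y s x′ t′ y′ s′) x″ y″ s″ t″ :=
        p₁ a b c x y s t (p₁ a b c x′ y′ s′ t′ x″ y″ s″ t″) (p₂ a x′ y′ s′ t′ x″ y″ s″ t″)
          (p₂ b x′ s′ y′ t′ x″ s″ y″ t″) (p₂ c x′ t′ y′ s′ x″ t″ y″ s″)) refl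
        A′ B′ C′ x y s t x′ y′ s′ t′ x″ y″ s″ t″)
      (solve 15 (λ a b c x y s t x′ y′ s′ t′ x″ y″ s″ t″ →
        p₂ a (p₁ a b c x y s t x′ y′ s′ t′) (p₂ a x y s t x′ y′ s′ t′) (p₂ b x s y t x′ s′ y′ t′)
          (p₂ c x t y s x′ t′ y′ s′) x″ y″ s″ t″ :=
        p₂ a x y s t (p₁ a b c x′ y′ s′ t′ x″ y″ s″ t″) (p₂ a x′ y′ s′ t′ x″ y″ s″ t″)
          (p₂ b x′ s′ y′ t′ x″ s″ y″ t″) (p₂ c x′ t′ y′ s′ x″ t″ y″ s″)) refl
        A′ B′ C′ x y s t x′ y′ s′ t′ x″ y″ s″ t″)
      (solve 15 (λ a b c x y s t x′ y′ s′ t′ x″ y″ s″ t″ →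
        p₂ b (p₁ a b c x y s t x′ y′ s′ t′) (p₂ b x s y t x′ s′ y′ t′) (p₂ a x y s t x′ y′ s′ t′)
          (p₂ c x t y s x′ t′ y′ s′) x″ s″ y″ t″ :=
        p₂ b x s y t (p₁ a b c x′ y′ s′ t′ x″ y″ s″ t″) (p₂ b x′ s′ y′ t′ x″ s″ y″ t″)
          (p₂ a x′ y′ s′ t′ x″ y″ s″ t″) (p₂ c x′ t′ y′ s′ x″ t″ y″ s″)) refl
        A′ B′ C′ x y s t x′ y′ s′ t′ x″ y″ s″ t″)
      (solve 15 (λ a b c x y s t x′ y′ s′ t′ x″ y″ s″ t″ →
        p₂ c (p₁ a b c x y s t x′ y′ s′ t′) (p₂ c x t y s x′ t′ y′ s′) (p₂ a x y s t x′ y′ s′ t′)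
          (p₂ b x s y t x′ s′ y′ t′) x″ t″ y″ s″ :=
        p₂ c x t y s (p₁ a b c x′ y′ s′ t′ x″ y″ s″ t″) (p₂ c x′ t′ y′ s′ x″ t″ y″ s″)
          (p₂ a x′ y′ s′ t′ x″ y″ s″ t″) (p₂ b x′ s′ y′ t′ x″ s″ y″ t″)) refl
        A′ B′ C′ x y s t x′ y′ s′ t′ x″ y″ s″ t″)

    *-distribˡ-+ : ∀ u v w → u * (v + w) ≡ u * v + u * w
    *-distribˡ-+ ⟪ x , y , s , t ⟫ ⟪ x′ , y′ , s′ , t′ ⟫ ⟪ x″ , y″ , s″ , t″ ⟫ = cong₄
      (solve 15 (λ a b c x y s t x′ y′ s′ t′ x″ y″ s″ t″ →
        p₁ a b c x y s t (x′ :+ x″) (y′ :+ y″) (s′ :+ s″) (t′ :+ t″) :=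
        p₁ a b c x y s t x′ y′ s′ t′ :+ p₁ a b c x y s t x″ y″ s″ t″) refl
        A′ B′ C′ x y s t x′ y′ s′ t′ x″ y″ s″ t″)
      (distrib₂ A′ x y s t x′ y′ s′ t′ x″ y″ s″ t″)
      (distrib₂ B′ x s y t x′ s′ y′ t′ x″ s″ y″ t″)
      (distrib₂ C′ x t y s x′ t′ y′ s′ x″ t″ y″ s″)
      where
      distrib₂ = solve 13 (λ a x y s t x′ y′ s′ t′ x″ y″ s″ t″ →
        p₂ a x y s t (x′ :+ x″) (y′ :+ y″) (s′ :+ s″) (t′ :+ t″) :=
        p₂ a x y s t x′ y′ s′ t′ :+ p₂ a x y s t x″ y″ s″ t″) refl

  embed-* : ∀ q x y s t → embed q * ⟪ x , y , s , t ⟫ ≡ ⟪ q ℚ.* x , q ℚ.* y , q ℚ.* s , q ℚ.* t ⟫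
  embed-* q x y s t = cong₄
    (solve 8 (λ a b c q x y s t →
      p₁ a b c q (con 0ℚ) (con 0ℚ) (con 0ℚ) x y s t := q :* x) refl A′ B′ C′ q x y s t)
    (scale₂ A′ q x y s t)
    (scale₂ B′ q x s y t)
    (scale₂ C′ q x t y s)
    where
    scale₂ = solve 6 (λ a q x y s t →
      p₂ a q (con 0ℚ) (con 0ℚ) (con 0ℚ) x y s t := q :* y) refl

  private
    *-identityˡ : ∀ u → embed 1ℚ * u ≡ u
    *-identityˡ ⟪ x , y , s , t ⟫ = trans (embed-* 1ℚ x y s t)
      (cong₄ (ℚₚ.*-identityˡ x) (ℚₚ.*-identityˡ y) (ℚₚ.*-identityˡ s) (ℚₚ.*-identityˡ t))

  isCommutativeRing : IsCommutativeRing _≡_ _+_ _*_ -_ (embed 0ℚ) (embed 1ℚ)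
  isCommutativeRing = record
    { isRing = record
      { +-isAbelianGroup = record
        { isGroup = record
          { isMonoid = record
            { isSemigroup = record
              { isMagma = record { isEquivalence = isEquivalence ; ∙-cong = cong₂ _+_ }
              ; assoc = λ u v w → cong₄ (ℚₚ.+-assoc (c₁ u) (c₁ v) (c₁ w))
                (ℚₚ.+-assoc (cₘ u) (cₘ v) (cₘ w))
                                        (ℚₚ.+-assoc (cₙ u) (cₙ v) (cₙ w))
                                          (ℚₚ.+-assoc (cₖ u) (cₖ v) (cₖ w))
              }
            ; identity =
                (λ u → cong₄ (ℚₚ.+-identityˡ (c₁ u)) (ℚₚ.+-identityˡ (cₘ u)) (ℚₚ.+-identityˡ (cₙ u))
                  (ℚₚ.+-identityˡ (cₖ u)))
              , (λ u → cong₄ (ℚₚ.+-identityʳ (c₁ u)) (ℚₚ.+-identityʳ (cₘ u)) (ℚₚ.+-identityʳ (cₙ u))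
                (ℚₚ.+-identityʳ (cₖ u)))
            }
          ; inverse =
              (λ u → cong₄ (ℚₚ.+-inverseˡ (c₁ u)) (ℚₚ.+-inverseˡ (cₘ u)) (ℚₚ.+-inverseˡ (cₙ u))
                (ℚₚ.+-inverseˡ (cₖ u)))
            , (λ u → cong₄ (ℚₚ.+-inverseʳ (c₁ u)) (ℚₚ.+-inverseʳ (cₘ u)) (ℚₚ.+-inverseʳ (cₙ u))
              (ℚₚ.+-inverseʳ (cₖ u)))
          ; ⁻¹-cong = cong -_
          }
        ; comm = λ u v → cong₄ (ℚₚ.+-comm (c₁ u) (c₁ v)) (ℚₚ.+-comm (cₘ u) (cₘ v))
                               (ℚₚ.+-comm (cₙ u) (cₙ v)) (ℚₚ.+-comm (cₖ u) (cₖ v))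
        }
      ; *-cong = cong₂ _*_
      ; *-assoc = *-assoc
      ; *-identity = *-identityˡ , λ u → trans (*-comm u (embed 1ℚ)) (*-identityˡ u)
      ; distrib = *-distribˡ-+ , λ u v w → trans (*-comm (v + w) u)
          (trans (*-distribˡ-+ u v w) (cong₂ _+_ (*-comm u v) (*-comm u w)))
      }
    ; *-comm = *-comm
    }

  commutativeRing : CommutativeRing 0ℓ 0ℓ
  commutativeRing = record { isCommutativeRing = isCommutativeRing }

-- Sums and ring homomorphisms

module _ {A B : Set} (_~_ : A → B → Set) where
  -- Stated for a relation so that it covers homomorphisms, congruence of sums, and closure of a
  -- predicate under sums (taking both vectors equal).
  foldr-related : ∀ {_+_ : A → A → A} {_+′_ : B → B → B} {z z′} → z ~ z′ →
    (∀ {x x′ y y′} → x ~ x′ → y ~ y′ → (x + y) ~ (x′ +′ y′)) →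
    ∀ {n} (t : Vector A n) (u : Vector B n) → (∀ i → t i ~ u i) →
    foldr _+_ z t ~ foldr _+′_ z′ u
  foldr-related z~ +~ {zero} t u t~u = z~
  foldr-related z~ +~ {suc n} t u t~u = +~ (t~u zero)
    (foldr-related z~ +~ (t ∘ suc) (u ∘ suc) (t~u ∘ suc))

-- The laws are propositional equations, so they rewrite under sums and forms by `cong`; the
-- equality of the ring itself enters only where integrality is transported.
record IsHom (R S : RawRing 0ℓ 0ℓ) (f : RawRing.Carrier R → RawRing.Carrier S) : Set where
  private
    module R = RawRing R
    module S = RawRing S
  field
    +-hom   : ∀ x y → f (x R.+ y) ≡ f x S.+ f y
    *-hom   : ∀ x y → f (x R.* y) ≡ f x S.* f y
    neg-hom : ∀ x → f (R.- x) ≡ S.- f x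
    0-hom   : f R.0# ≡ S.0#
    1-hom   : f R.1# ≡ S.1#

  private
    module OR = OverRing R
    module OS = OverRing S

  sum-hom : ∀ {n} (t : Vector R.Carrier n) (u : Vector S.Carrier n) → (∀ i → f (t i) ≡ u i) →
    f (OR.sum t) ≡ OS.sum u
  sum-hom = foldr-related (λ x y → f x ≡ y) 0-hom
    (λ {x} {_} {y} p q → trans (+-hom x y) (cong₂ S._+_ p q))

  ·-hom : ∀ n x → f (n OR.· x) ≡ n OS.· f x
  ·-hom zero    x = 0-hom
  ·-hom (suc n) x = trans (+-hom x _) (cong (f x S.+_) (·-hom n x))

  ^-hom : ∀ x n → f (x OR.^ n) ≡ f x OS.^ n
  ^-hom x zero    = 1-hom
  ^-hom x (suc n) = trans (*-hom x _) (cong (f x S.*_) (^-hom x n))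

  fromℤ-hom : ∀ z → f (OR.fromℤ z) ≡ OS.fromℤ z
  fromℤ-hom (+ n)    = trans (·-hom n R.1#) (cong (n OS.·_) 1-hom)
  fromℤ-hom -[1+ n ] = trans (neg-hom _) (cong S.-_
    (trans (·-hom (suc n) R.1#) (cong (suc n OS.·_) 1-hom)))

  evalForm-hom : ∀ {r} (a : Fin r → Fin r → ℤ) v → f (OR.evalForm a v) ≡ OS.evalForm a (f ∘ v)
  evalForm-hom a v = sum-hom _ _ λ i → sum-hom _ _ λ j → entry i j (does (i Finₚ.≤? j))
    where
    entry : ∀ i j e → f (if e then OR.fromℤ (a i j) R.* (v i R.* v j) else R.0#) ≡
                      (if e then OS.fromℤ (a i j) S.* (f (v i) S.* f (v j)) else S.0#)
    entry i j false = 0-hom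
    entry i j true  = trans (*-hom _ _) (cong₂ S._*_ (fromℤ-hom (a i j)) (*-hom _ _))

  integral-hom : (∀ {x y} → x R.≈ y → f x S.≈ f y) → ∀ {x} → OR.IsIntegral x → OS.IsIntegral (f x)
  integral-hom f-cong {x} (n , c , eq) = n , c , subst₂ S._≈_ lhs 0-hom (f-cong eq)
    where
    lhs : f (x OR.^ n R.+ OR.sum (λ i → OR.fromℤ (c i) R.* x OR.^ toℕ i)) ≡
          f x OS.^ n S.+ OS.sum (λ i → OS.fromℤ (c i) S.* f x OS.^ toℕ i)
    lhs = trans (+-hom _ _) (cong₂ S._+_ (^-hom x n)
      (sum-hom _ _ λ i → trans (*-hom _ _) (cong₂ S._*_ (fromℤ-hom (c i)) (^-hom x (toℕ i)))))

-- Almost integral elements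

common-multiple : ∀ {n} (P : Fin n → ℕ → Set) → (∀ i d e → P i d → P i (e ℕ.* d)) →
  (∀ i → ∃[ d ] (ℕ.NonZero d × P i d)) → ∃[ d ] (ℕ.NonZero d × ∀ i → P i d)
common-multiple {zero}  P scale h = 1 , _ , λ ()
common-multiple {suc n} P scale h
  with d , d≢0 , Pd ← h zero
  with e , e≢0 , Pe ← common-multiple (P ∘ suc) (scale ∘ suc) (h ∘ suc) =
  e ℕ.* d , ℕₚ.m*n≢0 e d {{e≢0}} {{d≢0}} , λ
    { zero    → scale zero d e Pd
    ; (suc i) → subst (P (suc i)) (ℕₚ.*-comm d e) (scale (suc i) e d (Pe i)) }

module CommutativeSemiringIdentities (R : CommutativeSemiring 0ℓ 0ℓ) where
  open CommutativeSemiring R using (_+_; _*_; _≈_) renaming (refl to ≈-refl)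
  open import Algebra.Solver.Ring.NaturalCoefficients.Default R

  interchange : ∀ x y u v → (x * y) * (u * v) ≈ (x * u) * (y * v)
  interchange = solve 4 (λ x y u v → (x :* y) :* (u :* v) := (x :* u) :* (y :* v)) ≈-refl

  shuffle : ∀ x y z w → x * y * (z * w) ≈ z * (x * (y * w))
  shuffle = solve 4 (λ x y z w → x :* y :* (z :* w) := z :* (x :* (y :* w))) ≈-refl

  expand : ∀ x u v p q r →
    x * (u * p * q * r) + x * (p * (v * q) * r) ≈ x * (p * q * ((u + v) * r))
  expand = solve 6 (λ x u v p q r →
    x :* (u :* p :* q :* r) :+ x :* (p :* (v :* q) :* r) := x :* (p :* q :* ((u :+ v) :* r))) ≈-refl

-- Bounded denominators of all powers replace integrality: this property follows
-- from a monic equation, passes to sums and products without any elimination,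
-- and still forces a rational number to be an integer.
module AlmostIntegrality (R : CommutativeRing 0ℓ 0ℓ) where
  open CommutativeRing R renaming (refl to ≈-refl; sym to ≈-sym; trans to ≈-trans)
  open OverRing rawRing

  -- `Λ` will be the order ℤ + ℤ√bc + ℤ√ac + ℤ√ab. It spans the field over ℚ, which is what
  -- `denominator` expresses, and denominators are measured relative to it.
  module Subring (Λ : Carrier → Set) (Λ-resp : ∀ {x y} → x ≈ y → Λ x → Λ y) (Λ-1 : Λ 1#)
    (Λ-+ : ∀ {x y} → Λ x → Λ y → Λ (x + y)) (Λ-* : ∀ {x y} → Λ x → Λ y → Λ (x * y))
    (Λ-neg : ∀ {x} → Λ x → Λ (- x))
    (denominator : ∀ x → ∃[ d ] (ℕ.NonZero d × Λ (d · 1# * x)))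
    where
    open CommutativeSemiringIdentities commutativeSemiring
    open Exponentiation semiring using (^-homo-*)
    open Multiplication semiring using (×1-homo-*)
    open Summation semiring using (*-distribˡ-sum; sum-cong-≋)
    open ≈-Reasoning setoid

    infixr 7 _∙_
    _∙_ : ℕ → Carrier → Carrier
    d ∙ x = d · 1# * x

    Λ-0 : Λ 0#
    Λ-0 = Λ-resp (-‿inverseʳ 1#) (Λ-+ Λ-1 (Λ-neg Λ-1))

    Λ-· : ∀ n → Λ (n · 1#)
    Λ-· zero    = Λ-0
    Λ-· (suc n) = Λ-+ Λ-1 (Λ-· n)

    Λ-fromℤ : ∀ z → Λ (fromℤ z)
    Λ-fromℤ (+ n)    = Λ-· n
    Λ-fromℤ -[1+ n ] = Λ-neg (Λ-· (suc n))

    Λ-sum : ∀ {n} (t : Vector Carrier n) → (∀ i → Λ (t i)) → Λ (sum t)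
    Λ-sum t h = foldr-related (λ u _ → Λ u) {_+′_ = _+_} {z′ = 0#} Λ-0 Λ-+ t t h

    ∙-* : ∀ d e x y → (d ℕ.* e) ∙ (x * y) ≈ (d ∙ x) * (e ∙ y)
    ∙-* d e x y = ≈-trans (*-congʳ (×1-homo-* d e)) (interchange (d · 1#) (e · 1#) x y)

    ∙-scale : ∀ d e x → Λ (d ∙ x) → Λ ((e ℕ.* d) ∙ x)
    ∙-scale d e x h = Λ-resp
      (≈-trans (≈-sym (*-assoc (e · 1#) (d · 1#) x)) (*-congʳ (≈-sym (×1-homo-* e d))))
      (Λ-* (Λ-· e) h)

    record AlmostIntegral (x : Carrier) : Set where
      constructor almostIntegral
      field
        bound     : ℕ
        bound≢0   : ℕ.NonZero bound
        bounded   : ∀ n → Λ (bound ∙ x ^ n)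

    -- Some d clears the denominators of the powers below the degree. The monic equation writes
    -- every higher power as an integral combination of earlier ones, so the same d serves for all.
    integral⇒almostIntegral : ∀ {x} → IsIntegral x → AlmostIntegral x
    integral⇒almostIntegral {x} (n , coeff , eq)
      with d , d≢0 , h ← common-multiple (λ i d → Λ (d ∙ x ^ toℕ i))
        (λ i d e → ∙-scale d e (x ^ toℕ i)) (λ (i : Fin n) → denominator (x ^ toℕ i))
      = almostIntegral d d≢0 (<-rec (λ j → Λ (d ∙ x ^ j)) step)
      where
      tail : Carrier
      tail = sum λ i → fromℤ (coeff i) * x ^ toℕ i
      reduce : ∀ k → d ∙ x ^ (k ℕ.+ n) ≈ - sum (λ i → fromℤ (coeff i) * (d ∙ x ^ (k ℕ.+ toℕ i)))
      reduce k = begin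
        d ∙ x ^ (k ℕ.+ n)            ≈⟨ *-congˡ (^-homo-* x k n) ⟩
        d ∙ (x ^ k * x ^ n)          ≈⟨ *-congˡ
          (*-congˡ (GroupProperties.inverseˡ-unique +-group _ _ eq)) ⟩
        d ∙ (x ^ k * - tail)         ≈⟨ *-assoc _ _ _ ⟨
        (d ∙ x ^ k) * - tail         ≈⟨ RingProperties.-‿distribʳ-* ring _ _ ⟨
        - ((d ∙ x ^ k) * tail)       ≈⟨ -‿cong
          (*-distribˡ-sum {n} (d ∙ x ^ k) (λ i → fromℤ (coeff i) * x ^ toℕ i)) ⟩
        - sum (λ i → (d ∙ x ^ k) * (fromℤ (coeff i) * x ^ toℕ i))
          ≈⟨ -‿cong (sum-cong-≋ λ i → ≈-trans
            (shuffle (d · 1#) (x ^ k) (fromℤ (coeff i)) (x ^ toℕ i))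
               (*-congˡ (*-congˡ (≈-sym (^-homo-* x k (toℕ i)))))) ⟩
        - sum (λ i → fromℤ (coeff i) * (d ∙ x ^ (k ℕ.+ toℕ i))) ∎
      step : ∀ j → (∀ {i} → i ℕ.< j → Λ (d ∙ x ^ i)) → Λ (d ∙ x ^ j)
      step j rec with j ℕₚ.<? n
      ... | yes j<n = subst (λ i → Λ (d ∙ x ^ i)) (Finₚ.toℕ-fromℕ< j<n) (h (fromℕ< j<n))
      ... | no  j≮n = subst (λ i → Λ (d ∙ x ^ i)) j≡ (Λ-resp (≈-sym (reduce k))
          (Λ-neg (Λ-sum (λ i → fromℤ (coeff i) * (d ∙ x ^ (k ℕ.+ toℕ i))) λ i →
            Λ-* (Λ-fromℤ (coeff i)) (rec (subst (k ℕ.+ toℕ i ℕ.<_) j≡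
              (ℕₚ.+-monoʳ-< k (Finₚ.toℕ<n i)))))))
        where
        k = j ℕ.∸ n
        j≡ : k ℕ.+ n ≡ j
        j≡ = ℕₚ.m∸n+n≡m (ℕₚ.≮⇒≥ j≮n)

    module _ {x y : Carrier} (hx : AlmostIntegral x) (hy : AlmostIntegral y) where
      open AlmostIntegral hx renaming (bound to d; bound≢0 to d≢0; bounded to x-bounded)
      open AlmostIntegral hy renaming (bound to e; bound≢0 to e≢0; bounded to y-bounded)
      private
        de≢0 : ℕ.NonZero (d ℕ.* e)
        de≢0 = ℕₚ.m*n≢0 d e {{d≢0}} {{e≢0}}

        monomials : ∀ i j → Λ ((d ℕ.* e) ∙ (x ^ i * y ^ j))
        monomials i j = Λ-resp (≈-sym (∙-* d e (x ^ i) (y ^ j))) (Λ-* (x-bounded i) (y-bounded j))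

        -- The extra monomial makes the induction close: splitting off one factor x + y raises
        -- either i or j by one, and both resulting terms share the denominator d e.
        monomials*sum : ∀ n i j → Λ ((d ℕ.* e) ∙ (x ^ i * y ^ j * (x + y) ^ n))
        monomials*sum zero    i j = Λ-resp (*-congˡ (≈-sym (*-identityʳ _))) (monomials i j)
        monomials*sum (suc n) i j = Λ-resp
          (expand ((d ℕ.* e) · 1#) x y (x ^ i) (y ^ j) ((x + y) ^ n))
          (Λ-+ (monomials*sum n (suc i) j) (monomials*sum n i (suc j)))

      +-almostIntegral : AlmostIntegral (x + y)
      +-almostIntegral = almostIntegral (d ℕ.* e) de≢0 λ n →
        Λ-resp (*-congˡ (≈-trans (*-congʳ (*-identityˡ _)) (*-identityˡ _))) (monomials*sum n 0 0)

      *-almostIntegral : AlmostIntegral (x * y)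
      *-almostIntegral = almostIntegral (d ℕ.* e) de≢0 λ n →
        Λ-resp (*-congˡ (≈-sym (^-distrib n))) (monomials n n)
        where
        ^-distrib : ∀ n → (x * y) ^ n ≈ x ^ n * y ^ n
        ^-distrib zero    = ≈-sym (*-identityˡ _)
        ^-distrib (suc n) = ≈-trans (*-congˡ (^-distrib n)) (interchange x y (x ^ n) (y ^ n))

-- Symmetries and conjugates of the biquadratic field

fromℤ-ℚ : ∀ z → ℚ-form.fromℤ z ≡ ι z
fromℤ-ℚ = λ { (+ n) → ·1 n ; -[1+ n ] → trans (cong ℚ.-_ (·1 (suc n))) (sym (ι-neg (+ suc n))) }
  where
  ·1 : ∀ n → n ℚ-form.· 1ℚ ≡ ι (+ n)
  ·1 zero    = refl
  ·1 (suc n) = trans (cong (1ℚ ℚ.+_) (·1 n)) (sym (ι-+ (+ 1) (+ n)))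

module _ (a b c : ℕ) where
  open BiquadraticRing a b c using (embed; embed-*; commutativeRing)
  open CommutativeRing commutativeRing using (rawRing)

  embed-isHom : IsHom ℚ.+-*-rawRing rawRing embed
  embed-isHom = record
    { +-hom   = λ x y → refl
    ; *-hom   = λ x y → sym (trans (embed-* x y 0ℚ 0ℚ 0ℚ)
        (cong₄ refl (ℚₚ.*-zeroʳ x) (ℚₚ.*-zeroʳ x) (ℚₚ.*-zeroʳ x)))
    ; neg-hom = λ x → refl
    ; 0-hom   = refl
    ; 1-hom   = refl
    }

rawBiquadratic = λ a b c → CommutativeRing.rawRing (BiquadraticRing.commutativeRing a b c)

fromℤ-embed : ∀ a b c z → OverRing.fromℤ (rawBiquadratic a b c) z
  ≡ BiquadraticRing.embed a b c (ι z)
fromℤ-embed a b c z = trans (sym (IsHom.fromℤ-hom (embed-isHom a b c) z))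
  (cong (BiquadraticRing.embed a b c) (fromℤ-ℚ z))

module _ {a b c : ℕ} where
  open +-*-Solver

  swap₁₂ : Biquadratic a b c → Biquadratic b a c
  swap₁₂ ⟪ x , y , s , t ⟫ = ⟪ x , s , y , t ⟫

  swap₂₃ : Biquadratic a b c → Biquadratic a c b
  swap₂₃ ⟪ x , y , s , t ⟫ = ⟪ x , y , t , s ⟫

  -- The nontrivial automorphism over ℚ(√bc); `conjugateₙ` is the one over ℚ(√ac), and their
  -- composite fixes √ab.
  conjugateₘ : Biquadratic a b c → Biquadratic a b c
  conjugateₘ ⟪ x , y , s , t ⟫ = ⟪ x , y , ℚ.- s , ℚ.- t ⟫

  swap₁₂-isHom : IsHom (rawBiquadratic a b c) (rawBiquadratic b a c) swap₁₂
  swap₁₂-isHom = record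
    { +-hom   = λ _ _ → refl
    ; *-hom   = λ { ⟪ x , y , s , t ⟫ ⟪ x′ , y′ , s′ , t′ ⟫ → cong₄
        (solve 7 (λ X Y S T a b c →
          X :+ b :* c :* Y :+ a :* c :* S :+ a :* b :* T :=
          X :+ a :* c :* S :+ b :* c :* Y :+ b :* a :* T) refl
          (x ℚ.* x′) (y ℚ.* y′) (s ℚ.* s′) (t ℚ.* t′) (ι (+ a)) (ι (+ b)) (ι (+ c)))
        refl refl
        (cong (λ z → x ℚ.* t′ ℚ.+ t ℚ.* x′ ℚ.+ ι (+ c) ℚ.* z) (ℚₚ.+-comm (y ℚ.* s′) (s ℚ.* y′))) }
    ; neg-hom = λ _ → refl
    ; 0-hom   = refl
    ; 1-hom   = refl
    }

  swap₂₃-isHom : IsHom (rawBiquadratic a b c) (rawBiquadratic a c b) swap₂₃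
  swap₂₃-isHom = record
    { +-hom   = λ _ _ → refl
    ; *-hom   = λ { ⟪ x , y , s , t ⟫ ⟪ x′ , y′ , s′ , t′ ⟫ → cong₄
        (solve 7 (λ X Y S T a b c →
          X :+ b :* c :* Y :+ a :* c :* S :+ a :* b :* T :=
          X :+ c :* b :* Y :+ a :* b :* T :+ a :* c :* S) refl
          (x ℚ.* x′) (y ℚ.* y′) (s ℚ.* s′) (t ℚ.* t′) (ι (+ a)) (ι (+ b)) (ι (+ c)))
        (cong (λ z → x ℚ.* y′ ℚ.+ y ℚ.* x′ ℚ.+ ι (+ a) ℚ.* z) (ℚₚ.+-comm (s ℚ.* t′) (t ℚ.* s′)))
        refl refl }
    ; neg-hom = λ _ → refl
    ; 0-hom   = refl
    ; 1-hom   = refl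
    }

  conjugateₘ-isHom : IsHom (rawBiquadratic a b c) (rawBiquadratic a b c) conjugateₘ
  conjugateₘ-isHom = record
    { +-hom   = λ { ⟪ _ , _ , s , t ⟫ ⟪ _ , _ , s′ , t′ ⟫ → cong₄ refl refl
                      (ℚₚ.neg-distrib-+ s s′) (ℚₚ.neg-distrib-+ t t′) }
    ; *-hom   = λ { ⟪ x , y , s , t ⟫ ⟪ x′ , y′ , s′ , t′ ⟫ → cong₄
        (solve 9 (λ X a b c Y s t s′ t′ →
          X :+ b :* c :* Y :+ a :* c :* (s :* s′) :+ a :* b :* (t :* t′) :=
          X :+ b :* c :* Y :+ a :* c :* (:- s :* :- s′) :+ a :* b :* (:- t :* :- t′)) refl
          (x ℚ.* x′) (ι (+ a)) (ι (+ b)) (ι (+ c)) (y ℚ.* y′) s t s′ t′)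
        (solve 6 (λ X a s t s′ t′ →
          X :+ a :* (s :* t′ :+ t :* s′) := X :+ a :* (:- s :* :- t′ :+ :- t :* :- s′)) refl
          (x ℚ.* y′ ℚ.+ y ℚ.* x′) (ι (+ a)) s t s′ t′)
        (neg₂ x y s t x′ y′ s′ t′ (ι (+ b)))
        (neg₂ x y t s x′ y′ t′ s′ (ι (+ c))) }
    ; neg-hom = λ _ → refl
    ; 0-hom   = refl
    ; 1-hom   = refl
    }
    where
    neg₂ = solve 9 (λ x y s t x′ y′ s′ t′ b →
      :- (x :* s′ :+ s :* x′ :+ b :* (y :* t′ :+ t :* y′)) :=
      x :* :- s′ :+ :- s :* x′ :+ b :* (y :* :- t′ :+ :- t :* y′)) refl

conjugateₙ : ∀ {a b c} → Biquadratic a b c → Biquadratic a b c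
conjugateₙ = swap₁₂ ∘ conjugateₘ ∘ swap₁₂

module _ {a b c : ℕ} where
  open OverRing (rawBiquadratic a b c)

  conjugateₘ-integral : ∀ {v} → IsIntegral v → IsIntegral (conjugateₘ v)
  conjugateₘ-integral = IsHom.integral-hom conjugateₘ-isHom (cong conjugateₘ)

  conjugateₙ-integral : ∀ {v} → IsIntegral v → IsIntegral (conjugateₙ v)
  conjugateₙ-integral =
    IsHom.integral-hom swap₁₂-isHom (cong swap₁₂) ∘
    IsHom.integral-hom conjugateₘ-isHom (cong conjugateₘ) ∘
    IsHom.integral-hom swap₁₂-isHom (cong swap₁₂)

  open BiquadraticRing a b c using (embed; embed-*; commutativeRing)

  record IntegerCoordinates (v : Biquadratic a b c) : Set where
    constructor integerCoordinates
    field
      int₁ : IsInteger (c₁ v)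
      intₘ : IsInteger (cₘ v)
      intₙ : IsInteger (cₙ v)
      intₖ : IsInteger (cₖ v)
  open IntegerCoordinates public

  private
    module R = CommutativeRing commutativeRing

    iA = integer (+ a)
    iB = integer (+ b)
    iC = integer (+ c)

    +-integer : ∀ {u v} → IntegerCoordinates u → IntegerCoordinates v → IntegerCoordinates (u R.+ v)
    +-integer (integerCoordinates x y s t) (integerCoordinates x′ y′ s′ t′) =
      integerCoordinates (x ⊕ x′) (y ⊕ y′) (s ⊕ s′) (t ⊕ t′)

    neg-integer : ∀ {u} → IntegerCoordinates u → IntegerCoordinates (R.- u)
    neg-integer (integerCoordinates x y s t) =
      integerCoordinates (neg-isInteger x) (neg-isInteger y) (neg-isInteger s) (neg-isInteger t)

    *-integer : ∀ {u v} → IntegerCoordinates u → IntegerCoordinates v → IntegerCoordinates (u R.* v)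
    *-integer (integerCoordinates x y s t) (integerCoordinates x′ y′ s′ t′) = integerCoordinates
      (x ⊗ x′ ⊕ iB ⊗ iC ⊗ (y ⊗ y′) ⊕ iA ⊗ iC ⊗ (s ⊗ s′) ⊕ iA ⊗ iB ⊗ (t ⊗ t′))
      (x ⊗ y′ ⊕ y ⊗ x′ ⊕ iA ⊗ (s ⊗ t′ ⊕ t ⊗ s′))
      (x ⊗ s′ ⊕ s ⊗ x′ ⊕ iB ⊗ (y ⊗ t′ ⊕ t ⊗ y′))
      (x ⊗ t′ ⊕ t ⊗ x′ ⊕ iC ⊗ (y ⊗ s′ ⊕ s ⊗ y′))

    coordinate : Biquadratic a b c → Fin 4 → ℚ
    coordinate v zero                   = c₁ v
    coordinate v (suc zero)             = cₘ v
    coordinate v (suc (suc zero))       = cₙ v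
    coordinate v (suc (suc (suc zero))) = cₖ v

    ι-scale : ∀ e d x → ι (+ e) ℚ.* (ι (+ d) ℚ.* x) ≡ ι (+ (e ℕ.* d)) ℚ.* x
    ι-scale e d x = trans (sym (ℚₚ.*-assoc (ι (+ e)) (ι (+ d)) x))
      (cong (ℚ._* x) (trans (sym (ι-* (+ e) (+ d))) (cong ι (sym (ℤₚ.pos-* e d)))))

    ·1≡embed : ∀ d → d · R.1# ≡ embed (ι (+ d))
    ·1≡embed d = fromℤ-embed a b c (+ d)

    denominator : ∀ v → ∃[ d ] (ℕ.NonZero d × IntegerCoordinates (d · R.1# R.* v))
    denominator v
      with d , d≢0 , h ← common-multiple (λ i d → IsInteger (ι (+ d) ℚ.* coordinate v i))
        (λ i d e p → subst IsInteger (ι-scale e d (coordinate v i)) (integer (+ e) ⊗ p))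
        (λ i → ↧ₙ coordinate v i , _ , ↥ coordinate v i , denominator-clear (coordinate v i))
      = d , d≢0 , subst IntegerCoordinates
          (sym (trans (cong (R._* v) (·1≡embed d)) (embed-* (ι (+ d)) (c₁ v) (cₘ v) (cₙ v) (cₖ v))))
          (integerCoordinates (h zero) (h (suc zero)) (h (suc (suc zero)))
            (h (suc (suc (suc zero)))))

    module AI = AlmostIntegrality.Subring commutativeRing IntegerCoordinates
      (subst IntegerCoordinates)
      (integerCoordinates (integer (+ 1)) (integer (+ 0)) (integer (+ 0)) (integer (+ 0)))
      +-integer *-integer neg-integer denominator

  open AI public using (AlmostIntegral; almostIntegral; integral⇒almostIntegral; +-almostIntegral;
    *-almostIntegral)

  almostIntegral⇒isInteger : ∀ {x} → AlmostIntegral (embed x) → IsInteger x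
  almostIntegral⇒isInteger {x} (almostIntegral d d≢0 h) = powers-bounded⇒isInteger x d {{d≢0}} λ n →
    subst IsInteger (cong c₁ (power n)) (int₁ (h n))
    where
    open IsHom (embed-isHom a b c)
    power : ∀ n → d · R.1# R.* embed x ^ n ≡ embed (ι (+ d) ℚ.* x ^ℚ n)
    power n = trans (cong₂ R._*_ (·1≡embed d) (sym (^-hom x n))) (sym (*-hom (ι (+ d)) (x ^ℚ n)))

-- Traces and norms to quadratic subfields

double : ℚ → ℚ
double x = x ℚ.+ x

private
  open +-*-Solver

  double-norm : ∀ k u w → double u ℚ.* double u ℚ.- k ℚ.* (double w ℚ.* double w) ≡
                ι (+ 4) ℚ.* (u ℚ.* u ℚ.- k ℚ.* (w ℚ.* w))
  double-norm = solve 3 (λ k u w → (u :+ u) :* (u :+ u) :- k :* ((w :+ w) :* (w :+ w)) :=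
                  con (ι (+ 4)) :* (u :* u :- k :* (w :* w))) refl

  double-square : ∀ k u w → double u ℚ.* double u ℚ.- ι (+ 4) ℚ.* (u ℚ.* u ℚ.- k ℚ.* (w ℚ.* w)) ≡
                  k ℚ.* (double w ℚ.* double w)
  double-square = solve 3 (λ k u w → (u :+ u) :* (u :+ u)
    :- con (ι (+ 4)) :* (u :* u :- k :* (w :* w)) :=
                    k :* ((w :+ w) :* (w :+ w))) refl

  double-norm₁ : ∀ k l m x y s t →
    double x ℚ.* double x ℚ.+ k ℚ.* (double y ℚ.* double y) ℚ.- l ℚ.* (double s ℚ.* double s)
      ℚ.- m ℚ.* (double t ℚ.* double t) ≡
    ι (+ 2) ℚ.* double (x ℚ.* x ℚ.+ k ℚ.* (y ℚ.* y) ℚ.- l ℚ.* (s ℚ.* s) ℚ.- m ℚ.* (t ℚ.* t))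
  double-norm₁ = solve 7 (λ k l m x y s t →
    (x :+ x) :* (x :+ x) :+ k :* ((y :+ y) :* (y :+ y)) :- l :* ((s :+ s) :* (s :+ s))
      :- m :* ((t :+ t) :* (t :+ t)) :=
    con (ι (+ 2)) :* (x :* x :+ k :* (y :* y) :- l :* (s :* s) :- m :* (t :* t) :+
                      (x :* x :+ k :* (y :* y) :- l :* (s :* s) :- m :* (t :* t)))) refl

  double-norm₂ : ∀ a x y s t → double x ℚ.* double y ℚ.- a ℚ.* (double s ℚ.* double t) ≡
    double (double (x ℚ.* y) ℚ.- a ℚ.* double (s ℚ.* t))
  double-norm₂ = solve 5 (λ a x y s t → (x :+ x) :* (y :+ y) :- a :* ((s :+ s) :* (t :+ t)) :=
    (x :* y :+ x :* y) :- a :* (s :* t :+ s :* t)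
      :+ ((x :* y :+ x :* y) :- a :* (s :* t :+ s :* t))) refl

module _ {a b c : ℕ} where
  open OverRing (rawBiquadratic a b c) using (IsIntegral)
  open BiquadraticRing a b c using (embed; commutativeRing)
  private
    module R = CommutativeRing commutativeRing
    A B C : ℚ
    A = ι (+ a)
    B = ι (+ b)
    C = ι (+ c)
  open +-*-Solver

  -- The trace and the norm of p + q√bc are a sum and a product of almost integral elements, and
  -- both are rational.
  quadratic-facts : ∀ {p q} → AlmostIntegral {a} {b} {c} ⟪ p , q , 0ℚ , 0ℚ ⟫ →
    AlmostIntegral {a} {b} {c} ⟪ p , ℚ.- q , 0ℚ , 0ℚ ⟫ →
    IsInteger (double p) × IsInteger (p ℚ.* p ℚ.- B ℚ.* C ℚ.* (q ℚ.* q))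
  quadratic-facts {p} {q} h h′ =
    almostIntegral⇒isInteger (subst AlmostIntegral
      (cong₄ refl (ℚₚ.+-inverseʳ q) refl refl) (+-almostIntegral h h′)) ,
    almostIntegral⇒isInteger (subst AlmostIntegral
      (cong₄
        (solve 5 (λ a b c p q → p :* p :+ b :* c :* (q :* :- q) :+ a :* c :* con 0ℚ
          :+ a :* b :* con 0ℚ :=
          p :* p :- b :* c :* (q :* q)) refl A B C p q)
        (solve 3 (λ a p q → p :* :- q :+ q :* p :+ a :* con 0ℚ := con 0ℚ) refl A p q)
        (zero₂ B p q) (zero₂ C p q))
      (*-almostIntegral h h′))
    where
    zero₂ = solve 3 (λ b p q →
      p :* con 0ℚ :+ con 0ℚ :* p :+ b :* (q :* con 0ℚ :+ con 0ℚ :* (:- q)) := con 0ℚ) refl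

  -- N₁ + N₂ √bc is the norm of x + y√bc + s√ac + t√ab to ℚ(√bc).
  N₁ N₂ : (x y s t : ℚ) → ℚ
  N₁ x y s t = x ℚ.* x ℚ.+ B ℚ.* C ℚ.* (y ℚ.* y) ℚ.- A ℚ.* C ℚ.* (s ℚ.* s) ℚ.- A ℚ.* B ℚ.* (t ℚ.* t)
  N₂ x y s t = double (x ℚ.* y) ℚ.- A ℚ.* double (s ℚ.* t)

  module _ {x y : ℚ} where
    -- Here z is the norm of 2x + 2y√bc. Then bc (4y)² = (4x)² - 4z is an integer, and bc is
    -- squarefree, so 4y is an integer as well.
    quarter-integers : SquareFree (b ℕ.* c) → IsInteger (double (double x)) →
      IsInteger (double x ℚ.* double x ℚ.- B ℚ.* C ℚ.* (double y ℚ.* double y)) →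
      ∃[ X ] ∃[ Y ] (double (double x) ≡ ι X × double (double y) ≡ ι Y ×
       ∃[ z ] X ℤ.* X ℤ.- + b ℤ.* + c ℤ.* (Y ℤ.* Y) ≡ + 4 ℤ.* z)
    quarter-integers sf iX z = proj₁ iX , proj₁ iY , proj₂ iX , proj₂ iY , proj₁ z ,
      isInteger-unique (double-norm (B ℚ.* C) (double x) (double y))
        (iX ⊗ iX ⊖ integer (+ b) ⊗ integer (+ c) ⊗ (iY ⊗ iY)) (integer (+ 4) ⊗ z)
      where
      iY : IsInteger (double (double y))
      iY = squareFree⇒isInteger (double (double y)) sf (subst IsInteger
        (trans (double-square (B ℚ.* C) (double x) (double y))
          (cong (ℚ._* (double (double y) ℚ.* double (double y)))
            (trans (sym (ι-* (+ b) (+ c))) (cong ι (sym (ℤₚ.pos-* b c))))))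
        (iX ⊗ iX ⊖ integer (+ 4) ⊗ z))

  -- U is 2 `N₁`, and X Y - a S T is 2 `N₂`, so the last expression is four times the norm w of the
  -- element to ℚ.
  half-norm-integers : ∀ {x y s t X Y S T} → double x ≡ ι X → double y ≡ ι Y → double s ≡ ι S →
    double t ≡ ι T →
    IsInteger (double (N₁ x y s t)) →
    IsInteger (N₁ x y s t ℚ.* N₁ x y s t ℚ.- B ℚ.* C ℚ.* (N₂ x y s t ℚ.* N₂ x y s t)) →
    ∃[ U ] ∃[ w ]
     (X ℤ.* X ℤ.+ + b ℤ.* + c ℤ.* (Y ℤ.* Y) ℤ.- + a ℤ.* + c ℤ.* (S ℤ.* S)
       ℤ.- + a ℤ.* + b ℤ.* (T ℤ.* T) ≡ + 2 ℤ.* U ×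
      U ℤ.* U ℤ.- + b ℤ.* + c ℤ.* ((X ℤ.* Y ℤ.- + a ℤ.* (S ℤ.* T))
        ℤ.* (X ℤ.* Y ℤ.- + a ℤ.* (S ℤ.* T))) ≡ + 4 ℤ.* w)
  half-norm-integers {x} {y} {s} {t} {X} {Y} {S} {T} x≡ y≡ s≡ t≡ U w = proj₁ U , proj₁ w ,
    isInteger-unique (double-norm₁ (B ℚ.* C) (A ℚ.* C) (A ℚ.* B) x y s t)
      (iX ⊗ iX ⊕ iB ⊗ iC ⊗ (iY ⊗ iY) ⊖ iA ⊗ iC ⊗ (iS ⊗ iS) ⊖ iA ⊗ iB ⊗ (iT ⊗ iT))
      (integer (+ 2) ⊗ U) ,
    isInteger-unique
      (trans (cong (λ V → double n₁ ℚ.* double n₁ ℚ.- B ℚ.* C ℚ.* (V ℚ.* V))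
        (double-norm₂ A x y s t))
        (double-norm (B ℚ.* C) n₁ (N₂ x y s t)))
      (U ⊗ U ⊖ iB ⊗ iC ⊗ (iV ⊗ iV)) (integer (+ 4) ⊗ w)
    where
    n₁ = N₁ x y s t
    iA = integer (+ a)
    iB = integer (+ b)
    iC = integer (+ c)
    iX : IsInteger (double x)
    iX = X , x≡
    iY : IsInteger (double y)
    iY = Y , y≡
    iS : IsInteger (double s)
    iS = S , s≡
    iT : IsInteger (double t)
    iT = T , t≡
    iV = iX ⊗ iY ⊖ iA ⊗ (iS ⊗ iT)

  module _ {x y s t : ℚ} (v-int : IsIntegral ⟪ x , y , s , t ⟫) where
    private
      v : Biquadratic a b c
      v = ⟪ x , y , s , t ⟫

      ai = integral⇒almostIntegral v-int
      aiₘ = integral⇒almostIntegral (conjugateₘ-integral v-int)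
      aiₙ = integral⇒almostIntegral (conjugateₙ-integral v-int)
      aiₖ = integral⇒almostIntegral (conjugateₙ-integral (conjugateₘ-integral v-int))

    -- The relative trace 2x + 2y√bc is v plus its conjugate over ℚ(√bc); the sum of the other two
    -- conjugates of v is the conjugate of that trace. The same pairing, with products, gives
    -- `norm-facts`.
    trace-facts : IsInteger (double (double x)) ×
      IsInteger (double x ℚ.* double x ℚ.- B ℚ.* C ℚ.* (double y ℚ.* double y))
    trace-facts = quadratic-facts
      (subst AlmostIntegral (cong₄ refl refl (ℚₚ.+-inverseʳ s) (ℚₚ.+-inverseʳ t))
        (+-almostIntegral ai aiₘ))
      (subst AlmostIntegral (cong₄ refl (sym (ℚₚ.neg-distrib-+ y y)) (ℚₚ.+-inverseʳ s)
        (ℚₚ.+-inverseʳ (ℚ.- t)))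
        (+-almostIntegral aiₙ aiₖ))

    norm-facts : IsInteger (double (N₁ x y s t)) ×
      IsInteger (N₁ x y s t ℚ.* N₁ x y s t ℚ.- B ℚ.* C ℚ.* (N₂ x y s t ℚ.* N₂ x y s t))
    norm-facts = quadratic-facts
      (subst AlmostIntegral (cong₄
          (solve 7 (λ a b c x y s t →
            x :* x :+ b :* c :* (y :* y) :+ a :* c :* (s :* :- s) :+ a :* b :* (t :* :- t) :=
            x :* x :+ b :* c :* (y :* y) :- a :* c :* (s :* s)
              :- a :* b :* (t :* t)) refl A B C x y s t)
          (solve 5 (λ a x y s t → x :* y :+ y :* x :+ a :* (s :* :- t :+ t :* :- s) :=
            x :* y :+ x :* y :- a :* (s :* t :+ s :* t)) refl A x y s t)
          (zero₂ x s B y t) (zero₂ x t C y s))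
        (*-almostIntegral ai aiₘ))
      (subst AlmostIntegral (cong₄
          (solve 7 (λ a b c x y s t →
            x :* x :+ b :* c :* (:- y :* :- y) :+ a :* c :* (s :* :- s)
              :+ a :* b :* (:- t :* :- (:- t)) :=
            x :* x :+ b :* c :* (y :* y) :- a :* c :* (s :* s)
              :- a :* b :* (t :* t)) refl A B C x y s t)
          (solve 5 (λ a x y s t → x :* :- y :+ :- y :* x :+ a :* (s :* :- (:- t) :+ :- t :* :- s) :=
            :- (x :* y :+ x :* y :- a :* (s :* t :+ s :* t))) refl A x y s t)
          (solve 5 (λ x s b y t → x :* :- s :+ s :* x :+ b :* (:- y :* :- (:- t) :+ :- t :* :- y) :=
            con 0ℚ) refl x s B y t)
          (solve 5 (λ x t c y s → x :* :- (:- t) :+ :- t :* x :+ c :* (:- y :* :- s :+ s :* :- y) :=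
            con 0ℚ) refl x t C y s))
        (*-almostIntegral aiₙ aiₖ))
      where
      zero₂ = solve 5 (λ x s b y t → x :* :- s :+ s :* x :+ b :* (y :* :- t :+ t :* y) :=
        con 0ℚ) refl

-- Congruences modulo 4

Even : ℤ → Set
Even z = ∃[ h ] z ≡ + 2 ℤ.* h

infix 4 _≈₄_
record _≈₄_ (x y : ℤ) : Set where
  constructor mod₄
  field
    quotient : ℤ
    equation : x ≡ y ℤ.+ + 4 ℤ.* quotient

≈₄-refl : ∀ {x} → x ≈₄ x
≈₄-refl {x} = mod₄ (+ 0) (sym (ℤₚ.+-identityʳ x))

≈₄-sym : ∀ {x y} → x ≈₄ y → y ≈₄ x
≈₄-sym {y = y} (mod₄ k refl) = mod₄ (ℤ.- k) (lemma y k)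
  where
  lemma : ∀ y k → y ≡ y ℤ.+ + 4 ℤ.* k ℤ.+ + 4 ℤ.* (ℤ.- k)
  lemma = ℤSolver.solve-∀

≈₄-trans : ∀ {x y z} → x ≈₄ y → y ≈₄ z → x ≈₄ z
≈₄-trans {z = z} (mod₄ k refl) (mod₄ l refl) = mod₄ (l ℤ.+ k) (lemma z k l)
  where
  lemma : ∀ z k l → z ℤ.+ + 4 ℤ.* l ℤ.+ + 4 ℤ.* k ≡ z ℤ.+ + 4 ℤ.* (l ℤ.+ k)
  lemma = ℤSolver.solve-∀

infixl 6 _+₄_ _-₄_
infixl 7 _*₄_

_+₄_ : ∀ {x x′ y y′} → x ≈₄ x′ → y ≈₄ y′ → x ℤ.+ y ≈₄ x′ ℤ.+ y′
_+₄_ {x′ = x} {y′ = y} (mod₄ k refl) (mod₄ l refl) = mod₄ (k ℤ.+ l) (lemma x y k l)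
  where
  lemma : ∀ x y k l → (x ℤ.+ + 4 ℤ.* k) ℤ.+ (y ℤ.+ + 4 ℤ.* l) ≡ (x ℤ.+ y) ℤ.+ + 4 ℤ.* (k ℤ.+ l)
  lemma = ℤSolver.solve-∀

_*₄_ : ∀ {x x′ y y′} → x ≈₄ x′ → y ≈₄ y′ → x ℤ.* y ≈₄ x′ ℤ.* y′
_*₄_ {x′ = x} {y′ = y} (mod₄ k refl) (mod₄ l refl) =
  mod₄ (x ℤ.* l ℤ.+ k ℤ.* y ℤ.+ + 4 ℤ.* (k ℤ.* l)) (lemma x y k l)
  where
  lemma : ∀ x y k l → (x ℤ.+ + 4 ℤ.* k) ℤ.* (y ℤ.+ + 4 ℤ.* l) ≡
          (x ℤ.* y) ℤ.+ + 4 ℤ.* (x ℤ.* l ℤ.+ k ℤ.* y ℤ.+ + 4 ℤ.* (k ℤ.* l))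
  lemma = ℤSolver.solve-∀

_-₄_ : ∀ {x x′ y y′} → x ≈₄ x′ → y ≈₄ y′ → x ℤ.- y ≈₄ x′ ℤ.- y′
_-₄_ {x′ = x} {y′ = y} (mod₄ k refl) (mod₄ l refl) = mod₄ (k ℤ.- l) (lemma x y k l)
  where
  lemma : ∀ x y k l → (x ℤ.+ + 4 ℤ.* k) ℤ.- (y ℤ.+ + 4 ℤ.* l) ≡ (x ℤ.- y) ℤ.+ + 4 ℤ.* (k ℤ.- l)
  lemma = ℤSolver.solve-∀

residue : ℤ → Fin 4
residue z = fromℕ< (ℤ/.n%d<d z (+ 4))

fin : Fin 4 → ℤ
fin i = + toℕ i

residue-≈₄ : ∀ z → z ≈₄ fin (residue z)
residue-≈₄ z = mod₄ (z ℤ/./ (+ 4)) (trans (ℤ/.a≡a%n+[a/n]*n z (+ 4)) (cong₂ ℤ._+_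
  (cong +_ (sym (Finₚ.toℕ-fromℕ< (ℤ/.n%d<d z (+ 4))))) (ℤₚ.*-comm (z ℤ/./ (+ 4)) (+ 4))))

-- Divisibility as an equation of remainders: on closed terms it is decided by evaluation, so
-- statements about residues modulo 4 can be verified by running through all cases.
_∣ᵇ_ : (d : ℕ) .{{_ : ℕ.NonZero d}} → ℤ → Set
d ∣ᵇ z = ℤ.∣ z ∣ ℕ.% d ≡ 0

_∣ᵇ?_ : (d : ℕ) .{{_ : ℕ.NonZero d}} (z : ℤ) → Dec (d ∣ᵇ z)
d ∣ᵇ? z = ℤ.∣ z ∣ ℕ.% d ℕₚ.≟ 0

≈₄0⇒∣ᵇ : ∀ {x} → x ≈₄ + 0 → 4 ∣ᵇ x
≈₄0⇒∣ᵇ {x} (mod₄ k refl) = trans (cong (ℕ._% 4)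
  (trans (cong ℤ.∣_∣ (ℤₚ.+-identityˡ (+ 4 ℤ.* k)))
  (trans (ℤₚ.abs-* (+ 4) k) (ℕₚ.*-comm 4 ℤ.∣ k ∣))))
  (ℕ/.m*n%n≡0 ℤ.∣ k ∣ 4)

∣ᵇ⇒Even : ∀ {x} → 2 ∣ᵇ x → Even x
∣ᵇ⇒Even {x} h = ℤ.sign x ℤ.◃ (ℤ.∣ x ∣ ℕ./ 2) , (begin
  x                                              ≡⟨ ℤₚ.signᵢ◃∣i∣≡i x ⟨
  ℤ.sign x ℤ.◃ ℤ.∣ x ∣                            ≡⟨ cong (ℤ.sign x ℤ.◃_) abs≡ ⟩
  ℤ.sign x ℤ.◃ (2 ℕ.* (ℤ.∣ x ∣ ℕ./ 2))
    ≡⟨ ℤₚ.◃-distrib-* Sign.+ (ℤ.sign x) 2 (ℤ.∣ x ∣ ℕ./ 2) ⟩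
  + 2 ℤ.* (ℤ.sign x ℤ.◃ (ℤ.∣ x ∣ ℕ./ 2))          ∎)
  where
  open ≡-Reasoning
  abs≡ : ℤ.∣ x ∣ ≡ 2 ℕ.* (ℤ.∣ x ∣ ℕ./ 2)
  abs≡ = trans (ℕ/.m≡m%n+[m/n]*n ℤ.∣ x ∣ 2) (trans (cong (ℕ._+ ℤ.∣ x ∣ ℕ./ 2 ℕ.* 2) h)
    (ℕₚ.*-comm (ℤ.∣ x ∣ ℕ./ 2) 2))

Even-≈₄ : ∀ {x y} → x ≈₄ y → Even y → Even x
Even-≈₄ (mod₄ k refl) (h , refl) = h ℤ.+ + 2 ℤ.* k , lemma h k
  where
  lemma : ∀ h k → + 2 ℤ.* h ℤ.+ + 4 ℤ.* k ≡ + 2 ℤ.* (h ℤ.+ + 2 ℤ.* k)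
  lemma = ℤSolver.solve-∀

all-residues₃ : (P : Fin 4 → Fin 4 → Fin 4 → Set) → (∀ i j k → Dec (P i j k)) →
  Dec (∀ i j k → P i j k)
all-residues₃ P P? = Finₚ.all? λ i → Finₚ.all? λ j → Finₚ.all? λ k → P? i j k

Even? : ∀ z → Dec (Even z)
Even? z with 2 ∣ᵇ? z
... | yes h = yes (∣ᵇ⇒Even h)
... | no ¬h = no λ { (h , refl) → ¬h (trans (cong (ℕ._% 2)
  (trans (ℤₚ.abs-* (+ 2) h) (ℕₚ.*-comm 2 ℤ.∣ h ∣))) (ℕ/.m*n%n≡0 ℤ.∣ h ∣ 2)) }

-- An odd x would require n s² ≡ 1 modulo 4, whereas s² is 0 or 1 and n is 2 or 3.
square-residues : ∀ (n x s : Fin 4) → 2 ℕ.≤ toℕ n →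
  4 ∣ᵇ (fin x ℤ.* fin x ℤ.- fin n ℤ.* (fin s ℤ.* fin s)) → 2 ∣ᵇ fin x
square-residues = from-yes (all-residues₃ _ λ n x s → (2 ℕₚ.≤? toℕ n) →-dec
  ((4 ∣ᵇ? (fin x ℤ.* fin x ℤ.- fin n ℤ.* (fin s ℤ.* fin s))) →-dec (2 ∣ᵇ? fin x)))

-- For even x the condition reads m y² ≡ 0 modulo 4, and an odd y has y² ≡ 1.
square-residues′ : ∀ (m x y : Fin 4) → 1 ℕ.≤ toℕ m → 2 ∣ᵇ fin x →
  4 ∣ᵇ (fin x ℤ.* fin x ℤ.- fin m ℤ.* (fin y ℤ.* fin y)) → 2 ∣ᵇ fin y
square-residues′ = from-yes (all-residues₃ _ λ m x y → (1 ℕₚ.≤? toℕ m) →-dec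
  ((2 ∣ᵇ? fin x) →-dec ((4 ∣ᵇ? (fin x ℤ.* fin x ℤ.- fin m ℤ.* (fin y ℤ.* fin y))) →-dec
    (2 ∣ᵇ? fin y))))

-- The residues for which ac and ab are 2 or 3 modulo 4 and bc is odd; then the
-- coordinates of integral elements have denominator at most 2.
Special : (a b c : Fin 4) → Set
Special a b c = toℕ b ℕ.% 2 ≡ 1 × toℕ c ℕ.% 2 ≡ 1 ×
  2 ℕ.≤ (toℕ a ℕ.* toℕ c) ℕ.% 4 × 2 ℕ.≤ (toℕ a ℕ.* toℕ b) ℕ.% 4

Special? : ∀ a b c → Dec (Special a b c)
Special? a b c = (toℕ b ℕ.% 2 ℕₚ.≟ 1) ×-dec (toℕ c ℕ.% 2 ℕₚ.≟ 1) ×-dec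
  (2 ℕₚ.≤? (toℕ a ℕ.* toℕ c) ℕ.% 4) ×-dec (2 ℕₚ.≤? (toℕ a ℕ.* toℕ b) ℕ.% 4)

norm-polynomial : (a b c x y s t u : ℤ) → ℤ
norm-polynomial a b c x y s t u = x ℤ.* x ℤ.+ b ℤ.* c ℤ.* (y ℤ.* y) ℤ.- a ℤ.* c ℤ.* (s ℤ.* s)
  ℤ.- a ℤ.* b ℤ.* (t ℤ.* t) ℤ.- + 2 ℤ.* u

norm-polynomial′ : (a b c x y s t u : ℤ) → ℤ
norm-polynomial′ a b c x y s t u = u ℤ.* u ℤ.- b ℤ.* c
  ℤ.* ((x ℤ.* y ℤ.- a ℤ.* (s ℤ.* t)) ℤ.* (x ℤ.* y ℤ.- a ℤ.* (s ℤ.* t)))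

-- If bc ≡ 1, then b ≡ c and u ≡ xy - ast modulo 2; substituting this turns the first congruence
-- into (x - y)² ≡ ac (s - t)² modulo 4, and ac ≡ 2 or 3 makes both differences even. If bc ≡ 3,
-- then a ≡ 2 and u² + (xy - ast)² ≡ 0 makes u even; the first congruence becomes x² - y² ≡ 2 (s² +
-- t²), so x - y is even, then x² ≡ y² and s² + t² is even.
norm-residues : ∀ (a b c : Fin 4) → Special a b c → ∀ (x y s t u : Fin 4) →
  4 ∣ᵇ norm-polynomial (fin a) (fin b) (fin c) (fin x) (fin y) (fin s) (fin t) (fin u) →
  4 ∣ᵇ norm-polynomial′ (fin a) (fin b) (fin c) (fin x) (fin y) (fin s) (fin t) (fin u) →
  2 ∣ᵇ (fin x ℤ.- fin y) × 2 ∣ᵇ (fin s ℤ.- fin t)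
norm-residues = from-yes (all-residues₃ _ λ a b c → Special? a b c →-dec
  (all-residues₃ _ λ x y s → Finₚ.all? λ t → Finₚ.all? λ u →
    (4 ∣ᵇ? norm-polynomial (fin a) (fin b) (fin c) (fin x) (fin y) (fin s) (fin t) (fin u)) →-dec
    ((4 ∣ᵇ? norm-polynomial′ (fin a) (fin b) (fin c) (fin x) (fin y) (fin s) (fin t) (fin u)) →-dec
    ((2 ∣ᵇ? (fin x ℤ.- fin y)) ×-dec (2 ∣ᵇ? (fin s ℤ.- fin t))))))

double-ι-cancel : ∀ {x h} → double x ≡ ι (+ 2 ℤ.* h) → x ≡ ι h
double-ι-cancel {x} {h} eq = begin
  x                        ≡⟨ solve 1 (λ x → x := con ½ :* (x :+ x)) refl x ⟩
  ½ ℚ.* double x           ≡⟨ cong (½ ℚ.*_) (trans eq (ι-* (+ 2) h)) ⟩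
  ½ ℚ.* (ι (+ 2) ℚ.* ι h)  ≡⟨ solve 1 (λ x → con ½ :* (con (ι (+ 2)) :* x) := x) refl (ι h) ⟩
  ι h                      ∎
  where
  open ≡-Reasoning
  open +-*-Solver

PairwiseSquareFree : ℕ → ℕ → ℕ → Set
PairwiseSquareFree a b c = SquareFree (b ℕ.* c) × SquareFree (a ℕ.* c) × SquareFree (a ℕ.* b)

-- The three congruences say that the traces of v to the three quadratic subfields have integral
-- norms, written in terms of four times the coordinates.
record QuarterCoordinates (a b c : ℕ) (v : Biquadratic a b c) : Set where
  field
    X Y S T : ℤ
    X≡ : double (double (c₁ v)) ≡ ι X
    Y≡ : double (double (cₘ v)) ≡ ι Y
    S≡ : double (double (cₙ v)) ≡ ι S
    T≡ : double (double (cₖ v)) ≡ ι T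
    norm-Y : X ℤ.* X ℤ.- + b ℤ.* + c ℤ.* (Y ℤ.* Y) ≈₄ + 0
    norm-S : X ℤ.* X ℤ.- + a ℤ.* + c ℤ.* (S ℤ.* S) ≈₄ + 0
    norm-T : X ℤ.* X ℤ.- + a ℤ.* + b ℤ.* (T ℤ.* T) ≈₄ + 0

≡⇒≈₄0 : ∀ {x} → ∃[ z ] x ≡ + 4 ℤ.* z → x ≈₄ + 0
≡⇒≈₄0 (z , eq) = mod₄ z (trans eq (sym (ℤₚ.+-identityˡ (+ 4 ℤ.* z))))

-- One argument for √bc is applied to v and to two permutations of it. The three resulting values of
-- 4x agree because `ι` is injective.
quarter-coordinates : ∀ {a b c v} → PairwiseSquareFree a b c →
  OverRing.IsIntegral (rawBiquadratic a b c) v → QuarterCoordinates a b c v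
quarter-coordinates {a} {b} {c} {⟪ x , y , s , t ⟫} (sfₘ , sfₙ , sfₖ) v-int =
  combine (quarter sfₘ v-int) (quarter sfₙ v₁₂-int)
    (quarter (λ d → sfₖ d) v₂₃₁-int)
  where
  v₁₂-int : OverRing.IsIntegral (rawBiquadratic b a c) ⟪ x , s , y , t ⟫
  v₁₂-int = IsHom.integral-hom swap₁₂-isHom (cong swap₁₂) v-int
  v₂₃₁-int : OverRing.IsIntegral (rawBiquadratic c a b) ⟪ x , t , y , s ⟫
  v₂₃₁-int = IsHom.integral-hom swap₁₂-isHom (cong swap₁₂)
    (IsHom.integral-hom swap₂₃-isHom (cong swap₂₃) v-int)
  Quarter : ℚ → ℚ → ℕ → ℕ → Set
  Quarter x y b c = ∃[ X ] ∃[ Y ] (double (double x) ≡ ι X × double (double y) ≡ ι Y ×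
                      ∃[ z ] X ℤ.* X ℤ.- + b ℤ.* + c ℤ.* (Y ℤ.* Y) ≡ + 4 ℤ.* z)
  quarter : ∀ {a b c x y s t} → SquareFree (b ℕ.* c) →
    OverRing.IsIntegral (rawBiquadratic a b c) ⟪ x , y , s , t ⟫ → Quarter x y b c
  quarter {a} {b} {c} {x} {y} {s} {t} sf h =
    quarter-integers {a} {b} {c} {x} {y} sf (proj₁ (trace-facts h)) (proj₂ (trace-facts h))
  combine : Quarter x y b c → Quarter x s a c → Quarter x t a b →
    QuarterCoordinates a b c ⟪ x , y , s , t ⟫
  combine (X , Y , pX , pY , eqY) (X₂ , S , pX₂ , pS , eqS) (X₃ , T , pX₃ , pT , eqT)
    with refl ← ι-injective X X₂ (trans (sym pX) pX₂) | refl ← ι-injective X X₃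
      (trans (sym pX) pX₃) = record
    { X = X ; Y = Y ; S = S ; T = T ; X≡ = pX ; Y≡ = pY ; S≡ = pS ; T≡ = pT
    ; norm-Y = ≡⇒≈₄0 eqY ; norm-S = ≡⇒≈₄0 eqS ; norm-T = ≡⇒≈₄0 eqT }

residue-ℕ : ℕ → Fin 4
residue-ℕ n = residue (+ n)

product-residue : Fin 4 → Fin 4 → Fin 4
product-residue i j = residue (+ (toℕ i ℕ.* toℕ j))

*-residue-≈₄ : ∀ m n → + m ℤ.* + n ≈₄ fin (product-residue (residue-ℕ m) (residue-ℕ n))
*-residue-≈₄ m n = ≈₄-trans (residue-≈₄ (+ m) *₄ residue-≈₄ (+ n))
  (subst (_≈₄ fin (product-residue (residue-ℕ m) (residue-ℕ n)))
    (ℤₚ.pos-* (toℕ (residue-ℕ m)) (toℕ (residue-ℕ n)))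
    (residue-≈₄ (+ (toℕ (residue-ℕ m) ℕ.* toℕ (residue-ℕ n)))))

norm-residue : ∀ m n X Y → X ℤ.* X ℤ.- + m ℤ.* + n ℤ.* (Y ℤ.* Y) ≈₄ + 0 →
  4 ∣ᵇ (fin (residue X) ℤ.* fin (residue X)
    ℤ.- fin (product-residue (residue-ℕ m) (residue-ℕ n)) ℤ.* (fin (residue Y) ℤ.* fin (residue Y)))
norm-residue m n X Y h = ≈₄0⇒∣ᵇ (≈₄-trans (≈₄-sym
  (residue-≈₄ X *₄ residue-≈₄ X -₄ *-residue-≈₄ m n *₄ (residue-≈₄ Y *₄ residue-≈₄ Y))) h)

-- Uniform residues mean that bc, ac and ab are all 1 modulo 4.
SpecialResidues UniformResidues : ℕ → ℕ → ℕ → Set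
SpecialResidues a b c = Special (residue-ℕ a) (residue-ℕ b) (residue-ℕ c)
UniformResidues a b c = residue-ℕ a ≡ residue-ℕ b × residue-ℕ b ≡ residue-ℕ c
  × toℕ (residue-ℕ a) ℕ.% 2 ≡ 1

special-products : ∀ a b c → Special a b c →
  1 ℕ.≤ toℕ (product-residue b c) × 2 ℕ.≤ toℕ (product-residue a c) ×
  2 ℕ.≤ toℕ (product-residue a b)
special-products = from-yes (all-residues₃ _ λ a b c → Special? a b c →-dec
  (1 ℕₚ.≤? toℕ (product-residue b c)) ×-dec (2 ℕₚ.≤? toℕ (product-residue a c)) ×-dec
    (2 ℕₚ.≤? toℕ (product-residue a b)))

-- For odd m the product is 1, so the condition is x² ≡ y² modulo 4.
uniform-square-residues : ∀ (m x y : Fin 4) → toℕ m ℕ.% 2 ≡ 1 →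
  4 ∣ᵇ (fin x ℤ.* fin x ℤ.- fin (product-residue m m) ℤ.* (fin y ℤ.* fin y)) →
    2 ∣ᵇ (fin x ℤ.- fin y)
uniform-square-residues = from-yes (all-residues₃ _ λ m x y → (toℕ m ℕ.% 2 ℕₚ.≟ 1) →-dec
  ((4 ∣ᵇ? (fin x ℤ.* fin x ℤ.- fin (product-residue m m) ℤ.* (fin y ℤ.* fin y))) →-dec
    (2 ∣ᵇ? (fin x ℤ.- fin y))))

Even-residue : ∀ z → 2 ∣ᵇ fin (residue z) → Even z
Even-residue z h = Even-≈₄ (residue-≈₄ z) (∣ᵇ⇒Even h)

Even-difference-residue : ∀ x y → 2 ∣ᵇ (fin (residue x) ℤ.- fin (residue y)) → Even (x ℤ.- y)
Even-difference-residue x y h = Even-≈₄ (residue-≈₄ x -₄ residue-≈₄ y) (∣ᵇ⇒Even h)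

quarter-parity : ∀ {a b c v} → UniformResidues a b c → (q : QuarterCoordinates a b c v) →
  let open QuarterCoordinates q in
  Even (X ℤ.- Y) × Even (X ℤ.- S) × Even (X ℤ.- T)
quarter-parity {a} {b} {c} (a≡b , b≡c , odd) q =
  step b c Y b≡c (trans (cong (λ r → toℕ r ℕ.% 2) (sym a≡b)) odd) norm-Y ,
  step a c S (trans a≡b b≡c) odd norm-S ,
  step a b T a≡b odd norm-T
  where
  open QuarterCoordinates q
  step : ∀ m n Z → residue-ℕ m ≡ residue-ℕ n → toℕ (residue-ℕ m) ℕ.% 2 ≡ 1 →
    X ℤ.* X ℤ.- + m ℤ.* + n ℤ.* (Z ℤ.* Z) ≈₄ + 0 → Even (X ℤ.- Z)
  step m n Z m≡n odd h = Even-difference-residue X Z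
    (uniform-square-residues (residue-ℕ m) (residue X) (residue Z) odd
    (subst (λ r → 4 ∣ᵇ (fin (residue X) ℤ.* fin (residue X)
      ℤ.- fin (product-residue (residue-ℕ m) r) ℤ.* (fin (residue Z) ℤ.* fin (residue Z))))
      (sym m≡n) (norm-residue m n X Z h)))

record HalfCoordinates (a b c : ℕ) (v : Biquadratic a b c) : Set where
  field
    X Y S T : ℤ
    X≡ : double (c₁ v) ≡ ι X
    Y≡ : double (cₘ v) ≡ ι Y
    S≡ : double (cₙ v) ≡ ι S
    T≡ : double (cₖ v) ≡ ι T
    parity-XY : Even (X ℤ.- Y)
    parity-ST : Even (S ℤ.- T)

-- Since ac ≡ 2 or 3, the norm congruence at √ac makes 4x even. None of bc, ac, ab is divisible by
-- 4, so the other three numerators are then even too. The parities of the halved numerators are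
-- beyond the reach of traces and come from the norm of v.
half-coordinates : ∀ {a b c v} → PairwiseSquareFree a b c → SpecialResidues a b c →
  OverRing.IsIntegral (rawBiquadratic a b c) v → HalfCoordinates a b c v
half-coordinates {a} {b} {c} {v@(⟪ x , y , s , t ⟫)} sf special v-int =
  halve (quarter-coordinates sf v-int)
  where
  halve : QuarterCoordinates a b c v → HalfCoordinates a b c v
  halve q = record
    { X = proj₁ X-even ; Y = proj₁ Y-even ; S = proj₁ S-even ; T = proj₁ T-even
    ; X≡ = x≡ ; Y≡ = y≡ ; S≡ = s≡ ; T≡ = t≡
    ; parity-XY = proj₁ parity ; parity-ST = proj₂ parity }
    where
    open QuarterCoordinates q
    products = special-products (residue-ℕ a) (residue-ℕ b) (residue-ℕ c) special
    rX-even : 2 ∣ᵇ fin (residue X)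
    rX-even = square-residues (product-residue (residue-ℕ a) (residue-ℕ c)) (residue X) (residue S)
      (proj₁ (proj₂ products)) (norm-residue a c X S norm-S)
    even′ : ∀ m n Z → 1 ℕ.≤ toℕ (product-residue (residue-ℕ m) (residue-ℕ n)) →
      X ℤ.* X ℤ.- + m ℤ.* + n ℤ.* (Z ℤ.* Z) ≈₄ + 0 → Even Z
    even′ m n Z 1≤mn h = Even-residue Z (square-residues′
      (product-residue (residue-ℕ m) (residue-ℕ n)) (residue X) (residue Z)
      1≤mn rX-even (norm-residue m n X Z h))
    X-even : Even X
    X-even = Even-residue X rX-even
    Y-even : Even Y
    Y-even = even′ b c Y (proj₁ products) norm-Y
    S-even : Even S
    S-even = even′ a c S (ℕₚ.<⇒≤ (proj₁ (proj₂ products))) norm-S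
    T-even : Even T
    T-even = even′ a b T (ℕₚ.<⇒≤ (proj₂ (proj₂ products))) norm-T
    half : ∀ z {Z} → double (double z) ≡ ι Z → ((h , _) : Even Z) → double z ≡ ι h
    half _ eq (h , Z≡) = double-ι-cancel {h = h} (trans eq (cong ι Z≡))
    x≡ = half x X≡ X-even
    y≡ = half y Y≡ Y-even
    s≡ = half s S≡ S-even
    t≡ = half t T≡ T-even
    parities : ∀ X Y S T → double x ≡ ι X → double y ≡ ι Y → double s ≡ ι S → double t ≡ ι T →
      Even (X ℤ.- Y) × Even (S ℤ.- T)
    parities X Y S T x≡ y≡ s≡ t≡
      = conclude (half-norm-integers {a} {b} {c} {x} {y} {s} {t} {X} {Y} {S} {T} x≡ y≡ s≡ t≡
        (proj₁ (norm-facts v-int)) (proj₂ (norm-facts v-int)))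
      where
      ρ = residue-≈₄
      rV = ρ X *₄ ρ Y -₄ ρ (+ a) *₄ (ρ S *₄ ρ T)
      conclude : ∃[ U ] ∃[ w ]
       (X ℤ.* X ℤ.+ + b ℤ.* + c ℤ.* (Y ℤ.* Y) ℤ.- + a ℤ.* + c ℤ.* (S ℤ.* S)
         ℤ.- + a ℤ.* + b ℤ.* (T ℤ.* T) ≡ + 2 ℤ.* U ×
        U ℤ.* U ℤ.- + b ℤ.* + c ℤ.* ((X ℤ.* Y ℤ.- + a ℤ.* (S ℤ.* T))
          ℤ.* (X ℤ.* Y ℤ.- + a ℤ.* (S ℤ.* T))) ≡ + 4 ℤ.* w) →
        Even (X ℤ.- Y) × Even (S ℤ.- T)
      conclude (U , w , eqU , eqw) = Even-difference-residue X Y (proj₁ r) ,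
        Even-difference-residue S T (proj₂ r)
        where
        r = norm-residues (residue-ℕ a) (residue-ℕ b) (residue-ℕ c) special (residue X) (residue Y)
          (residue S) (residue T) (residue U)
          (≈₄0⇒∣ᵇ (≈₄-trans (≈₄-sym
          (ρ X *₄ ρ X +₄ ρ (+ b) *₄ ρ (+ c) *₄ (ρ Y *₄ ρ Y) -₄ ρ (+ a) *₄ ρ (+ c) *₄ (ρ S *₄ ρ S)
            -₄ ρ (+ a) *₄ ρ (+ b) *₄ (ρ T *₄ ρ T)
            -₄ ≈₄-refl {+ 2} *₄ ρ U))
          (mod₄ (+ 0) (ℤₚ.i≡j⇒i-j≡0 eqU))))
          (≈₄0⇒∣ᵇ (≈₄-trans (≈₄-sym (ρ U *₄ ρ U -₄ ρ (+ b) *₄ ρ (+ c) *₄ (rV *₄ rV)))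
          (≡⇒≈₄0 (w , eqw))))
    parity = parities (proj₁ X-even) (proj₁ Y-even) (proj₁ S-even) (proj₁ T-even) x≡ y≡ s≡ t≡

-- Values of the form in coordinates

open OverRing ℤ.+-*-rawRing using () renaming
  (sum to sumℤ; fromℤ to fromℤℤ; evalForm to evalFormℤ; _·_ to _·ℤ_)

module _ {r : ℕ} where
  upper : (Fin r → Fin r → ℤ) → ℤ
  upper f = sumℤ λ i → sumℤ λ j → if does (i Finₚ.≤? j) then f i j else + 0

  polarForm : (Fin r → Fin r → ℤ) → Vector ℤ r → Vector ℤ r → ℤ
  polarForm a x y = upper λ i j → fromℤℤ (a i j) ℤ.* (x i ℤ.* y j ℤ.+ y i ℤ.* x j)

fromℤℤ≡ : ∀ z → fromℤℤ z ≡ z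
fromℤℤ≡ = λ { (+ n) → ·1 n ; -[1+ n ] → cong ℤ.-_ (·1 (suc n)) }
  where
  ·1 : ∀ n → n ·ℤ (+ 1) ≡ + n
  ·1 zero = refl
  ·1 (suc n) = cong (λ z → + 1 ℤ.+ z) (·1 n)

module _ {A : Set} {_+_ : A → A → A} {ε : A} (_~_ : A → (Fin 4 → ℤ) → Set)
  (ε~ : ε ~ λ _ → + 0)
  (+~ : ∀ x y f g → x ~ f → y ~ g → (x + y) ~ λ k → f k ℤ.+ g k) where
  -- A single sum in the field is followed by up to four integral sums at once, one for each product
  -- of coordinates that contributes to the coefficient under study.
  sum-related : ∀ {n} (t : Vector A n) (u : Fin 4 → Vector ℤ n) →
    (∀ i → t i ~ λ k → u k i) → foldr _+_ ε t ~ λ k → sumℤ (u k)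
  sum-related {zero}  t u h = ε~
  sum-related {suc n} t u h = +~ _ _ (λ k → u k zero) (λ k → sumℤ (u k ∘ suc)) (h zero)
    (sum-related (t ∘ suc) (λ k → u k ∘ suc) (h ∘ suc))

pattern #0 = zero
pattern #1 = suc zero
pattern #2 = suc (suc zero)
pattern #3 = suc (suc (suc zero))

-- ℓ is a common denominator of all coordinates: 2 for special residues and 4 for uniform ones.
-- Values of the form, being quadratic, are scaled by ℓ².
module Coordinates (a b c : ℕ) (ℓ : ℚ) where
  open OverRing (rawBiquadratic a b c) using (evalForm)
  open BiquadraticRing a b c using (embed; embed-*; commutativeRing)
  private
    module R = CommutativeRing commutativeRing

  -- The coefficients of 1 and of √ac in a product. The entries of f collect xx′, yy′, ss′, tt′ for
  -- the former; for the latter they collect the mixed terms of x with s and of y with t, where b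
  -- stems from √bc √ab = b√ac.
  combination₁ combinationₙ : (Fin 4 → ℤ) → ℤ
  combination₁ f = f #0 ℤ.+ + b ℤ.* + c ℤ.* f #1 ℤ.+ + a ℤ.* + c ℤ.* f #2 ℤ.+ + a ℤ.* + b ℤ.* f #3
  combinationₙ f = f #0 ℤ.+ + b ℤ.* f #1

  combination₁-+ : ∀ f g → combination₁ (λ k → f k ℤ.+ g k) ≡ combination₁ f ℤ.+ combination₁ g
  combination₁-+ f g = lemma (+ a) (+ b) (+ c) (f #0) (f #1) (f #2) (f #3) (g #0) (g #1) (g #2)
    (g #3)
    where
    lemma : ∀ a b c x y s t x′ y′ s′ t′ →
      (x ℤ.+ x′) ℤ.+ b ℤ.* c ℤ.* (y ℤ.+ y′) ℤ.+ a ℤ.* c ℤ.* (s ℤ.+ s′) ℤ.+ a ℤ.* b ℤ.* (t ℤ.+ t′) ≡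
      (x ℤ.+ b ℤ.* c ℤ.* y ℤ.+ a ℤ.* c ℤ.* s ℤ.+ a ℤ.* b ℤ.* t)
        ℤ.+ (x′ ℤ.+ b ℤ.* c ℤ.* y′ ℤ.+ a ℤ.* c ℤ.* s′ ℤ.+ a ℤ.* b ℤ.* t′)
    lemma = ℤSolver.solve-∀

  combinationₙ-+ : ∀ f g → combinationₙ (λ k → f k ℤ.+ g k) ≡ combinationₙ f ℤ.+ combinationₙ g
  combinationₙ-+ f g = lemma (+ b) (f #0) (f #1) (g #0) (g #1)
    where
    lemma : ∀ b x y x′ y′ → (x ℤ.+ x′) ℤ.+ b ℤ.* (y ℤ.+ y′) ≡ (x ℤ.+ b ℤ.* y) ℤ.+ (x′ ℤ.+ b ℤ.* y′)
    lemma = ℤSolver.solve-∀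

  Matches : (Biquadratic a b c → ℚ) → ((Fin 4 → ℤ) → ℤ) → Biquadratic a b c → (Fin 4 → ℤ) → Set
  Matches π combination u f = ℓ ℚ.* ℓ ℚ.* π u ≡ ι (combination f)

  private
    matches-+ : ∀ x y i j {k} → ℓ ℚ.* ℓ ℚ.* x ≡ ι i → ℓ ℚ.* ℓ ℚ.* y ≡ ι j → k ≡ i ℤ.+ j →
      ℓ ℚ.* ℓ ℚ.* (x ℚ.+ y) ≡ ι k
    matches-+ x y i j p q refl = trans (ℚₚ.*-distribˡ-+ (ℓ ℚ.* ℓ) x y)
      (trans (cong₂ ℚ._+_ p q) (sym (ι-+ i j)))

    combination₁-0 : combination₁ (λ _ → + 0) ≡ + 0
    combination₁-0 = lemma (+ a) (+ b) (+ c)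
      where
      lemma : ∀ a b c → + 0 ℤ.+ b ℤ.* c ℤ.* + 0 ℤ.+ a ℤ.* c ℤ.* + 0 ℤ.+ a ℤ.* b ℤ.* + 0 ≡ + 0
      lemma = ℤSolver.solve-∀

    combinationₙ-0 : combinationₙ (λ _ → + 0) ≡ + 0
    combinationₙ-0 = lemma (+ b)
      where
      lemma : ∀ b → + 0 ℤ.+ b ℤ.* + 0 ≡ + 0
      lemma = ℤSolver.solve-∀

  record Scaled (v : Biquadratic a b c) (X Y S T : ℤ) : Set where
    constructor scaled
    field
      X≡ : ℓ ℚ.* c₁ v ≡ ι X
      Y≡ : ℓ ℚ.* cₘ v ≡ ι Y
      S≡ : ℓ ℚ.* cₙ v ≡ ι S
      T≡ : ℓ ℚ.* cₖ v ≡ ι T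

  private
    fromℤ-* : ∀ z u → OverRing.fromℤ (rawBiquadratic a b c) z R.* u ≡
      ⟪ ι z ℚ.* c₁ u , ι z ℚ.* cₘ u , ι z ℚ.* cₙ u , ι z ℚ.* cₖ u ⟫
    fromℤ-* z u = trans (cong (R._* u) (fromℤ-embed a b c z))
      (embed-* (ι z) (c₁ u) (cₘ u) (cₙ u) (cₖ u))

    A B C : ℚ
    A = ι (+ a)
    B = ι (+ b)
    C = ι (+ c)
    iA = integer (+ a)
    iB = integer (+ b)
    iC = integer (+ c)

    open +-*-Solver

    scale₁ : ∀ ℓ q a b c x y s t x′ y′ s′ t′ →
      q ℚ.* ((ℓ ℚ.* x) ℚ.* (ℓ ℚ.* x′)) ℚ.+ b ℚ.* c ℚ.* (q ℚ.* ((ℓ ℚ.* y) ℚ.* (ℓ ℚ.* y′)))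
        ℚ.+ a ℚ.* c ℚ.* (q ℚ.* ((ℓ ℚ.* s) ℚ.* (ℓ ℚ.* s′)))
          ℚ.+ a ℚ.* b ℚ.* (q ℚ.* ((ℓ ℚ.* t) ℚ.* (ℓ ℚ.* t′))) ≡
      ℓ ℚ.* ℓ ℚ.* (q ℚ.* (x ℚ.* x′ ℚ.+ b ℚ.* c ℚ.* (y ℚ.* y′) ℚ.+ a ℚ.* c ℚ.* (s ℚ.* s′)
        ℚ.+ a ℚ.* b ℚ.* (t ℚ.* t′)))
    scale₁ = solve 13 (λ ℓ q a b c x y s t x′ y′ s′ t′ →
      q :* ((ℓ :* x) :* (ℓ :* x′)) :+ b :* c :* (q :* ((ℓ :* y) :* (ℓ :* y′)))
        :+ a :* c :* (q :* ((ℓ :* s) :* (ℓ :* s′))) :+ a :* b :* (q :* ((ℓ :* t) :* (ℓ :* t′))) :=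
      ℓ :* ℓ :* (q :* (x :* x′ :+ b :* c :* (y :* y′) :+ a :* c :* (s :* s′)
        :+ a :* b :* (t :* t′)))) refl

    scaleₙ : ∀ ℓ q b x y s t x′ y′ s′ t′ →
      q ℚ.* ((ℓ ℚ.* x) ℚ.* (ℓ ℚ.* s′) ℚ.+ (ℓ ℚ.* s) ℚ.* (ℓ ℚ.* x′))
        ℚ.+ b ℚ.* (q ℚ.* ((ℓ ℚ.* y) ℚ.* (ℓ ℚ.* t′) ℚ.+ (ℓ ℚ.* t) ℚ.* (ℓ ℚ.* y′))) ≡
      ℓ ℚ.* ℓ ℚ.* (q ℚ.* (x ℚ.* s′ ℚ.+ s ℚ.* x′ ℚ.+ b ℚ.* (y ℚ.* t′ ℚ.+ t ℚ.* y′)))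
    scaleₙ = solve 11 (λ ℓ q b x y s t x′ y′ s′ t′ →
      q :* ((ℓ :* x) :* (ℓ :* s′) :+ (ℓ :* s) :* (ℓ :* x′))
        :+ b :* (q :* ((ℓ :* y) :* (ℓ :* t′) :+ (ℓ :* t) :* (ℓ :* y′))) :=
      ℓ :* ℓ :* (q :* (x :* s′ :+ s :* x′ :+ b :* (y :* t′ :+ t :* y′)))) refl

    entry₁ : ∀ z u u′ {X Y S T X′ Y′ S′ T′} → Scaled u X Y S T → Scaled u′ X′ Y′ S′ T′ → ∀ {w} →
      w ≡ z →
      ℓ ℚ.* ℓ ℚ.* c₁ (OverRing.fromℤ (rawBiquadratic a b c) z R.* (u R.* u′)) ≡
      ι (w ℤ.* (X ℤ.* X′) ℤ.+ + b ℤ.* + c ℤ.* (w ℤ.* (Y ℤ.* Y′))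
        ℤ.+ + a ℤ.* + c ℤ.* (w ℤ.* (S ℤ.* S′)) ℤ.+ + a ℤ.* + b ℤ.* (w ℤ.* (T ℤ.* T′)))
    entry₁ z u@(⟪ x , y , s , t ⟫) u′@(⟪ x′ , y′ , s′ , t′ ⟫) {X} {Y} {S} {T} {X′} {Y′} {S′} {T′}
      (scaled X≡ Y≡ S≡ T≡) (scaled X′≡ Y′≡ S′≡ T′≡) refl =
      trans (cong (λ w → ℓ ℚ.* ℓ ℚ.* c₁ w) (fromℤ-* z (u R.* u′)))
        (trans (sym (scale₁ ℓ (ι z) A B C x y s t x′ y′ s′ t′))
          (proj₂ (iz ⊗ ((X , X≡) ⊗ (X′ , X′≡)) ⊕ iB ⊗ iC ⊗ (iz ⊗ ((Y , Y≡) ⊗ (Y′ , Y′≡)))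
            ⊕ iA ⊗ iC ⊗ (iz ⊗ ((S , S≡) ⊗ (S′ , S′≡))) ⊕ iA ⊗ iB ⊗ (iz ⊗ ((T , T≡) ⊗ (T′ , T′≡))))))
      where
      iz = integer z

    entryₙ : ∀ z u u′ {X Y S T X′ Y′ S′ T′} → Scaled u X Y S T → Scaled u′ X′ Y′ S′ T′ → ∀ {w} →
      w ≡ z →
      ℓ ℚ.* ℓ ℚ.* cₙ (OverRing.fromℤ (rawBiquadratic a b c) z R.* (u R.* u′)) ≡
      ι (w ℤ.* (X ℤ.* S′ ℤ.+ S ℤ.* X′) ℤ.+ + b ℤ.* (w ℤ.* (Y ℤ.* T′ ℤ.+ T ℤ.* Y′)))
    entryₙ z u@(⟪ x , y , s , t ⟫) u′@(⟪ x′ , y′ , s′ , t′ ⟫) {X} {Y} {S} {T} {X′} {Y′} {S′} {T′}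
      (scaled X≡ Y≡ S≡ T≡) (scaled X′≡ Y′≡ S′≡ T′≡) refl =
      trans (cong (λ w → ℓ ℚ.* ℓ ℚ.* cₙ w) (fromℤ-* z (u R.* u′)))
        (trans (sym (scaleₙ ℓ (ι z) B x y s t x′ y′ s′ t′))
          (proj₂ (iz ⊗ ((X , X≡) ⊗ (S′ , S′≡) ⊕ (S , S≡) ⊗ (X′ , X′≡))
            ⊕ iB ⊗ (iz ⊗ ((Y , Y≡) ⊗ (T′ , T′≡) ⊕ (T , T≡) ⊗ (Y′ , Y′≡))))))
      where
      iz = integer z

  module _ {r : ℕ} (coeff : Fin r → Fin r → ℤ) (v : Vector (Biquadratic a b c) r)
    (X Y S T : Vector ℤ r)
    (v≡ : ∀ i → Scaled (v i) (X i) (Y i) (S i) (T i)) where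

    private
      select : {A : Set} → A → A → A → A → Fin 4 → A
      select x y s t #0 = x
      select x y s t #1 = y
      select x y s t #2 = s
      select x y s t #3 = t

    evalForm-c₁ : ℓ ℚ.* ℓ ℚ.* c₁ (evalForm coeff v) ≡
      ι (evalFormℤ coeff X ℤ.+ + b ℤ.* + c ℤ.* evalFormℤ coeff Y
        ℤ.+ + a ℤ.* + c ℤ.* evalFormℤ coeff S ℤ.+ + a ℤ.* + b ℤ.* evalFormℤ coeff T)
    evalForm-c₁ = sum-related (Matches c₁ combination₁) base step
      (λ i → OverRing.sum (rawBiquadratic a b c) λ j → entryB i j)
      (λ k i → sumℤ λ j → entryℤ k i j)
      λ i → sum-related (Matches c₁ combination₁) base step (entryB i) (λ k j → entryℤ k i j) λ j →
        entry i j (does (i Finₚ.≤? j))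
      where
      base = trans (ℚₚ.*-zeroʳ (ℓ ℚ.* ℓ)) (cong ι (sym combination₁-0))
      step : ∀ x y f g → Matches c₁ combination₁ x f → Matches c₁ combination₁ y g →
        Matches c₁ combination₁ (x R.+ y) λ k → f k ℤ.+ g k
      step x y f g p q = matches-+ (c₁ x) (c₁ y) (combination₁ f) (combination₁ g) p q
        (combination₁-+ f g)
      coord : Fin 4 → Vector ℤ r
      coord = select X Y S T
      entryB : Fin r → Fin r → Biquadratic a b c
      entryB i j = if does (i Finₚ.≤? j) then
        OverRing.fromℤ (rawBiquadratic a b c) (coeff i j) R.* (v i R.* v j) else R.0#
      entryℤ : Fin 4 → Fin r → Fin r → ℤ
      entryℤ k i j = if does (i Finₚ.≤? j) then fromℤℤ (coeff i j) ℤ.* (coord k i ℤ.* coord k j)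
        else + 0
      entry : ∀ i j e → Matches c₁ combination₁
        (if e then OverRing.fromℤ (rawBiquadratic a b c) (coeff i j) R.* (v i R.* v j) else R.0#)
        (λ k → if e then fromℤℤ (coeff i j) ℤ.* (coord k i ℤ.* coord k j) else + 0)
      entry i j false = base
      entry i j true  = entry₁ (coeff i j) (v i) (v j) (v≡ i) (v≡ j) (fromℤℤ≡ (coeff i j))

    evalForm-cₙ : ℓ ℚ.* ℓ ℚ.* cₙ (evalForm coeff v) ≡
      ι (polarForm coeff X S ℤ.+ + b ℤ.* polarForm coeff Y T)
    evalForm-cₙ = sum-related (Matches cₙ combinationₙ) base step
      (λ i → OverRing.sum (rawBiquadratic a b c) λ j → entryB i j)
      (λ k i → sumℤ λ j → entryℤ k i j)
      λ i → sum-related (Matches cₙ combinationₙ) base step (entryB i) (λ k j → entryℤ k i j) λ j →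
        entry i j (does (i Finₚ.≤? j))
      where
      base = trans (ℚₚ.*-zeroʳ (ℓ ℚ.* ℓ)) (cong ι (sym combinationₙ-0))
      step : ∀ x y f g → Matches cₙ combinationₙ x f → Matches cₙ combinationₙ y g →
        Matches cₙ combinationₙ (x R.+ y) λ k → f k ℤ.+ g k
      step x y f g p q = matches-+ (cₙ x) (cₙ y) (combinationₙ f) (combinationₙ g) p q
        (combinationₙ-+ f g)
      coord coord′ : Fin 4 → Vector ℤ r
      -- The pairs X, S and Y, T occupy the slots 0 and 1 that `combinationₙ` reads and are repeated
      -- to fill all four.
      coord  = select X Y X Y
      coord′ = select S T S T
      entryB : Fin r → Fin r → Biquadratic a b c
      entryB i j = if does (i Finₚ.≤? j) then
        OverRing.fromℤ (rawBiquadratic a b c) (coeff i j) R.* (v i R.* v j) else R.0#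
      entryℤ : Fin 4 → Fin r → Fin r → ℤ
      entryℤ k i j = if does (i Finₚ.≤? j) then
        fromℤℤ (coeff i j) ℤ.* (coord k i ℤ.* coord′ k j ℤ.+ coord′ k i ℤ.* coord k j) else + 0
      entry : ∀ i j e → Matches cₙ combinationₙ
        (if e then OverRing.fromℤ (rawBiquadratic a b c) (coeff i j) R.* (v i R.* v j) else R.0#)
        (λ k → if e then fromℤℤ (coeff i j) ℤ.* (coord k i ℤ.* coord′ k j
          ℤ.+ coord′ k i ℤ.* coord k j) else + 0)
      entry i j false = base
      entry i j true  = entryₙ (coeff i j) (v i) (v j) (v≡ i) (v≡ j) (fromℤℤ≡ (coeff i j))

module _ {r : ℕ} (coeff : Fin r → Fin r → ℤ) where
  upper-cong : ∀ {f g : Fin r → Fin r → ℤ} → (∀ i j → f i j ≡ g i j) → upper f ≡ upper g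
  upper-cong f≡g = foldr-related _≡_ refl (cong₂ ℤ._+_) _ _ λ i →
    foldr-related _≡_ refl (cong₂ ℤ._+_) _ _ λ j →
    cong (λ x → if does (i Finₚ.≤? j) then x else + 0) (f≡g i j)

  upper-0 : ∀ {f : Fin r → Fin r → ℤ} → (∀ i j → f i j ≡ + 0) → upper f ≡ + 0
  upper-0 {f} f≡0 = zeros _ λ i → zeros _ λ j → entry i j (does (i Finₚ.≤? j))
    where
    zeros : ∀ {n} (t : Vector ℤ n) → (∀ i → t i ≡ + 0) → sumℤ t ≡ + 0
    zeros t h = foldr-related (λ x _ → x ≡ + 0) {_+′_ = ℤ._+_} {z′ = + 0} refl (cong₂ ℤ._+_) t t h
    entry : ∀ i j e → (if e then f i j else + 0) ≡ + 0
    entry i j false = refl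
    entry i j true  = f≡0 i j

  evalForm-cong : ∀ {x y} → (∀ i → x i ≡ y i) → evalFormℤ coeff x ≡ evalFormℤ coeff y
  evalForm-cong x≡y = upper-cong λ i j → cong₂ (λ u w →
    fromℤℤ (coeff i j) ℤ.* (u ℤ.* w)) (x≡y i) (x≡y j)

  evalForm-0 : ∀ {x} → (∀ i → x i ≡ + 0) → evalFormℤ coeff x ≡ + 0
  evalForm-0 {x} x≡0 = upper-0 λ i j →
    trans (cong (λ y → fromℤℤ (coeff i j) ℤ.* (y ℤ.* x j)) (x≡0 i))
      (ℤₚ.*-zeroʳ (fromℤℤ (coeff i j)))

  polarForm-0ˡ : ∀ {x} y → (∀ i → x i ≡ + 0) → polarForm coeff x y ≡ + 0
  polarForm-0ˡ {x} y x≡0 = upper-0 λ i j →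
    trans (cong₂ (λ u w → fromℤℤ (coeff i j) ℤ.* (u ℤ.* y j ℤ.+ y i ℤ.* w)) (x≡0 i) (x≡0 j))
      (lemma (fromℤℤ (coeff i j)) (y i) (y j))
    where
    lemma : ∀ c y z → c ℤ.* (+ 0 ℤ.* z ℤ.+ y ℤ.* + 0) ≡ + 0
    lemma = ℤSolver.solve-∀

  polarForm-0ʳ : ∀ x {y} → (∀ i → y i ≡ + 0) → polarForm coeff x y ≡ + 0
  polarForm-0ʳ x {y} y≡0 = upper-0 λ i j →
    trans (cong₂ (λ u w → fromℤℤ (coeff i j) ℤ.* (x i ℤ.* w ℤ.+ u ℤ.* x j)) (y≡0 i) (y≡0 j))
      (lemma (fromℤℤ (coeff i j)) (x i) (x j))
    where
    lemma : ∀ c y z → c ℤ.* (y ℤ.* + 0 ℤ.+ + 0 ℤ.* z) ≡ + 0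
    lemma = ℤSolver.solve-∀

  evalForm-2* : ∀ x → evalFormℤ coeff (λ i → + 2 ℤ.* x i) ≡ + 4 ℤ.* evalFormℤ coeff x
  evalForm-2* x = foldr-related (λ y z → y ≡ + 4 ℤ.* z) refl +~ _ _ λ i →
    foldr-related (λ y z → y ≡ + 4 ℤ.* z) refl +~ _ _ λ j →
    entry i j (does (i Finₚ.≤? j))
    where
    +~ : ∀ {x x′ y y′} → x ≡ + 4 ℤ.* x′ → y ≡ + 4 ℤ.* y′ → x ℤ.+ y ≡ + 4 ℤ.* (x′ ℤ.+ y′)
    +~ {x′ = x′} {y′ = y′} p q = trans (cong₂ ℤ._+_ p q) (sym (ℤₚ.*-distribˡ-+ (+ 4) x′ y′))
    lemma : ∀ c y z → c ℤ.* (+ 2 ℤ.* y ℤ.* (+ 2 ℤ.* z)) ≡ + 4 ℤ.* (c ℤ.* (y ℤ.* z))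
    lemma = ℤSolver.solve-∀
    entry : ∀ i j e → (if e then fromℤℤ (coeff i j) ℤ.* (+ 2 ℤ.* x i ℤ.* (+ 2 ℤ.* x j)) else + 0) ≡
                      + 4 ℤ.* (if e then fromℤℤ (coeff i j) ℤ.* (x i ℤ.* x j) else + 0)
    entry i j false = refl
    entry i j true  = lemma (fromℤℤ (coeff i j)) (x i) (x j)

-- Lower bounds from positive definiteness and parity

weight : (a b c x y s t : ℕ) → ℕ
weight a b c x y s t = x ℕ.+ b ℕ.* c ℕ.* y ℕ.+ a ℕ.* c ℕ.* s ℕ.+ a ℕ.* b ℕ.* t

-- The last four arguments will be lower bounds 0, 1 or 4 for the form on the vectors X, Y, S, T; by
-- monotonicity their weight is at most the scaled rational coefficient of α.
weight-mono : ∀ a b c {x x′ y y′ s s′ t t′} → x ℕ.≤ x′ → y ℕ.≤ y′ → s ℕ.≤ s′ → t ℕ.≤ t′ →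
  weight a b c x y s t ℕ.≤ weight a b c x′ y′ s′ t′
weight-mono a b c p q r s = ℕₚ.+-mono-≤ (ℕₚ.+-mono-≤ (ℕₚ.+-mono-≤ p
  (ℕₚ.*-monoʳ-≤ (b ℕ.* c) q)) (ℕₚ.*-monoʳ-≤ (a ℕ.* c) r)) (ℕₚ.*-monoʳ-≤ (a ℕ.* b) s)

Even-minus : ∀ {x y} → Even (x ℤ.- y) → Even x → Even y
Even-minus {x} {y} (h , eq) (k , refl) = k ℤ.- h , trans (lemma (+ 2 ℤ.* k) y)
  (trans (cong (λ z → + 2 ℤ.* k ℤ.- z) eq) (lemma′ k h))
  where
  lemma : ∀ x y → y ≡ x ℤ.- (x ℤ.- y)
  lemma = ℤSolver.solve-∀
  lemma′ : ∀ k h → + 2 ℤ.* k ℤ.- + 2 ℤ.* h ≡ + 2 ℤ.* (k ℤ.- h)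
  lemma′ = ℤSolver.solve-∀

Even-plus : ∀ {x y} → Even (x ℤ.- y) → Even y → Even x
Even-plus {x} {y} (h , eq) (k , refl) = h ℤ.+ k , trans (lemma x (+ 2 ℤ.* k))
  (trans (cong (λ z → z ℤ.+ + 2 ℤ.* k) eq) (sym (ℤₚ.*-distribˡ-+ (+ 2) h k)))
  where
  lemma : ∀ x y → x ≡ (x ℤ.- y) ℤ.+ y
  lemma = ℤSolver.solve-∀

Even-0 : ∀ {x} → x ≡ + 0 → Even x
Even-0 x≡0 = + 0 , x≡0

module _ (Q : ℤForm) where
  open ℤForm Q
  private
    N : Vector ℤ rank → ℤ
    N = OverRing.evalForm ℤ.+-*-rawRing coeff

  IsZero AllEven : Vector ℤ rank → Set
  IsZero X = ∀ i → X i ≡ + 0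
  AllEven X = ∀ i → Even (X i)

  isZero? : ∀ X → Dec (IsZero X)
  isZero? X = Finₚ.all? λ i → X i ℤₚ.≟ + 0

  -- A nonzero integral vector has value at least 1, and an even one X = 2H has value 4 Q(H), where
  -- H is again nonzero.
  record Value (X : Vector ℤ rank) : Set where
    field
      value     : ℕ
      value≡    : N X ≡ + value
      ≥1        : ¬ IsZero X → 1 ℕ.≤ value
      ≥4        : ¬ IsZero X → AllEven X → 4 ℕ.≤ value

  form-value : ∀ X → Value X
  form-value X with isZero? X
  ... | yes X≡0 = record { value = 0 ; value≡ = evalForm-0 coeff X≡0 ; ≥1 = λ X≢0 →
    ⊥-elim (X≢0 X≡0) ; ≥4 = λ X≢0 _ → ⊥-elim (X≢0 X≡0) }
  ... | no X≢0 with N X in eq | positiveDefinite X X≢0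
  ...   | + n | ℤ.+<+ 1≤n = record { value = n ; value≡ = eq ; ≥1 = λ _ → 1≤n ; ≥4 = λ _ → bound }
    where
    bound : AllEven X → 4 ℕ.≤ n
    bound even = multiple (N H) refl (positiveDefinite H H≢0)
      where
      H : Vector ℤ rank
      H i = proj₁ (even i)
      H≢0 : ¬ IsZero H
      H≢0 H≡0 = X≢0 λ i → trans (proj₂ (even i)) (cong (λ z → + 2 ℤ.* z) (H≡0 i))
      multiple : ∀ z → N H ≡ z → + 0 ℤ.< z → 4 ℕ.≤ n
      multiple (+ (suc m)) NH≡ _ = subst (4 ℕ.≤_)
        (ℤₚ.+-injective (trans (ℤₚ.pos-* 4 (suc m)) (trans (sym
        (trans (evalForm-cong coeff λ i → proj₂ (even i))
          (trans (evalForm-2* coeff H) (cong (λ z → + 4 ℤ.* z) NH≡)))) eq))) (ℕₚ.m≤m*n 4 (suc m))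
      multiple (+ 0) _ (ℤ.+<+ ())

  module _ (a b c M : ℕ) (X Y S T : Vector ℤ rank)
    (N≡ : N X ℤ.+ + b ℤ.* + c ℤ.* N Y ℤ.+ + a ℤ.* + c ℤ.* N S ℤ.+ + a ℤ.* + b ℤ.* N T ≡ + M)
    (polar≢0 : ¬ (polarForm coeff X S ℤ.+ + b ℤ.* polarForm coeff Y T ≡ + 0)) where
    private
      module X = Value (form-value X)
      module Y = Value (form-value Y)
      module S = Value (form-value S)
      module T = Value (form-value T)

      weight≡ : weight a b c X.value Y.value S.value T.value ≡ M
      weight≡ = ℤₚ.+-injective (trans (pos-weight X.value Y.value S.value T.value)
        (trans (sym (cong₂ ℤ._+_ (cong₂ ℤ._+_ (cong₂ ℤ._+_
        X.value≡ (cong (λ z → + b ℤ.* + c ℤ.* z) Y.value≡))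
          (cong (λ z → + a ℤ.* + c ℤ.* z) S.value≡)) (cong (λ z → + a ℤ.* + b ℤ.* z) T.value≡)))
          N≡))
        where
        pos-product : ∀ a b x → + (a ℕ.* b ℕ.* x) ≡ + a ℤ.* + b ℤ.* + x
        pos-product a b x = trans (ℤₚ.pos-* (a ℕ.* b) x) (cong (ℤ._* + x) (ℤₚ.pos-* a b))
        pos-weight : ∀ x y s t → + weight a b c x y s t ≡ + x ℤ.+ + b ℤ.* + c ℤ.* + y
          ℤ.+ + a ℤ.* + c ℤ.* + s ℤ.+ + a ℤ.* + b ℤ.* + t
        pos-weight x y s t = cong₂ ℤ._+_ (cong₂ ℤ._+_ (cong (λ z → + x ℤ.+ z) (pos-product b c y))
          (pos-product a c s)) (pos-product a b t)

      bound : ∀ {x y s t} → x ℕ.≤ X.value → y ℕ.≤ Y.value → s ℕ.≤ S.value → t ℕ.≤ T.value →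
        weight a b c x y s t ℕ.≤ M
      bound p q r s = ℕₚ.≤-trans (weight-mono a b c p q r s) (ℕₚ.≤-reflexive weight≡)

      no-cross-terms : IsZero X ⊎ IsZero S → IsZero Y ⊎ IsZero T → ⊥
      no-cross-terms XS YT = polar≢0 (cong₂ (λ u w →
        u ℤ.+ + b ℤ.* w) (vanish X S XS) (vanish Y T YT) ▸ ℤₚ.*-zeroʳ (+ b))
        where
        vanish : ∀ X Y → IsZero X ⊎ IsZero Y → polarForm coeff X Y ≡ + 0
        vanish X Y (inj₁ h) = polarForm-0ˡ coeff Y h
        vanish X Y (inj₂ h) = polarForm-0ʳ coeff X h
        _▸_ : ∀ {x y} → x ≡ + 0 ℤ.+ y → y ≡ + 0 → x ≡ + 0
        p ▸ q = trans p (trans (ℤₚ.+-identityˡ _) q)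

      -- If Y or T vanishes, so does their polar form, and then X and S must both be nonzero. The
      -- last component records which of Y and T vanished, because parity then makes X or S even.
      cross-terms : (¬ IsZero Y × ¬ IsZero T)
        ⊎ (¬ IsZero X × ¬ IsZero S × (IsZero Y ⊎ (IsZero T × ¬ IsZero Y)))
      cross-terms with isZero? Y | isZero? T
      ... | no Y≢0 | no T≢0 = inj₁ (Y≢0 , T≢0)
      ... | yes Y≡0 | _ = inj₂ ((λ X≡0 → no-cross-terms (inj₁ X≡0) (inj₁ Y≡0)) ,
        (λ S≡0 → no-cross-terms (inj₂ S≡0) (inj₁ Y≡0)) , inj₁ Y≡0)
      ... | no Y≢0 | yes T≡0 = inj₂ ((λ X≡0 → no-cross-terms (inj₁ X≡0) (inj₂ T≡0)) ,
        (λ S≡0 → no-cross-terms (inj₂ S≡0) (inj₂ T≡0)) , inj₂ (T≡0 , Y≢0))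

    -- If T = 0 then S is even, and if Y = 0 then X is even.
    half-contradiction : (∀ i → Even (X i ℤ.- Y i)) → (∀ i → Even (S i ℤ.- T i)) →
      ¬ weight a b c 0 1 0 1 ℕ.≤ M → ¬ weight a b c 1 0 4 0 ℕ.≤ M → ¬ weight a b c 4 0 1 1 ℕ.≤ M → ⊥
    half-contradiction XY ST ¬YT ¬XS ¬XST with isZero? T | cross-terms
    ... | _ | inj₁ (Y≢0 , T≢0) = ¬YT (bound z≤n (Y.≥1 Y≢0) z≤n (T.≥1 T≢0))
    ... | yes T≡0 | inj₂ (X≢0 , S≢0 , _) = ¬XS
      (bound (X.≥1 X≢0) z≤n (S.≥4 S≢0 λ i → Even-plus (ST i) (Even-0 (T≡0 i))) z≤n)
    ... | no T≢0 | inj₂ (X≢0 , S≢0 , inj₁ Y≡0) =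
      ¬XST (bound (X.≥4 X≢0 λ i → Even-plus (XY i) (Even-0 (Y≡0 i))) z≤n (S.≥1 S≢0) (T.≥1 T≢0))
    ... | no T≢0 | inj₂ (_ , _ , inj₂ (T≡0 , _)) = T≢0 T≡0

    -- One odd entry makes the entries of all four vectors in its position odd.
    quarter-contradiction : (∀ i → Even (X i ℤ.- Y i) × Even (X i ℤ.- S i) × Even (X i ℤ.- T i)) →
      ¬ weight a b c 1 1 1 1 ℕ.≤ M → ¬ weight a b c 4 0 4 0 ℕ.≤ M → ¬ weight a b c 0 4 0 4 ℕ.≤ M → ⊥
    quarter-contradiction parity ¬odd ¬XS ¬YT with Finₚ.all? (λ i → Even? (X i))
    ... | yes X-even with cross-terms
    ...   | inj₁ (Y≢0 , T≢0) = ¬YT (bound z≤n (Y.≥4 Y≢0 λ i →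
      Even-minus (proj₁ (parity i)) (X-even i))
              z≤n (T.≥4 T≢0 λ i → Even-minus (proj₂ (proj₂ (parity i))) (X-even i)))
    ...   | inj₂ (X≢0 , S≢0 , _) = ¬XS (bound (X.≥4 X≢0 X-even)
              z≤n (S.≥4 S≢0 λ i → Even-minus (proj₁ (proj₂ (parity i))) (X-even i)) z≤n)
    quarter-contradiction parity ¬odd ¬XS ¬YT | no ¬X-even =
      ¬X-even λ i → even i (Even? (X i))
      where
      even : ∀ i → Dec (Even (X i)) → Even (X i)
      even i (yes h) = h
      even i (no ¬h) = ⊥-elim (¬odd (bound
        (X.≥1 λ X≡0 → ¬h (Even-0 (X≡0 i)))
        (Y.≥1 λ Y≡0 → ¬h (Even-plus (proj₁ (parity i)) (Even-0 (Y≡0 i))))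
        (S.≥1 λ S≡0 → ¬h (Even-plus (proj₁ (proj₂ (parity i))) (Even-0 (S≡0 i))))
        (T.≥1 λ T≡0 → ¬h (Even-plus (proj₂ (proj₂ (parity i))) (Even-0 (T≡0 i))))))

-- Choice of α and numerical bounds

module NaturalNumberBounds where
  open import Data.Nat.Base
  open import Data.Nat.Properties

  interval : (f : ℕ → ℕ) → f 0 ≡ 0 → (∀ i → f i < f (suc i)) → ∀ n →
    ∃[ i ] (f i ≤ n × n < f (suc i))
  interval f f0 mono zero = 0 , ≤-reflexive f0 , subst (_< f 1) f0 (mono 0)
  interval f f0 mono (suc n) with i , fi≤n , n<fi ← interval f f0 mono n with f (suc i) ≤? suc n
  ... | yes h = suc i , h , ≤-<-trans n<fi (mono (suc i))
  ... | no h  = i , m≤n⇒m≤1+n fi≤n , ≰⇒> h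

  square<square : ∀ i → i * i < suc i * suc i
  square<square i = s≤s (≤-trans (*-monoʳ-≤ i (n≤1+n i)) (m≤n+m (i * suc i) i))

  squareFree⇒≢square : ∀ {n} → 1 < n → SquareFree n → ∀ t → ¬ t * t ≡ n
  squareFree⇒≢square 1<n sf t refl with sf t (divides 1 (sym (+-identityʳ (t * t))))
  ... | refl = <-irrefl refl 1<n

  -- A squarefree n > 1 is not a square, so both inequalities are strict: t = `suc i` is the
  -- integral part of √n and r = `suc (suc i)` the next integer.
  isqrt : ∀ n → 1 < n → SquareFree n → ∃[ i ] (suc i * suc i < n × n < suc (suc i) * suc (suc i))
  isqrt n 1<n sf with interval (λ i → i * i) refl square<square n
  ... | zero , _ , n<1 = ⊥-elim (<-asym 1<n n<1)
  ... | suc i , i²≤n , n< = i , ≤∧≢⇒< i²≤n (squareFree⇒≢square 1<n sf (suc i)) , n<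

  pronic<pronic : ∀ i → i * suc i < suc i * suc (suc i)
  pronic<pronic i = subst (_< suc i * suc (suc i)) (*-comm (suc i) i)
    (*-monoʳ-< (suc i) (m<n⇒m<1+n (n<1+n i)))

  -- Here 4i(i+1) < 4n < 4(i+1)(i+2) says that 1 + 4n lies between consecutive
  -- odd squares.
  pronic-interval : ∀ n → 1 < 1 + 4 * n → ¬ 1 + 4 * n ≡ 5 → SquareFree (1 + 4 * n) →
    ∃[ i ] (suc i * suc (suc i) < n × n < suc (suc i) * suc (suc (suc i)))
  pronic-interval n 1<n n≢5 sf with interval (λ i → i * suc i) refl pronic<pronic n
  ... | zero , _ , s≤s z≤n = ⊥-elim (<-irrefl refl 1<n)
  ... | zero , _ , s≤s (s≤s z≤n) = ⊥-elim (n≢5 refl)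
  ... | suc i , ≤n , n< = i , ≤∧≢⇒< ≤n ≢n , n<
    where
    square : ∀ i → (3 + 2 * i) * (3 + 2 * i) ≡ 1 + 4 * (suc i * suc (suc i))
    square = ℕSolver.solve-∀
    ≢n : ¬ suc i * suc (suc i) ≡ n
    ≢n refl = squareFree⇒≢square 1<n sf (3 + 2 * i) (square i)

  -- The difference of the two sides is (a - c)²; the order of a and c is split to keep the
  -- subtraction in ℕ.
  4ac≤[a+c]² : ∀ a c → 4 * (a * c) ≤ (a + c) * (a + c)
  4ac≤[a+c]² a c with ≤-total a c
  ... | inj₁ a≤c = subst (λ c → 4 * (a * c) ≤ (a + c) * (a + c)) (m+[n∸m]≡n a≤c) (lemma a (c ∸ a))
    where
    expand : ∀ a d → 4 * (a * (a + d)) + d * d ≡ (a + (a + d)) * (a + (a + d))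
    expand = ℕSolver.solve-∀
    lemma : ∀ a d → 4 * (a * (a + d)) ≤ (a + (a + d)) * (a + (a + d))
    lemma a d = subst (4 * (a * (a + d)) ≤_) (expand a d) (m≤m+n _ (d * d))
  ... | inj₂ c≤a = subst (λ a → 4 * (a * c) ≤ (a + c) * (a + c)) (m+[n∸m]≡n c≤a) (lemma c (a ∸ c))
    where
    expand : ∀ c d → 4 * ((c + d) * c) + d * d ≡ (c + d + c) * (c + d + c)
    expand = ℕSolver.solve-∀
    lemma : ∀ c d → 4 * ((c + d) * c) ≤ (c + d + c) * (c + d + c)
    lemma c d = subst (4 * ((c + d) * c) ≤_) (expand c d) (m≤m+n _ (d * d))

  2t<a+c : ∀ a c t → t * t < a * c → 2 * t < a + c
  2t<a+c a c t t²<ac = ≰⇒> λ a+c≤2t → <⇒≱ (*-monoʳ-< 4 t²<ac)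
    (≤-trans (4ac≤[a+c]² a c) (≤-trans (*-mono-≤ a+c≤2t a+c≤2t) (≤-reflexive (square t))))
    where
    square : ∀ t → 2 * t * (2 * t) ≡ 4 * (t * t)
    square = ℕSolver.solve-∀

  -- By the inequality of arithmetic and geometric means, t < √(ac) forces a + c ≥ 2t + 1, and bc +
  -- ab = b(a + c). This makes the contribution of Y and T comparable with r, which is linear in t.
  n*[1+2t]≤bc+ab : ∀ n a b c t → t * t < a * c → n ≤ b → n * (1 + 2 * t) ≤ b * c + a * b
  n*[1+2t]≤bc+ab n a b c t t²<ac n≤b = ≤-trans (*-mono-≤ n≤b (2t<a+c a c t t²<ac))
    (≤-reflexive (distrib a b c))
    where
    distrib : ∀ a b c → b * (a + c) ≡ b * c + a * b
    distrib = ℕSolver.solve-∀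

  -- Here t = i + 1 and r = t + 1 is the rational coefficient of α = r + √ac. Doubled coordinates
  -- multiply the form by 4, hence M = 4r.
  module HalfBounds (a b c i : ℕ) (t²<ac : suc i * suc i < a * c) (c<b : c < b) (3≤b : 3 ≤ b) where
    private
      M = 4 * suc (suc i)

    -- The comparison is 3 (2t + 1) > 4 (t + 1). A factor 2 in place of 3 would give only 4t + 2,
    -- which is why 3 ≤ b is required.
    ¬0101 : ¬ weight a b c 0 1 0 1 ≤ M
    ¬0101 h = <⇒≱ {M} {3 * (1 + 2 * suc i)} (subst (M <_) (eq i) (m≤m+n (suc M) (2 * i)))
      (≤-trans (n*[1+2t]≤bc+ab 3 a b c (suc i) t²<ac 3≤b) (≤-trans (≤-reflexive (wt a b c)) h))
      where
      eq : ∀ i → suc (4 * suc (suc i)) + 2 * i ≡ 3 * (1 + 2 * suc i)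
      eq = ℕSolver.solve-∀
      wt : ∀ a b c → b * c + a * b ≡ 0 + b * c * 1 + a * c * 0 + a * b * 1
      wt = ℕSolver.solve-∀

    ¬1040 : ¬ weight a b c 1 0 4 0 ≤ M
    ¬1040 h = <⇒≱ {M} {1 + 4 * suc (suc i * suc i)}
      (subst (M <_) (eq i) (m≤m+n (suc M) (4 * (i * i) + 4 * i)))
      (≤-trans (+-monoʳ-≤ 1 (*-monoʳ-≤ 4 t²<ac)) (≤-trans (≤-reflexive (wt a b c)) h))
      where
      eq : ∀ i → suc (4 * suc (suc i)) + (4 * (i * i) + 4 * i) ≡ 1 + 4 * suc (suc i * suc i)
      eq = ℕSolver.solve-∀
      wt : ∀ a b c → 1 + 4 * (a * c) ≡ 1 + b * c * 0 + a * c * 4 + a * b * 0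
      wt = ℕSolver.solve-∀

    -- Besides ac ≥ t² + 1, the ordering c < b gives ab ≥ t² + 2. The resulting bound exceeds M by
    -- only 1 when t = 1, so the strictness of ac < ab matters.
    ¬4011 : ¬ weight a b c 4 0 1 1 ≤ M
    ¬4011 h = <⇒≱ {M} {4 + (suc (suc i * suc i) + suc (suc (suc i * suc i)))}
      (subst (M <_) (eq i) (m≤m+n (suc M) (2 * (i * i))))
      (≤-trans (+-monoʳ-≤ 4 (+-mono-≤ t²<ac (≤-trans (s≤s t²<ac) ac<ab)))
        (≤-trans (≤-reflexive (wt a b c)) h))
      where
      a≢0 : NonZero a
      a≢0 = ≢-nonZero λ { refl → n≮0 t²<ac }
      ac<ab : a * c < a * b
      ac<ab = *-monoʳ-< a {{a≢0}} c<b
      eq : ∀ i → suc (4 * suc (suc i)) + 2 * (i * i) ≡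
        4 + (suc (suc i * suc i) + suc (suc (suc i * suc i)))
      eq = ℕSolver.solve-∀
      wt : ∀ a b c → 4 + (a * c + a * b) ≡ 4 + b * c * 0 + a * c * 1 + a * b * 1
      wt = ℕSolver.solve-∀

  -- Here t = 3 + 2i and r = t + 2 are the consecutive odd integers around √ac. The rational
  -- coefficient of α is r/2 and the coordinates are multiplied by 4, hence M = 16 (r/2) = 8r.
  module QuarterBounds (a b c i : ℕ) (t²<ac : (3 + 2 * i) * (3 + 2 * i) < a * c) (5≤b : 5 ≤ b) where
    private
      M = 8 * (5 + 2 * i)
      j = 3 + 2 * i

    ¬1111 : ¬ weight a b c 1 1 1 1 ≤ M
    ¬1111 h = <⇒≱ {M} {1 + (suc (j * j) + 5 * (1 + 2 * j))}
      (subst (M <_) (eq i) (m≤m+n (suc M) (5 + (16 * i + 4 * (i * i)))))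
      (≤-trans (+-monoʳ-≤ 1 (+-mono-≤ t²<ac (n*[1+2t]≤bc+ab 5 a b c j t²<ac 5≤b)))
        (≤-trans (≤-reflexive (wt a b c)) h))
      where
      eq : ∀ i → suc (8 * (5 + 2 * i)) + (5 + (16 * i + 4 * (i * i))) ≡
                 1 + (suc ((3 + 2 * i) * (3 + 2 * i)) + 5 * (1 + 2 * (3 + 2 * i)))
      eq = ℕSolver.solve-∀
      wt : ∀ a b c → 1 + (a * c + (b * c + a * b)) ≡ 1 + b * c * 1 + a * c * 1 + a * b * 1
      wt = ℕSolver.solve-∀

    -- The inequality amounts to t² - 2t - 2 > 0, true from t = 3 on. For ac = 5 one would have t =
    -- 1 and r = 3, and both sides would be 24.
    ¬4040 : ¬ weight a b c 4 0 4 0 ≤ M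
    ¬4040 h = <⇒≱ {M} {4 + 4 * suc (j * j)}
      (subst (M <_) (eq i) (m≤m+n (suc M) (3 + (32 * i + 16 * (i * i)))))
      (≤-trans (+-monoʳ-≤ 4 (*-monoʳ-≤ 4 t²<ac)) (≤-trans (≤-reflexive (wt a b c)) h))
      where
      eq : ∀ i → suc (8 * (5 + 2 * i)) + (3 + (32 * i + 16 * (i * i))) ≡
        4 + 4 * suc ((3 + 2 * i) * (3 + 2 * i))
      eq = ℕSolver.solve-∀
      wt : ∀ a b c → 4 + 4 * (a * c) ≡ 4 + b * c * 0 + a * c * 4 + a * b * 0
      wt = ℕSolver.solve-∀

    ¬0404 : ¬ weight a b c 0 4 0 4 ≤ M
    ¬0404 h = <⇒≱ {M} {4 * (5 * (1 + 2 * j))}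
      (subst (M <_) (eq i) (m≤m+n (suc M) (99 + 64 * i)))
      (≤-trans (*-monoʳ-≤ 4 (n*[1+2t]≤bc+ab 5 a b c j t²<ac 5≤b))
        (≤-trans (≤-reflexive (wt a b c)) h))
      where
      eq : ∀ i → suc (8 * (5 + 2 * i)) + (99 + 64 * i) ≡ 4 * (5 * (1 + 2 * (3 + 2 * i)))
      eq = ℕSolver.solve-∀
      wt : ∀ a b c → 4 * (b * c + a * b) ≡ 0 + b * c * 4 + a * c * 0 + a * b * 4
      wt = ℕSolver.solve-∀

open NaturalNumberBounds

-- Representation of quadratic integers

module _ (R : CommutativeRing 0ℓ 0ℓ) where
  open CommutativeRing R hiding (refl; sym; trans)
  open OverRing rawRing
  open import Relation.Binary.Reasoning.Setoid setoid

  quadratic⇒integral : ∀ α T D → suc T · α ≈ α * α + suc D · 1# → IsIntegral α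
  quadratic⇒integral α T D eq = 2 , (λ { zero → + suc D ; (suc _) → -[1+ T ] }) , (begin
    α * (α * 1#) + (suc D · 1# * 1# + (- (suc T · 1#) * (α * 1#) + 0#))
      ≈⟨ +-cong (*-congˡ (*-identityʳ α)) (+-cong (*-identityʳ _) (begin
           - (suc T · 1#) * (α * 1#) + 0#  ≈⟨ +-identityʳ _ ⟩
           - (suc T · 1#) * (α * 1#)       ≈⟨ *-congˡ (*-identityʳ α) ⟩
           - (suc T · 1#) * α              ≈⟨ RingProperties.-‿distribˡ-* ring _ _ ⟨
           - (suc T · 1# * α)              ≈⟨
             -‿cong (Multiplication.×-assoc-* semiring (suc T) 1# α) ⟩
           - (suc T · (1# * α))            ≈⟨ -‿cong (×-congʳ (suc T) (*-identityˡ α)) ⟩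
           - (suc T · α)                   ∎)) ⟩
    α * α + (suc D · 1# + - (suc T · α))   ≈⟨ +-assoc _ _ _ ⟨
    α * α + suc D · 1# + - (suc T · α)     ≈⟨ +-congʳ eq ⟨
    suc T · α + - (suc T · α)              ≈⟨ -‿inverseʳ _ ⟩
    0#                                     ∎)
    where open Multiplication semiring using (×-congʳ)

-- An α with (suc T)α = α² + suc D is integral, and it is totally positive because
-- (suc T)σ(α) = σ(α)² + suc D > 0 for every real embedding σ.
Represents : RawRing 0ℓ 0ℓ → ℤForm → Set
Represents R Q = ∀ α T D → IsIntegral α → suc T · α ≡ α * α + suc D · 1# →
  Σ[ v ∈ Vector Carrier (ℤForm.rank Q) ]
    ((∀ i → IsIntegral (v i)) × evalForm (ℤForm.coeff Q) v ≡ α)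
  where
  open RawRing R
  open OverRing R

module _ {a b c : ℕ} where
  open OverRing (rawBiquadratic a b c)
  open BiquadraticRing a b c
  open +-*-Solver

  -- The element u + h√ac is a root of the polynomial with trace 2u = `suc T` and norm u² - ac h² =
  -- `suc D`.
  quadratic-equation : ∀ {u h} T D → double u ≡ ι (+ suc T) →
    u ℚ.* u ≡ ι (+ a) ℚ.* ι (+ c) ℚ.* (h ℚ.* h) ℚ.+ ι (+ suc D) →
    suc T · ⟪ u , 0ℚ , h , 0ℚ ⟫ ≡ ⟪ u , 0ℚ , h , 0ℚ ⟫ * ⟪ u , 0ℚ , h , 0ℚ ⟫ + suc D · embed 1ℚ
  quadratic-equation {u} {h} T D trace norm = begin
    suc T · α
      ≡⟨ cong (suc T ·_) (CommutativeRing.*-identityˡ commutativeRing α) ⟨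
    suc T · (embed 1ℚ * α)
      ≡⟨ Multiplication.×-assoc-* (CommutativeRing.semiring commutativeRing) (suc T) (embed 1ℚ) α ⟨
    suc T · embed 1ℚ * α                            ≡⟨ cong (_* α) (fromℤ-embed a b c (+ suc T)) ⟩
    embed (ι (+ suc T)) * α                         ≡⟨ embed-* (ι (+ suc T)) u 0ℚ h 0ℚ ⟩
    ⟪ ι (+ suc T) ℚ.* u , ι (+ suc T) ℚ.* 0ℚ , ι (+ suc T) ℚ.* h , ι (+ suc T) ℚ.* 0ℚ ⟫
      ≡⟨ cong (λ t → ⟪ t ℚ.* u , t ℚ.* 0ℚ , t ℚ.* h , t ℚ.* 0ℚ ⟫) trace ⟨
    ⟪ double u ℚ.* u , double u ℚ.* 0ℚ , double u ℚ.* h , double u ℚ.* 0ℚ ⟫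
      ≡⟨ cong₄
        (begin
          double u ℚ.* u                 ≡⟨ ℚₚ.*-distribʳ-+ u u u ⟩
          u ℚ.* u ℚ.+ u ℚ.* u            ≡⟨ cong (u ℚ.* u ℚ.+_) norm ⟩
          u ℚ.* u ℚ.+ (A ℚ.* C ℚ.* (h ℚ.* h) ℚ.+ ι (+ suc D))
            ≡⟨ solve 6 (λ u h a b c d → u :* u :+ (a :* c :* (h :* h) :+ d) :=
                 u :* u :+ b :* c :* (con 0ℚ :* con 0ℚ) :+ a :* c :* (h :* h)
                   :+ a :* b :* (con 0ℚ :* con 0ℚ) :+ d) refl
                 u h A B C (ι (+ suc D)) ⟩
          u ℚ.* u ℚ.+ B ℚ.* C ℚ.* (0ℚ ℚ.* 0ℚ) ℚ.+ A ℚ.* C ℚ.* (h ℚ.* h) ℚ.+ A ℚ.* B ℚ.* (0ℚ ℚ.* 0ℚ)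
            ℚ.+ ι (+ suc D) ∎)
        (zeros u h A)
        (solve 3 (λ u h b → (u :+ u) :* h := u :* h :+ h :* u
          :+ b :* (con 0ℚ :* con 0ℚ :+ con 0ℚ :* con 0ℚ) :+ con 0ℚ) refl u h B)
        (solve 3 (λ u h c → (u :+ u) :* con 0ℚ :=
          u :* con 0ℚ :+ con 0ℚ :* u :+ c :* (con 0ℚ :* h :+ h :* con 0ℚ) :+ con 0ℚ) refl u h C) ⟩
    α * α + embed (ι (+ suc D))
      ≡⟨ cong (λ w → α * α + w) (fromℤ-embed a b c (+ suc D)) ⟨
    α * α + suc D · embed 1ℚ                        ∎
    where
    open ≡-Reasoning
    α = ⟪ u , 0ℚ , h , 0ℚ ⟫
    A B C : ℚ
    A = ι (+ a)
    B = ι (+ b)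
    C = ι (+ c)
    zeros = solve 3 (λ u h a → (u :+ u) :* con 0ℚ :=
      u :* con 0ℚ :+ con 0ℚ :* u :+ a :* (h :* con 0ℚ :+ con 0ℚ :* h) :+ con 0ℚ) refl

  represents-quadratic : ∀ {Q u h} → Represents (rawBiquadratic a b c) Q → ∀ T D →
    double u ≡ ι (+ suc T) →
    u ℚ.* u ≡ ι (+ a) ℚ.* ι (+ c) ℚ.* (h ℚ.* h) ℚ.+ ι (+ suc D) →
    Σ[ v ∈ Vector (Biquadratic a b c) (ℤForm.rank Q) ]
      ((∀ i → IsIntegral (v i)) × evalForm (ℤForm.coeff Q) v ≡ ⟪ u , 0ℚ , h , 0ℚ ⟫)
  represents-quadratic {u = u} {h} rep T D trace norm =
    rep ⟪ u , 0ℚ , h , 0ℚ ⟫ T D (quadratic⇒integral commutativeRing _ T D eq) eq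
    where
    eq = quadratic-equation {u} {h} T D trace norm

-- Contradiction for a well-chosen root √ac

module _ (a b c : ℕ) where
  open OverRing (rawBiquadratic a b c) using (IsIntegral; evalForm)

  private
    2*≡ : ∀ x z → double x ≡ ι z → ι (+ 2) ℚ.* x ≡ ι z
    2*≡ x z eq = trans (solve 1 (λ x → con (ι (+ 2)) :* x := x :+ x) refl x) eq
      where open +-*-Solver

    4*≡ : ∀ x z → double (double x) ≡ ι z → ι (+ 4) ℚ.* x ≡ ι z
    4*≡ x z eq = trans (solve 1 (λ x → con (ι (+ 4)) :* x := (x :+ x) :+ (x :+ x)) refl x) eq
      where open +-*-Solver

    4ι : ∀ r → ι (+ 2) ℚ.* ι (+ 2) ℚ.* ι (+ r) ≡ ι (+ (4 ℕ.* r))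
    4ι r = trans (sym (ι-* (+ 4) (+ r))) (cong ι (sym (ℤₚ.pos-* 4 r)))

    8ι : ∀ r → ι (+ 4) ℚ.* ι (+ 4) ℚ.* (½ ℚ.* ι (+ r)) ≡ ι (+ (8 ℕ.* r))
    8ι r = trans (sym (ℚₚ.*-assoc (ι (+ 4) ℚ.* ι (+ 4)) ½ (ι (+ r))))
      (trans (sym (ι-* (+ 8) (+ r))) (cong ι (sym (ℤₚ.pos-* 8 r))))

    4≢0 : ¬ + 4 ≡ + 0
    4≢0 ()

    8≢0 : ¬ + 8 ≡ + 0
    8≢0 ()

  module _ (Q : ℤForm) where
    open ℤForm Q

    module _ (v : Vector (Biquadratic a b c) rank) where
      private
        N : Vector ℤ rank → ℤ
        N = OverRing.evalForm ℤ.+-*-rawRing coeff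

      module _ (ℓ u h : ℚ) (M k : ℕ) (X Y S T : Vector ℤ rank) (k≢0 : ¬ + k ≡ + 0)
        (Qv≡α : evalForm coeff v ≡ ⟪ u , 0ℚ , h , 0ℚ ⟫)
        (v≡ : ∀ j → Coordinates.Scaled a b c ℓ (v j) (X j) (Y j) (S j) (T j))
          (ℓℓu≡ : ℓ ℚ.* ℓ ℚ.* u ≡ ι (+ M)) (ℓℓh≡ : ℓ ℚ.* ℓ ℚ.* h ≡ ι (+ k)) where
        open Coordinates a b c ℓ

        norm-equation : N X ℤ.+ + b ℤ.* + c ℤ.* N Y ℤ.+ + a ℤ.* + c ℤ.* N S ℤ.+ + a ℤ.* + b ℤ.* N T
          ≡ + M
        norm-equation = ι-injective (N X ℤ.+ + b ℤ.* + c ℤ.* N Y ℤ.+ + a ℤ.* + c ℤ.* N S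
          ℤ.+ + a ℤ.* + b ℤ.* N T) (+ M)
          (trans (sym (evalForm-c₁ coeff v X Y S T v≡))
            (trans (cong (λ w → ℓ ℚ.* ℓ ℚ.* c₁ w) Qv≡α) ℓℓu≡))

        polar-nonzero : ¬ (polarForm coeff X S ℤ.+ + b ℤ.* polarForm coeff Y T ≡ + 0)
        polar-nonzero polar≡0 = k≢0 (ι-injective (+ k) (+ 0) (trans (sym ℓℓh≡)
          (trans (cong (λ w → ℓ ℚ.* ℓ ℚ.* cₙ w) (sym Qv≡α))
            (trans (evalForm-cₙ coeff v X Y S T v≡) (cong ι polar≡0)))))

      half-coordinates-value : (∀ j → HalfCoordinates a b c (v j)) → ∀ r →
        evalForm coeff v ≡ ⟪ ι (+ r) , 0ℚ , 1ℚ , 0ℚ ⟫ →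
        ¬ weight a b c 0 1 0 1 ℕ.≤ 4 ℕ.* r → ¬ weight a b c 1 0 4 0 ℕ.≤ 4 ℕ.* r →
          ¬ weight a b c 4 0 1 1 ℕ.≤ 4 ℕ.* r → ⊥
      half-coordinates-value half r Qv≡α = half-contradiction Q a b c (4 ℕ.* r) X Y S T
        -- With ℓ = 2 the coefficients r and 1 of α become 4r and 4; the latter shows that the polar
        -- sum is nonzero.
        (norm-equation (ι (+ 2)) (ι (+ r)) 1ℚ (4 ℕ.* r) 4 X Y S T 4≢0 Qv≡α v≡ (4ι r) refl)
        (polar-nonzero (ι (+ 2)) (ι (+ r)) 1ℚ (4 ℕ.* r) 4 X Y S T 4≢0 Qv≡α v≡ (4ι r) refl)
        (λ j → HalfCoordinates.parity-XY (half j)) (λ j → HalfCoordinates.parity-ST (half j))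
        where
        X Y S T : Vector ℤ rank
        X j = HalfCoordinates.X (half j)
        Y j = HalfCoordinates.Y (half j)
        S j = HalfCoordinates.S (half j)
        T j = HalfCoordinates.T (half j)
        v≡ : ∀ j → Coordinates.Scaled a b c (ι (+ 2)) (v j) (X j) (Y j) (S j) (T j)
        v≡ j = Coordinates.scaled (2*≡ (c₁ (v j)) (X j) (HalfCoordinates.X≡ (half j)))
          (2*≡ (cₘ (v j)) (Y j) (HalfCoordinates.Y≡ (half j)))
          (2*≡ (cₙ (v j)) (S j) (HalfCoordinates.S≡ (half j)))
            (2*≡ (cₖ (v j)) (T j) (HalfCoordinates.T≡ (half j)))

      quarter-coordinates-value : UniformResidues a b c → (∀ j → QuarterCoordinates a b c (v j)) →
        ∀ r → evalForm coeff v ≡ ⟪ ½ ℚ.* ι (+ r) , 0ℚ , ½ , 0ℚ ⟫ →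
        ¬ weight a b c 1 1 1 1 ℕ.≤ 8 ℕ.* r → ¬ weight a b c 4 0 4 0 ℕ.≤ 8 ℕ.* r →
          ¬ weight a b c 0 4 0 4 ℕ.≤ 8 ℕ.* r → ⊥
      quarter-coordinates-value uniform quarter r Qv≡α =
        quarter-contradiction Q a b c (8 ℕ.* r) X Y S T
        -- With ℓ = 4 the coefficients r/2 and 1/2 of α become 8r and 8.
        (norm-equation (ι (+ 4)) (½ ℚ.* ι (+ r)) ½ (8 ℕ.* r) 8 X Y S T 8≢0 Qv≡α v≡ (8ι r) refl)
        (polar-nonzero (ι (+ 4)) (½ ℚ.* ι (+ r)) ½ (8 ℕ.* r) 8 X Y S T 8≢0 Qv≡α v≡ (8ι r) refl)
        (λ j → quarter-parity uniform (quarter j))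
        where
        X Y S T : Vector ℤ rank
        X j = QuarterCoordinates.X (quarter j)
        Y j = QuarterCoordinates.Y (quarter j)
        S j = QuarterCoordinates.S (quarter j)
        T j = QuarterCoordinates.T (quarter j)
        v≡ : ∀ j → Coordinates.Scaled a b c (ι (+ 4)) (v j) (X j) (Y j) (S j) (T j)
        v≡ j = Coordinates.scaled (4*≡ (c₁ (v j)) (X j) (QuarterCoordinates.X≡ (quarter j)))
          (4*≡ (cₘ (v j)) (Y j) (QuarterCoordinates.Y≡ (quarter j)))
          (4*≡ (cₙ (v j)) (S j) (QuarterCoordinates.S≡ (quarter j)))
            (4*≡ (cₖ (v j)) (T j) (QuarterCoordinates.T≡ (quarter j)))

  module _ (Q : ℤForm) where
    open ℤForm Q

    IntegrallyRepresented : Biquadratic a b c → Set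
    IntegrallyRepresented α = Σ[ v ∈ Vector (Biquadratic a b c) rank ]
      ((∀ j → IsIntegral (v j)) × evalForm coeff v ≡ α)

    special-value : SpecialResidues a b c → PairwiseSquareFree a b c → ∀ r →
      IntegrallyRepresented ⟪ ι (+ r) , 0ℚ , 1ℚ , 0ℚ ⟫ →
      ¬ weight a b c 0 1 0 1 ℕ.≤ 4 ℕ.* r → ¬ weight a b c 1 0 4 0 ℕ.≤ 4 ℕ.* r →
        ¬ weight a b c 4 0 1 1 ℕ.≤ 4 ℕ.* r → ⊥
    special-value special sf r (v , v-int , Qv≡α) =
      half-coordinates-value Q v (λ j → half-coordinates {a} {b} {c} {v j} sf special (v-int j)) r
        Qv≡α

    uniform-value : UniformResidues a b c → PairwiseSquareFree a b c → ∀ r →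
      IntegrallyRepresented ⟪ ½ ℚ.* ι (+ r) , 0ℚ , ½ , 0ℚ ⟫ →
      ¬ weight a b c 1 1 1 1 ℕ.≤ 8 ℕ.* r → ¬ weight a b c 4 0 4 0 ℕ.≤ 8 ℕ.* r →
        ¬ weight a b c 0 4 0 4 ℕ.≤ 8 ℕ.* r → ⊥
    uniform-value uniform sf r (v , v-int , Qv≡α) =
      quarter-coordinates-value Q v uniform (λ j →
        quarter-coordinates {a} {b} {c} {v j} sf (v-int j)) r Qv≡α

  private
    trace-norm : ∀ r D → a ℕ.* c ℕ.+ suc D ≡ r ℕ.* r →
      ι (+ r) ℚ.* ι (+ r) ≡ ι (+ a) ℚ.* ι (+ c) ℚ.* (1ℚ ℚ.* 1ℚ) ℚ.+ ι (+ suc D)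
    trace-norm r D split = begin
      ι (+ r) ℚ.* ι (+ r)                  ≡⟨ ι-* (+ r) (+ r) ⟨
      ι (+ r ℤ.* + r)                      ≡⟨
        cong ι (trans (sym (ℤₚ.pos-* r r)) (trans (cong +_ (sym split))
        (cong (ℤ._+ + suc D) (ℤₚ.pos-* a c)))) ⟩
      ι (+ a ℤ.* + c ℤ.+ + suc D)          ≡⟨ ι-+ (+ a ℤ.* + c) (+ suc D) ⟩
      ι (+ a ℤ.* + c) ℚ.+ ι (+ suc D)      ≡⟨
        cong (ℚ._+ ι (+ suc D)) (trans (ι-* (+ a) (+ c))
        (sym (ℚₚ.*-identityʳ (ι (+ a) ℚ.* ι (+ c))))) ⟩
      ι (+ a) ℚ.* ι (+ c) ℚ.* (1ℚ ℚ.* 1ℚ) ℚ.+ ι (+ suc D) ∎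
      where open ≡-Reasoning

    half-trace-norm : ∀ r D → a ℕ.* c ℕ.+ 4 ℕ.* suc D ≡ r ℕ.* r →
      ½ ℚ.* ι (+ r) ℚ.* (½ ℚ.* ι (+ r)) ≡ ι (+ a) ℚ.* ι (+ c) ℚ.* (½ ℚ.* ½) ℚ.+ ι (+ suc D)
    half-trace-norm r D split = begin
      ½ ℚ.* ι (+ r) ℚ.* (½ ℚ.* ι (+ r))    ≡⟨
        solve 1 (λ x → con ½ :* x :* (con ½ :* x) := con (½ ℚ.* ½) :* (x :* x)) refl (ι (+ r)) ⟩
      ½ ℚ.* ½ ℚ.* (ι (+ r) ℚ.* ι (+ r))    ≡⟨
        cong (½ ℚ.* ½ ℚ.*_) (trans (sym (ι-* (+ r) (+ r))) (cong ι square)) ⟩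
      ½ ℚ.* ½ ℚ.* ι (+ a ℤ.* + c ℤ.+ + 4 ℤ.* + suc D)
        ≡⟨ cong (½ ℚ.* ½ ℚ.*_) (proj₂ (integer (+ a) ⊗ integer (+ c)
          ⊕ integer (+ 4) ⊗ integer (+ suc D))) ⟨
      ½ ℚ.* ½ ℚ.* (ι (+ a) ℚ.* ι (+ c) ℚ.+ ι (+ 4) ℚ.* ι (+ suc D))
        ≡⟨ solve 2 (λ x y → con (½ ℚ.* ½) :* (x :+ con (ι (+ 4)) :* y) :=
          x :* con (½ ℚ.* ½) :+ y) refl (ι (+ a) ℚ.* ι (+ c)) (ι (+ suc D)) ⟩
      ι (+ a) ℚ.* ι (+ c) ℚ.* (½ ℚ.* ½) ℚ.+ ι (+ suc D) ∎
      where
      open ≡-Reasoning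
      open +-*-Solver
      square : + r ℤ.* + r ≡ + a ℤ.* + c ℤ.+ + 4 ℤ.* + suc D
      square = trans (sym (ℤₚ.pos-* r r)) (trans (cong +_ (sym split))
        (cong₂ ℤ._+_ (ℤₚ.pos-* a c) (ℤₚ.pos-* 4 (suc D))))

    double-trace : ∀ r T → r ℕ.+ r ≡ T → double (ι (+ r)) ≡ ι (+ T)
    double-trace r T eq = trans (sym (ι-+ (+ r) (+ r))) (cong (λ n → ι (+ n)) eq)

    double-half : ∀ r → double (½ ℚ.* ι (+ r)) ≡ ι (+ r)
    double-half r = solve 1 (λ x → con ½ :* x :+ con ½ :* x := x) refl (ι (+ r))
      where open +-*-Solver

  special-not-represented : ∀ Q → PairwiseSquareFree a b c → SpecialResidues a b c → c ℕ.< b →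
    3 ℕ.≤ b → 1 ℕ.< a ℕ.* c →
    ¬ Represents (rawBiquadratic a b c) Q
  special-not-represented Q sf special c<b 3≤b 1<ac rep =
    start (isqrt (a ℕ.* c) 1<ac (proj₁ (proj₂ sf)))
    where
    trace : ∀ i → suc (suc i) ℕ.+ suc (suc i) ≡ suc (suc (2 ℕ.* suc i))
    trace = ℕSolver.solve-∀
    conclude : ∀ r T → r ℕ.+ r ≡ suc T → ∀ D → a ℕ.* c ℕ.+ suc D ≡ r ℕ.* r →
      ¬ weight a b c 0 1 0 1 ℕ.≤ 4 ℕ.* r →
      ¬ weight a b c 1 0 4 0 ℕ.≤ 4 ℕ.* r → ¬ weight a b c 4 0 1 1 ℕ.≤ 4 ℕ.* r → ⊥
    conclude r T trace D split = special-value Q special sf r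
      (represents-quadratic {a} {b} {c} {Q} {ι (+ r)} {1ℚ} rep T D (double-trace r (suc T) trace)
        (trace-norm r D split))
    start : ∃[ i ] (suc i ℕ.* suc i ℕ.< a ℕ.* c × a ℕ.* c ℕ.< suc (suc i) ℕ.* suc (suc i)) → ⊥
    start (i , t²<ac , ac<r²) = conclude (suc (suc i)) (suc (2 ℕ.* suc i)) (trace i)
      -- The norm r² - ac of α is positive; D is its predecessor.
      (suc (suc i) ℕ.* suc (suc i) ℕ.∸ suc (a ℕ.* c))
      (trans (ℕₚ.+-suc (a ℕ.* c) _) (ℕₚ.m+[n∸m]≡n ac<r²)) ¬0101 ¬1040 ¬4011
      where open HalfBounds a b c i t²<ac c<b 3≤b

  uniform-not-represented : ∀ Q → PairwiseSquareFree a b c → UniformResidues a b c → 5 ℕ.≤ b → ∀ n →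
    a ℕ.* c ≡ 1 ℕ.+ 4 ℕ.* n →
    1 ℕ.< a ℕ.* c → ¬ a ℕ.* c ≡ 5 → ¬ Represents (rawBiquadratic a b c) Q
  uniform-not-represented Q sf uniform 5≤b n ac≡ 1<ac ac≢5 rep =
    start (pronic-interval n (subst (1 ℕ.<_) ac≡ 1<ac) (λ eq →
      ac≢5 (trans ac≡ eq)) (subst SquareFree ac≡ (proj₁ (proj₂ sf))))
    where
    expand₃ : ∀ i → (3 ℕ.+ 2 ℕ.* i) ℕ.* (3 ℕ.+ 2 ℕ.* i) ≡ 1 ℕ.+ 4 ℕ.* (suc i ℕ.* suc (suc i))
    expand₃ = ℕSolver.solve-∀
    expand₅ : ∀ i → (5 ℕ.+ 2 ℕ.* i) ℕ.* (5 ℕ.+ 2 ℕ.* i) ≡ 1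
      ℕ.+ 4 ℕ.* (suc (suc i) ℕ.* suc (suc (suc i)))
    expand₅ = ℕSolver.solve-∀
    distrib : ∀ n d → 1 ℕ.+ 4 ℕ.* (n ℕ.+ d) ≡ 1 ℕ.+ 4 ℕ.* n ℕ.+ 4 ℕ.* d
    distrib = ℕSolver.solve-∀
    conclude : ∀ r T → r ≡ suc T → ∀ D → a ℕ.* c ℕ.+ 4 ℕ.* suc D ≡ r ℕ.* r →
      ¬ weight a b c 1 1 1 1 ℕ.≤ 8 ℕ.* r →
      ¬ weight a b c 4 0 4 0 ℕ.≤ 8 ℕ.* r → ¬ weight a b c 0 4 0 4 ℕ.≤ 8 ℕ.* r → ⊥
    conclude r T r≡ D split = uniform-value Q uniform sf r
      (represents-quadratic {a} {b} {c} {Q} {½ ℚ.* ι (+ r)} {½} rep T D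
        (trans (double-half r) (cong (λ n → ι (+ n)) r≡))
        (half-trace-norm r D split))
    start : ∃[ i ] (suc i ℕ.* suc (suc i) ℕ.< n × n ℕ.< suc (suc i) ℕ.* suc (suc (suc i))) → ⊥
    start (i , <n , n<) = conclude (5 ℕ.+ 2 ℕ.* i) (4 ℕ.+ 2 ℕ.* i) refl D
      (trans (cong (ℕ._+ 4 ℕ.* suc D) ac≡) (trans (sym (distrib n (suc D)))
        (trans (cong (λ m → 1 ℕ.+ 4 ℕ.* m)
        (trans (ℕₚ.+-suc n D) (ℕₚ.m+[n∸m]≡n n<))) (sym (expand₅ i))))) ¬1111 ¬4040 ¬0404
      where
      open QuarterBounds a b c i (subst₂ ℕ._<_ (sym (expand₃ i)) (sym ac≡)
        (ℕₚ.+-monoʳ-< 1 (ℕₚ.*-monoʳ-< 4 <n))) 5≤b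
      -- The norm of α is (r² - ac)/4, where r² = 1 + 4 (i + 2)(i + 3) and ac = 1 + 4n; D is its
      -- predecessor.
      D : ℕ
      D = suc (suc i) ℕ.* suc (suc (suc i)) ℕ.∸ suc n

-- Transport along isomorphisms and change of basis

module _ {R S : RawRing 0ℓ 0ℓ} {f : RawRing.Carrier R → RawRing.Carrier S} {g : RawRing.Carrier S →
  RawRing.Carrier R}
  (f-hom : IsHom R S f) (fg≡id : ∀ x → f (g x) ≡ x) where
  private
    module R = RawRing R
    module S = RawRing S

  inverse-isHom : (∀ x → g (f x) ≡ x) → IsHom S R g
  inverse-isHom gf≡id = record
    { +-hom   = λ x y → trans (cong g (trans (cong₂ S._+_ (sym (fg≡id x)) (sym (fg≡id y)))
      (sym (+-hom (g x) (g y))))) (gf≡id _)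
    ; *-hom   = λ x y → trans (cong g (trans (cong₂ S._*_ (sym (fg≡id x)) (sym (fg≡id y)))
      (sym (*-hom (g x) (g y))))) (gf≡id _)
    ; neg-hom = λ x → trans (cong g (trans (cong S.-_ (sym (fg≡id x))) (sym (neg-hom (g x)))))
      (gf≡id _)
    ; 0-hom   = trans (cong g (sym 0-hom)) (gf≡id _)
    ; 1-hom   = trans (cong g (sym 1-hom)) (gf≡id _)
    }
    where open IsHom f-hom

  -- The condition on α is a polynomial equation rather than positivity under embeddings, so it
  -- passes through any isomorphism without a comparison of real embeddings.
  represents-transport : IsHom S R g → (∀ {x y} → x R.≈ y → f x S.≈ f y) →
    (∀ {x y} → x S.≈ y → g x R.≈ g y) →
    ∀ {Q} → Represents R Q → Represents S Q
  represents-transport g-hom f-cong g-cong {Q} rep α T D α-int eq =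
    map (rep (g α) T D (G.integral-hom g-cong α-int) equation)
    where
    module F = IsHom f-hom
    module G = IsHom g-hom
    open ℤForm Q
    equation : OverRing._·_ R (suc T) (g α) ≡ (g α R.* g α) R.+ OverRing._·_ R (suc D) R.1#
    equation = trans (sym (G.·-hom (suc T) α)) (trans (cong g eq) (trans (G.+-hom _ _)
      (cong₂ R._+_ (G.*-hom α α) (trans (G.·-hom (suc D) S.1#)
        (cong (OverRing._·_ R (suc D)) G.1-hom)))))
    map : Σ[ v ∈ Vector R.Carrier rank ] ((∀ i → OverRing.IsIntegral R (v i))
      × OverRing.evalForm R coeff v ≡ g α) →
          Σ[ v ∈ Vector S.Carrier rank ] ((∀ i → OverRing.IsIntegral S (v i))
            × OverRing.evalForm S coeff v ≡ α)
    map (v , v-int , Qv≡gα) = f ∘ v , (λ i → F.integral-hom f-cong (v-int i)) ,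
      trans (sym (F.evalForm-hom coeff v)) (trans (cong f Qv≡gα) (fg≡id α))

represents-swap₁₂ : ∀ {a b c Q} → Represents (rawBiquadratic a b c) Q →
  Represents (rawBiquadratic b a c) Q
represents-swap₁₂ {Q = Q} = represents-transport swap₁₂-isHom (λ _ →
  refl) swap₁₂-isHom (cong swap₁₂) (cong swap₁₂) {Q}

represents-swap₂₃ : ∀ {a b c Q} → Represents (rawBiquadratic a b c) Q →
  Represents (rawBiquadratic a c b) Q
represents-swap₂₃ {Q = Q} = represents-transport swap₂₃-isHom (λ _ →
  refl) swap₂₃-isHom (cong swap₂₃) (cong swap₂₃) {Q}

module _ (u w g : ℕ) .{{_ : ℕ.NonZero g}} where
  private
    G 1/G : ℚ
    G = ι (+ g)

    instance
      G≢0 : ℚ.NonZero G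
      G≢0 = ℚ.≢-nonZero λ G≡0 → ℕ.≢-nonZero⁻¹ g (ℤₚ.+-injective (ι-injective (+ g) (+ 0) G≡0))

    1/G = ℚ.1/ G

  -- With p = u g and q = w g one has √p√q = g√(w u), so the last coordinate is multiplied by g.
  toBiquadratic : K (u ℕ.* g) (w ℕ.* g) → Biquadratic w u g
  toBiquadratic ⟨ x , y , s , t ⟩ = ⟪ x , y , s , G ℚ.* t ⟫

  fromBiquadratic : Biquadratic w u g → K (u ℕ.* g) (w ℕ.* g)
  fromBiquadratic ⟪ x , y , s , t ⟫ = ⟨ x , y , s , 1/G ℚ.* t ⟩

  toBiquadratic-isHom : IsHom (K-rawRing (u ℕ.* g) (w ℕ.* g)) (rawBiquadratic w u g) toBiquadratic
  toBiquadratic-isHom = record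
    { +-hom   = λ { ⟨ _ , _ , _ , t ⟩ ⟨ _ , _ , _ , t′ ⟩ →
      cong₄ refl refl refl (ℚₚ.*-distribˡ-+ G t t′) }
    ; *-hom   = *-hom
    ; neg-hom = λ { ⟨ _ , _ , _ , t ⟩ → cong₄ refl refl refl (sym (ℚₚ.neg-distribʳ-* G t)) }
    ; 0-hom   = cong₄ refl refl refl (ℚₚ.*-zeroʳ G)
    ; 1-hom   = cong₄ refl refl refl (ℚₚ.*-zeroʳ G)
    }
    where
    open +-*-Solver
    W U : ℚ
    W = ι (+ w)
    U = ι (+ u)
    ι-product : ∀ m n → ι (+ (m ℕ.* n)) ≡ ι (+ m) ℚ.* ι (+ n)
    ι-product m n = trans (cong ι (ℤₚ.pos-* m n)) (ι-* (+ m) (+ n))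
    *-hom : ∀ x y → toBiquadratic (x *K y) ≡ BiquadraticRing._*_ w u g (toBiquadratic x)
      (toBiquadratic y)
    *-hom ⟨ x , y , s , t ⟩ ⟨ x′ , y′ , s′ , t′ ⟩ = cong₄
      (trans (cong₂ (λ P Q → x ℚ.* x′ ℚ.+ P ℚ.* (y ℚ.* y′) ℚ.+ Q ℚ.* (s ℚ.* s′)
        ℚ.+ P ℚ.* Q ℚ.* (t ℚ.* t′)) (ι-product u g) (ι-product w g))
        (solve 8 (λ X Y S t t′ w u g →
          X :+ u :* g :* Y :+ w :* g :* S :+ u :* g :* (w :* g) :* (t :* t′) :=
          X :+ u :* g :* Y :+ w :* g :* S :+ w :* u :* (g :* t :* (g :* t′))) refl
          (x ℚ.* x′) (y ℚ.* y′) (s ℚ.* s′) t t′ W U G))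
      (trans (cong (λ Q → x ℚ.* y′ ℚ.+ y ℚ.* x′ ℚ.+ Q ℚ.* (s ℚ.* t′ ℚ.+ t ℚ.* s′)) (ι-product w g))
        (scale (x ℚ.* y′ ℚ.+ y ℚ.* x′) W G s t s′ t′))
      (trans (cong (λ P → x ℚ.* s′ ℚ.+ s ℚ.* x′ ℚ.+ P ℚ.* (y ℚ.* t′ ℚ.+ t ℚ.* y′)) (ι-product u g))
        (scale (x ℚ.* s′ ℚ.+ s ℚ.* x′) U G y t y′ t′))
      (solve 9 (λ g x y s t x′ y′ s′ t′ →
        g :* (x :* t′ :+ t :* x′ :+ y :* s′ :+ s :* y′) :=
        x :* (g :* t′) :+ g :* t :* x′ :+ g :* (y :* s′ :+ s :* y′)) refl G x y s t x′ y′ s′ t′)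
      where
      scale = solve 7 (λ X w g s t s′ t′ →
        X :+ w :* g :* (s :* t′ :+ t :* s′) := X :+ w :* (s :* (g :* t′) :+ g :* t :* s′)) refl

  represents-toBiquadratic : ∀ {Q} → Represents (K-rawRing (u ℕ.* g) (w ℕ.* g)) Q →
    Represents (rawBiquadratic w u g) Q
  represents-toBiquadratic {Q} = represents-transport toBiquadratic-isHom to∘from
    (inverse-isHom toBiquadratic-isHom to∘from from∘to) (cong toBiquadratic)
      (cong fromBiquadratic) {Q}
    where
    cancel : ∀ x y t → x ℚ.* y ≡ 1ℚ → x ℚ.* (y ℚ.* t) ≡ t
    cancel x y t xy≡1 = trans (sym (ℚₚ.*-assoc x y t))
      (trans (cong (ℚ._* t) xy≡1) (ℚₚ.*-identityˡ t))
    to∘from : ∀ x → toBiquadratic (fromBiquadratic x) ≡ x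
    to∘from ⟪ x , y , s , t ⟫ = cong₄ refl refl refl (cancel G 1/G t (ℚₚ.*-inverseʳ G))
    from∘to : ∀ x → fromBiquadratic (toBiquadratic x) ≡ x
    from∘to ⟨ x , y , s , t ⟩ = cong (λ t → ⟨ x , y , s , t ⟩) (cancel 1/G G t (ℚₚ.*-inverseˡ G))

-- Total positivity

open ℝ

½*-pos : ∀ {ε} → 0ℚ ℚ.< ε → 0ℚ ℚ.< ½ ℚ.* ε
½*-pos {ε} 0<ε = subst (ℚ._< ½ ℚ.* ε) (ℚₚ.*-zeroʳ ½) (ℚₚ.*-monoʳ-<-pos ½ 0<ε)

½+½ : ∀ ε → ½ ℚ.* ε ℚ.+ ½ ℚ.* ε ≡ ε
½+½ ε = trans (sym (ℚₚ.*-distribʳ-+ ε ½ ½)) (ℚₚ.*-identityˡ ε)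

∣x-y+z-w∣<ε : ∀ {ε} x y z w → ∣ x ℚ.- y ∣ ℚ.< ½ ℚ.* ε → ∣ z ℚ.- w ∣ ℚ.< ½ ℚ.* ε →
  ∣ (x ℚ.- y) ℚ.+ (z ℚ.- w) ∣ ℚ.< ε
∣x-y+z-w∣<ε {ε} x y z w p q = ℚₚ.≤-<-trans (ℚₚ.∣p+q∣≤∣p∣+∣q∣ (x ℚ.- y) (z ℚ.- w))
  (subst (∣ x ℚ.- y ∣ ℚ.+ ∣ z ℚ.- w ∣ ℚ.<_) (½+½ ε) (ℚₚ.+-mono-< p q))

≈ℝ-refl : ∀ {x} → x ≈ℝ x
≈ℝ-refl {x} ε 0<ε = 0 , λ n _ → subst (λ d → ∣ d ∣ ℚ.< ε) (sym (ℚₚ.+-inverseʳ (seq x n))) 0<ε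

≈ℝ-sym : ∀ {x y} → x ≈ℝ y → y ≈ℝ x
≈ℝ-sym {x} {y} h ε 0<ε with N , close ← h ε 0<ε = N , λ n N≤n → subst (ℚ._< ε)
  (trans (sym (ℚₚ.∣-p∣≡∣p∣ (seq x n ℚ.- seq y n)))
    (cong ∣_∣ (solve 2 (λ x y → :- (x :- y) := y :- x) refl (seq x n) (seq y n))))
  (close n N≤n)
  where open +-*-Solver

≈ℝ-trans : ∀ {x y z} → x ≈ℝ y → y ≈ℝ z → x ≈ℝ z
≈ℝ-trans {x} {y} {z} p q ε 0<ε
  with M , x≈y ← p (½ ℚ.* ε) (½*-pos 0<ε) | N , y≈z ← q (½ ℚ.* ε) (½*-pos 0<ε) =
  M ℕ.⊔ N , λ n n≥ → subst (λ d → ∣ d ∣ ℚ.< ε)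
    (solve 3 (λ x y z → (x :- y) :+ (y :- z) := x :- z) refl (seq x n) (seq y n) (seq z n))
    (∣x-y+z-w∣<ε (seq x n) (seq y n) (seq y n) (seq z n) (x≈y n (ℕₚ.m⊔n≤o⇒m≤o M N n≥))
      (y≈z n (ℕₚ.m⊔n≤o⇒n≤o M N n≥)))
  where open +-*-Solver

+ℝ-cong : ∀ {x x′ y y′} → x ≈ℝ x′ → y ≈ℝ y′ → (x +ℝ y) ≈ℝ (x′ +ℝ y′)
+ℝ-cong {x} {x′} {y} {y′} p q ε 0<ε
  with M , x≈x′ ← p (½ ℚ.* ε) (½*-pos 0<ε) | N , y≈y′ ← q (½ ℚ.* ε) (½*-pos 0<ε) =
  M ℕ.⊔ N , λ n n≥ → subst (λ d → ∣ d ∣ ℚ.< ε)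
    (solve 4 (λ x x′ y y′ → (x :- x′) :+ (y :- y′) :=
      x :+ y :- (x′ :+ y′)) refl (seq x n) (seq x′ n) (seq y n) (seq y′ n))
    (∣x-y+z-w∣<ε (seq x n) (seq x′ n) (seq y n) (seq y′ n) (x≈x′ n (ℕₚ.m⊔n≤o⇒m≤o M N n≥))
      (y≈y′ n (ℕₚ.m⊔n≤o⇒n≤o M N n≥)))
  where open +-*-Solver

open OverRing ℝ-rawRing using () renaming (_·_ to _·ℝ_)

seq-· : ∀ n x k → seq (n ·ℝ x) k ≡ ι (+ n) ℚ.* seq x k
seq-· zero    x k = sym (ℚₚ.*-zeroˡ (seq x k))
seq-· (suc n) x k = trans (cong (seq x k ℚ.+_) (seq-· n x k))
  (trans (solve 2 (λ n x → x :+ n :* x := (con 1ℚ :+ n) :* x) refl (ι (+ n)) (seq x k))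
    (cong (ℚ._* seq x k) (sym (ι-+ (+ 1) (+ n)))))
  where open +-*-Solver

0≤x*x : ∀ x → 0ℚ ℚ.≤ x ℚ.* x
0≤x*x x = subst (0ℚ ℚ.≤_) (square x) (ℚₚ.0≤∣p∣ (x ℚ.* x))
  where
  square : ∀ x → ∣ x ℚ.* x ∣ ≡ x ℚ.* x
  square x with ℚₚ.∣p∣≡p∨∣p∣≡-p x
  ... | inj₁ eq = trans (ℚₚ.∣p*q∣≡∣p∣*∣q∣ x x) (cong₂ ℚ._*_ eq eq)
  ... | inj₂ eq = trans (ℚₚ.∣p*q∣≡∣p∣*∣q∣ x x) (trans (cong₂ ℚ._*_ eq eq)
          (solve 1 (λ x → :- x :* :- x := x :* x) refl x))
    where open +-*-Solver

module _ {p q : ℕ} where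
  open OverRing (K-rawRing p q) using (_·_)

  module _ (σ : K p q → ℝ) (σ-mono : IsRealEmbedding p q σ) where
    open RingMorphisms (K-rawRing p q) ℝ-rawRing
    open IsRingMonomorphism σ-mono using (+-homo; *-homo; 0#-homo; 1#-homo)

    ·-homo : ∀ n x → σ (n · x) ≈ℝ n ·ℝ σ x
    ·-homo zero    x = 0#-homo
    ·-homo (suc n) x = ≈ℝ-trans {σ (suc n · x)} {σ x +ℝ σ (n · x)} {suc n ·ℝ σ x} (+-homo x (n · x))
      (+ℝ-cong {σ x} {σ x} {σ (n · x)} {n ·ℝ σ x} (≈ℝ-refl {σ x}) (·-homo n x))

    ·1-homo : ∀ n → σ (n · RawRing.1# (K-rawRing p q)) ≈ℝ n ·ℝ constℝ 1ℚ
    ·1-homo zero    = 0#-homo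
    ·1-homo (suc n) = ≈ℝ-trans {σ (suc n · 1K)} {σ 1K +ℝ σ (n · 1K)} {suc n ·ℝ constℝ 1ℚ}
      (+-homo 1K (n · 1K))
      (+ℝ-cong {σ 1K} {constℝ 1ℚ} {σ (n · 1K)} {n ·ℝ constℝ 1ℚ} 1#-homo (·1-homo n))
      where 1K = RawRing.1# (K-rawRing p q)

    -- Every term of the sequence for σ(α)² + `suc D` is at least 1, and eventually it is within ½
    -- of `suc T` times the term of σ(α). That product therefore stays above ½, which explains ε = ½
    -- / `suc T`.
    quadratic-positive : ∀ α T D → suc T · α ≡ (α *K α) +K suc D · RawRing.1# (K-rawRing p q) →
      Positiveℝ (σ α)
    quadratic-positive α T D eq = ε , 0<ε , proj₁ close , λ k k≥ → bound k (proj₂ close k k≥)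
      where
      1K = RawRing.1# (K-rawRing p q)
      n : ℚ
      n = ι (+ suc T)
      s : ℕ → ℚ
      s = seq (σ α)
      rhs : ℝ
      rhs = (σ α *ℝ σ α) +ℝ suc D ·ℝ constℝ 1ℚ
      rhs≈ : rhs ≈ℝ suc T ·ℝ σ α
      rhs≈ = ≈ℝ-trans {rhs} {σ (α *K α) +ℝ σ (suc D · 1K)} {suc T ·ℝ σ α}
        (+ℝ-cong {σ α *ℝ σ α} {σ (α *K α)} {suc D ·ℝ constℝ 1ℚ} {σ (suc D · 1K)}
          (≈ℝ-sym {σ (α *K α)} {σ α *ℝ σ α} (*-homo α α))
            (≈ℝ-sym {σ (suc D · 1K)} {suc D ·ℝ constℝ 1ℚ} (·1-homo (suc D))))
        (≈ℝ-trans {σ (α *K α) +ℝ σ (suc D · 1K)} {σ ((α *K α) +K suc D · 1K)} {suc T ·ℝ σ α}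
          (≈ℝ-sym {σ ((α *K α) +K suc D · 1K)} {σ (α *K α) +ℝ σ (suc D · 1K)}
            (+-homo (α *K α) (suc D · 1K)))
          (subst (λ x → σ x ≈ℝ suc T ·ℝ σ α) eq (·-homo (suc T) α)))
      close = rhs≈ ½ (ℚₚ.positive⁻¹ ½)
      n-pos : ℚ.Positive n
      n-pos = ℚₚ.normalize-pos (suc T) 1
      instance
        n-positive : ℚ.Positive n
        n-positive = n-pos
        n-nonZero : ℚ.NonZero n
        n-nonZero = ℚₚ.pos⇒nonZero n
        n-nonNegative : ℚ.NonNegative n
        n-nonNegative = ℚₚ.pos⇒nonNeg n
      ε : ℚ
      ε = ℚ.1/ n ℚ.* ½
      nε≡½ : n ℚ.* ε ≡ ½
      nε≡½ = trans (sym (ℚₚ.*-assoc n (ℚ.1/ n) ½))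
        (trans (cong (ℚ._* ½) (ℚₚ.*-inverseʳ n)) (ℚₚ.*-identityˡ ½))
      0<ε : 0ℚ ℚ.< ε
      0<ε = ℚₚ.*-cancelˡ-<-nonNeg n (subst₂ ℚ._<_ (sym (ℚₚ.*-zeroʳ n)) (sym nε≡½) (ℚₚ.positive⁻¹ ½))
      -- The sequence of an integer is constant, so index 0 stands for every index.
      1≤D : 1ℚ ℚ.≤ seq (suc D ·ℝ constℝ 1ℚ) 0
      1≤D = nonNeg D
        where
        0≤· : ∀ n → 0ℚ ℚ.≤ seq (n ·ℝ constℝ 1ℚ) 0
        0≤· zero    = ℚₚ.≤-refl
        0≤· (suc n) = ℚₚ.+-mono-≤ (ℚₚ.nonNegative⁻¹ 1ℚ) (0≤· n)
        nonNeg : ∀ n → 1ℚ ℚ.≤ seq (suc n ·ℝ constℝ 1ℚ) 0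
        nonNeg n = ℚₚ.+-mono-≤ (ℚₚ.≤-refl {1ℚ}) (0≤· n)
      bound : ∀ k → ∣ seq rhs k ℚ.- seq (suc T ·ℝ σ α) k ∣ ℚ.< ½ → ε ℚ.< s k
      bound k h = ℚₚ.*-cancelˡ-<-nonNeg n (subst₂ ℚ._<_ (sym nε≡½) (seq-· (suc T) (σ α) k) ½<ns)
        where
        ns r : ℚ
        ns = seq (suc T ·ℝ σ α) k
        r = seq rhs k
        1≤r : 1ℚ ℚ.≤ r
        1≤r = subst (1ℚ ℚ.≤_) (cong (s k ℚ.* s k ℚ.+_)
          (trans (seq-· (suc D) (constℝ 1ℚ) 0) (sym (seq-· (suc D) (constℝ 1ℚ) k))))
          (ℚₚ.+-mono-≤ (0≤x*x (s k)) 1≤D)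
        ½<ns : ½ ℚ.< ns
        ½<ns = subst₂ ℚ._<_ refl (solve 2 (λ r n → r :- (r :- n) := n) refl r ns)
          (ℚₚ.+-mono-≤-< 1≤r (ℚₚ.neg-antimono-< (ℚₚ.≤-<-trans (p≤∣p∣ (r ℚ.- ns)) h)))
          where
          open +-*-Solver
          p≤∣p∣ : ∀ p → p ℚ.≤ ∣ p ∣
          p≤∣p∣ p with ℚₚ.≤-total 0ℚ p
          ... | inj₁ 0≤p = ℚₚ.≤-reflexive (sym (ℚₚ.0≤p⇒∣p∣≡p 0≤p))
          ... | inj₂ p≤0 = ℚₚ.≤-trans p≤0 (ℚₚ.0≤∣p∣ p)

  universal⇒represents : ∀ {Q} → IsUniversal p q Q → Represents (K-rawRing p q) Q
  universal⇒represents universal α T D α-int eq =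
    universal α α-int λ σ σ-mono → quadratic-positive σ σ-mono α T D eq

-- Choice of the root √ac

NonZeroProduct : Fin 4 → Fin 4 → Set
NonZeroProduct i j = ¬ toℕ i ℕ.* toℕ j ℕ.% 4 ≡ 0

NonZeroProduct? : ∀ i j → Dec (NonZeroProduct i j)
NonZeroProduct? i j = ¬? (toℕ i ℕ.* toℕ j ℕ.% 4 ℕₚ.≟ 0)

Uniform : Fin 4 → Fin 4 → Fin 4 → Set
Uniform i j k = i ≡ j × j ≡ k × toℕ i ℕ.% 2 ≡ 1

-- At most one residue is even, and it must be 2; in the role of a it makes both ac and ab equal to
-- 2 modulo 4. If all three are odd but not equal, two agree, and the remaining one in the role of a
-- makes both ac and ab equal to 3.
classify : ∀ i j k → NonZeroProduct j k → NonZeroProduct i k → NonZeroProduct i j →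
  Uniform i j k ⊎ Special i j k ⊎ Special j i k ⊎ Special k i j
classify = from-yes (all-residues₃ _ λ i j k →
  NonZeroProduct? j k →-dec (NonZeroProduct? i k →-dec (NonZeroProduct? i j →-dec
  (((i Finₚ.≟ j) ×-dec (j Finₚ.≟ k) ×-dec (toℕ i ℕ.% 2 ℕₚ.≟ 1)) ⊎-dec
   (Special? i j k ⊎-dec (Special? j i k ⊎-dec Special? k i j))))))

toℕ-residue : ∀ n → toℕ (residue-ℕ n) ≡ n ℕ.% 4
toℕ-residue n = Finₚ.toℕ-fromℕ< _

squareFree⇒nonZeroProduct : ∀ m n → SquareFree (m ℕ.* n) →
  NonZeroProduct (residue-ℕ m) (residue-ℕ n)
squareFree⇒nonZeroProduct m n sf mn≡0 with sf 2
  (m%n≡0⇒n∣m (m ℕ.* n) 4 (trans (ℕ/.%-distribˡ-* m n 4)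
  (trans (cong₂ (λ i j → i ℕ.* j ℕ.% 4) (sym (toℕ-residue m)) (sym (toℕ-residue n))) mn≡0)))
... | ()

squareFree⇒≢0 : ∀ {n} → SquareFree n → ¬ n ≡ 0
squareFree⇒≢0 sf refl with sf 2 (divides 0 refl)
... | ()

odd-square : ∀ (i : Fin 4) → toℕ i ℕ.% 2 ≡ 1 → toℕ i ℕ.* toℕ i ℕ.% 4 ≡ 1
odd-square = from-yes (Finₚ.all? {4} λ i → (toℕ i ℕ.% 2 ℕₚ.≟ 1) →-dec
  (toℕ i ℕ.* toℕ i ℕ.% 4 ℕₚ.≟ 1))

-- Congruent numbers c < b differ by at least 4, and c is at least 1.
5≤ : ∀ b c → 0 < c → c < b → residue-ℕ b ≡ residue-ℕ c → 5 ℕ.≤ b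
5≤ (suc (suc (suc (suc (suc _))))) _ _ _ _ = s≤s (s≤s (s≤s (s≤s (s≤s z≤n))))
5≤ 1 (suc c) _ (s≤s ()) _
5≤ 2 1 _ _ ()
5≤ 2 (suc (suc c)) _ (s≤s (s≤s ())) _
5≤ 3 1 _ _ ()
5≤ 3 2 _ _ ()
5≤ 3 (suc (suc (suc c))) _ (s≤s (s≤s (s≤s ()))) _
5≤ 4 1 _ _ ()
5≤ 4 2 _ _ ()
5≤ 4 3 _ _ ()
5≤ 4 (suc (suc (suc (suc c)))) _ (s≤s (s≤s (s≤s (s≤s ())))) _

3≤ : ∀ b c → 0 < c → c < b → toℕ (residue-ℕ b) ℕ.% 2 ≡ 1 → 3 ℕ.≤ b
3≤ (suc (suc (suc _))) _ _ _ _ = s≤s (s≤s (s≤s z≤n))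
3≤ 1 (suc c) _ (s≤s ()) _
3≤ 2 _ _ _ ()

-- In the presence of squarefreeness, two of the parameters are equal exactly when their product is
-- 1. Distinctness thus says that none of the three roots is rational.
record Distinct (a b c : ℕ) : Set where
  field
    squareFree : PairwiseSquareFree a b c
    a≢b : ¬ a ≡ b
    a≢c : ¬ a ≡ c
    b≢c : ¬ b ≡ c

  0<a*c : 0 < a ℕ.* c
  0<a*c = ℕₚ.n≢0⇒n>0 (squareFree⇒≢0 (proj₁ (proj₂ squareFree)))

  0<c : 0 < c
  0<c = ℕₚ.n≢0⇒n>0 λ { refl → squareFree⇒≢0 (proj₁ squareFree) (ℕₚ.*-zeroʳ b) }

  1<a*c : 1 < a ℕ.* c
  1<a*c = ℕₚ.≤∧≢⇒< 0<a*c λ 1≡ac → a≢c (trans (ℕₚ.m*n≡1⇒m≡1 a c (sym 1≡ac))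
    (sym (ℕₚ.m*n≡1⇒n≡1 a c (sym 1≡ac))))

distinct-swap₁₂ : ∀ {a b c} → Distinct a b c → Distinct b a c
distinct-swap₁₂ {a} {b} {c} d = record
  { squareFree = proj₁ (proj₂ squareFree) , proj₁ squareFree ,
    subst SquareFree (ℕₚ.*-comm a b) (proj₂ (proj₂ squareFree))
  ; a≢b = λ b≡a → a≢b (sym b≡a) ; a≢c = b≢c ; b≢c = a≢c }
  where open Distinct d

distinct-swap₂₃ : ∀ {a b c} → Distinct a b c → Distinct a c b
distinct-swap₂₃ {a} {b} {c} d = record
  { squareFree = subst SquareFree (ℕₚ.*-comm b c) (proj₁ squareFree) , proj₂ (proj₂ squareFree) ,
    proj₁ (proj₂ squareFree)
  ; a≢b = a≢c ; a≢c = a≢b ; b≢c = λ c≡b → b≢c (sym c≡b) }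
  where open Distinct d

module _ (Q : ℤForm) where
  Rep : ℕ → ℕ → ℕ → Set
  Rep a b c = Represents (rawBiquadratic a b c) Q

  swap₁₂-rep : ∀ {a b c} → Rep a b c → Rep b a c
  swap₁₂-rep {a} {b} {c} = represents-swap₁₂ {a} {b} {c} {Q}

  swap₂₃-rep : ∀ {a b c} → Rep a b c → Rep a c b
  swap₂₃-rep {a} {b} {c} = represents-swap₂₃ {a} {b} {c} {Q}

  -- Special residues are symmetric in b and c, so these may be exchanged until c < b. This selects
  -- the smaller of ac and ab, both of which are 2 or 3 modulo 4.
  special-contradiction : ∀ a b c → Distinct a b c → SpecialResidues a b c → ¬ Rep a b c
  special-contradiction a b c d special rep = order (ℕₚ.<-cmp b c)
    where
    open Distinct d
    order : _ → ⊥
    order (tri> _ _ c<b) = special-not-represented a b c Q squareFree special c<b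
      (3≤ b c 0<c c<b (proj₁ special)) 1<a*c rep
    order (tri≈ _ b≡c _) = b≢c b≡c
    order (tri< b<c _ _) = special-not-represented a c b Q (Distinct.squareFree d′) special′ b<c
      (3≤ c b (Distinct.0<c d′) b<c (proj₁ special′)) (Distinct.1<a*c d′)
        (swap₂₃-rep {a} {b} {c} rep)
      where
      d′ = distinct-swap₂₃ d
      special′ : SpecialResidues a c b
      special′ = proj₁ (proj₂ special) , proj₁ special , proj₂ (proj₂ (proj₂ special)) ,
        proj₁ (proj₂ (proj₂ special))

  ordered-uniform-contradiction : ∀ a b c → Distinct a b c → UniformResidues a b c → c < b →
    ¬ a ℕ.* c ≡ 5 → ¬ Rep a b c
  ordered-uniform-contradiction a b c d uniform@(a≡b , b≡c , odd) c<b =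
    uniform-not-represented a b c Q squareFree uniform (5≤ b c 0<c c<b b≡c) (a ℕ.* c ℕ./ 4)
      (trans (ℕ/.m≡m%n+[m/n]*n (a ℕ.* c) 4) (cong₂ ℕ._+_ ac%4≡1 (ℕₚ.*-comm (a ℕ.* c ℕ./ 4) 4)))
        1<a*c
    where
    open Distinct d
    ac%4≡1 : a ℕ.* c ℕ.% 4 ≡ 1
    ac%4≡1 = trans (ℕ/.%-distribˡ-* a c 4) (trans
      (cong₂ (λ i j → i ℕ.* j ℕ.% 4) (sym (toℕ-residue a))
      (trans (sym (toℕ-residue c)) (cong toℕ (sym (trans a≡b b≡c)))))
        (odd-square (residue-ℕ a) odd))

  uniform-swap₁₂ : ∀ {a b c} → UniformResidues a b c → UniformResidues b a c
  uniform-swap₁₂ (a≡b , b≡c , odd) = sym a≡b , trans a≡b b≡c , subst (λ r → toℕ r ℕ.% 2 ≡ 1) a≡b odd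

  uniform-swap₂₃ : ∀ {a b c} → UniformResidues a b c → UniformResidues a c b
  uniform-swap₂₃ (a≡b , b≡c , odd) = trans a≡b b≡c , sym b≡c , odd

  -- If ac = 5, then exchanging the roles of a and b gives another non-maximal
  -- product, which is not 5.
  uniform-contradiction′ : ∀ a b c → Distinct a b c → UniformResidues a b c → c < b → ¬ Rep a b c
  uniform-contradiction′ a b c d uniform c<b rep = split (a ℕ.* c ℕₚ.≟ 5) (ℕₚ.<-cmp a c)
    where
    open Distinct d
    c≢0 : ℕ.NonZero c
    c≢0 = ℕ.>-nonZero 0<c
    a≢0 : ℕ.NonZero a
    a≢0 = ℕ.≢-nonZero λ { refl → ℕₚ.<-irrefl refl 0<a*c }
    split : _ → _ → ⊥
    split (no ac≢5) _ = ordered-uniform-contradiction a b c d uniform c<b ac≢5 rep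
    split (yes ac≡5) (tri> _ _ c<a) = ordered-uniform-contradiction b a c (distinct-swap₁₂ d)
      (uniform-swap₁₂ {a} {b} {c} uniform) c<a
      (λ bc≡5 → a≢b (ℕₚ.*-cancelʳ-≡ a b c {{c≢0}} (trans ac≡5 (sym bc≡5))))
        (swap₁₂-rep {a} {b} {c} rep)
    split (yes ac≡5) (tri≈ _ a≡c _) = a≢c a≡c
    split (yes ac≡5) (tri< a<c _ _) = ordered-uniform-contradiction b c a
      (distinct-swap₂₃ (distinct-swap₁₂ d))
      (uniform-swap₂₃ {b} {a} {c} (uniform-swap₁₂ {a} {b} {c} uniform)) a<c
      (λ ba≡5 → b≢c (ℕₚ.*-cancelˡ-≡ b c a {{a≢0}} (trans (ℕₚ.*-comm a b) (trans ba≡5 (sym ac≡5)))))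
      (swap₂₃-rep {b} {a} {c} (swap₁₂-rep {a} {b} {c} rep))

  uniform-contradiction : ∀ a b c → Distinct a b c → UniformResidues a b c → ¬ Rep a b c
  uniform-contradiction a b c d uniform rep = order (ℕₚ.<-cmp b c)
    where
    order : _ → ⊥
    order (tri> _ _ c<b) = uniform-contradiction′ a b c d uniform c<b rep
    order (tri≈ _ b≡c _) = Distinct.b≢c d b≡c
    order (tri< b<c _ _) = uniform-contradiction′ a c b (distinct-swap₂₃ d)
      (uniform-swap₂₃ {a} {b} {c} uniform) b<c (swap₂₃-rep {a} {b} {c} rep)

  not-represented : ∀ a b c → Distinct a b c → ¬ Rep a b c
  not-represented a b c d rep = cases (classify (residue-ℕ a) (residue-ℕ b) (residue-ℕ c)
    (squareFree⇒nonZeroProduct b c (proj₁ squareFree))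
      (squareFree⇒nonZeroProduct a c (proj₁ (proj₂ squareFree)))
    (squareFree⇒nonZeroProduct a b (proj₂ (proj₂ squareFree))))
    where
    open Distinct d
    cases : _ → ⊥
    cases (inj₁ uniform) = uniform-contradiction a b c d uniform rep
    cases (inj₂ (inj₁ special)) = special-contradiction a b c d special rep
    cases (inj₂ (inj₂ (inj₁ special))) = special-contradiction b a c (distinct-swap₁₂ d) special
      (swap₁₂-rep {a} {b} {c} rep)
    cases (inj₂ (inj₂ (inj₂ special))) = special-contradiction c a b
      (distinct-swap₁₂ (distinct-swap₂₃ d)) special
      (swap₁₂-rep {a} {c} {b} (swap₂₃-rep {a} {b} {c} rep))

-- Reduction of p and q to coprime factors

squareFree-factorˡ : ∀ m n → SquareFree (m ℕ.* n) → SquareFree m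
squareFree-factorˡ m n sf d d²∣m = sf d (∣-trans d²∣m (m∣m*n n))

-- Equality of w with g, or of u with g, would make q or p a square greater than 1; coprimality of u
-- and w makes u w squarefree.
factors-distinct : ∀ u w g → 1 < u ℕ.* g → 1 < w ℕ.* g → ¬ u ℕ.* g ≡ w ℕ.* g →
  SquareFree (u ℕ.* g) → SquareFree (w ℕ.* g) → Coprime u w → Distinct w u g
factors-distinct u w g 1<p 1<q p≢q sfp sfq u⊥w = record
  { squareFree = sfp , sfq , coprime-squareFree-* (Coprimality.sym u⊥w) (squareFree-factorˡ w g sfq)
    (squareFree-factorˡ u g sfp)
  ; a≢b = λ { refl → p≢q refl }
  ; a≢c = not-square sfq 1<q
  ; b≢c = not-square sfp 1<p
  }
  where
  not-square : ∀ {m n} → SquareFree (m ℕ.* n) → 1 < m ℕ.* n → ¬ m ≡ n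
  not-square {m} sf 1<m² refl with sf m (divides 1 (sym (ℕₚ.+-identityʳ (m ℕ.* m))))
  ... | refl = ℕₚ.<-irrefl refl 1<m²

not-universal : ∀ Q u w g → 1 < u ℕ.* g → 1 < w ℕ.* g → u ℕ.* g ≢ w ℕ.* g →
  SquareFree (u ℕ.* g) → SquareFree (w ℕ.* g) → g ≡ gcd (u ℕ.* g) (w ℕ.* g) →
    ¬ IsUniversal (u ℕ.* g) (w ℕ.* g) Q
not-universal Q u w g 1<p 1<q p≢q sfp sfq g≡gcd universal = not-represented Q w u g
  (factors-distinct u w g 1<p 1<q p≢q sfp sfq u⊥w)
  (represents-toBiquadratic u w g {Q} (universal⇒represents {u ℕ.* g} {w ℕ.* g} {Q} universal))
  where
  instance
    g≢0 : ℕ.NonZero g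
    g≢0 = ℕ.≢-nonZero λ { refl → ℕₚ.<⇒≱ 1<p (ℕₚ.≤-trans (ℕₚ.≤-reflexive (ℕₚ.*-zeroʳ u)) z≤n) }
  u⊥w : Coprime u w
  u⊥w {d} (d∣u , d∣w) = ∣1⇒≡1 (*-cancelʳ-∣ g (subst (d ℕ.* g ∣_)
    (trans (sym g≡gcd) (sym (ℕₚ.+-identityʳ g)))
    (gcd-greatest (*-monoˡ-∣ g d∣u) (*-monoˡ-∣ g d∣w))))

theorem5p2 : (p q : ℕ) → 1 < p → 1 < q → p ≢ q → SquareFree p → SquareFree q →
    ¬ (Σ[ Q ∈ ℤForm ] IsUniversal p q Q)
theorem5p2 p q 1<p 1<q p≢q sfp sfq (Q , universal) =
  factor p q (gcd p q) (gcd[m,n]∣m p q) (gcd[m,n]∣n p q) refl 1<p 1<q p≢q sfp sfq universal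
  where
  factor : ∀ p q g → g ∣ p → g ∣ q → g ≡ gcd p q → 1 < p → 1 < q → p ≢ q → SquareFree p →
    SquareFree q → ¬ IsUniversal p q Q
  factor _ _ g (divides u refl) (divides w refl) g≡gcd 1<p 1<q p≢q sfp sfq =
    not-universal Q u w g 1<p 1<q p≢q sfp sfq g≡gcd
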